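{- There exists a cyclically $6$-connected strictly critical snark of order $n$ in each of the following cases: (i) $n\equiv 0\pmod 8$ and $n\ge 320$; (ii) $n\equiv 2\pmod 8$ and $n\ge 306$; (iii) $n\equiv 4\pmod 8$ and $n\ge 324$; (iv) $n\equiv 6\pmod 8$ and $n\ge 342$.
   Context: A snark is a connected cubic graph with chromatic index $4$. A snark is critical if, for every pair of distinct adjacent vertices, the graph obtained by removing these two vertices is $3$-edge-colourable; it is bicritical if the same holds for every pair of distinct vertices; it is strictly critical if it is critical but not bicritical. A cubic graph is cyclically $k$-connected if no set of fewer than $k$ edges separates two cycles of the graph from each other. -}

module Defs where

open import Data.Nat using (ℕ; zero; suc; _+_; _<_)
open import Data.Fin using (Fin; zero; suc; inject₁; fromℕ; _≟_)
open import Data.Bool using (Bool; true; false; T; _∧_; not; _∨_)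
open import Data.List using (List; length; filter)
open import Data.Bool.ListAction using (any)
open import Data.Product using (Σ; _×_; _,_)
open import Data.Empty using (⊥)
open import Relation.Nullary using (¬_)
open import Relation.Nullary.Decidable using (T?; ⌊_⌋)
open import Relation.Binary.PropositionalEquality using (_≡_; _≢_)
open import Relation.Binary.Construct.Closure.ReflexiveTransitive using (Star)
open import Function.Definitions using (Injective)

allVertices : (n : ℕ) → List (Fin n)
allVertices n = Data.List.allFin n

Graph : ℕ → Set
Graph n = Fin n → Fin n → Bool

module _ {n : ℕ} (G : Graph n) where

  Edge : Fin n → Fin n → Set
  Edge i j = T (G i j)

  IsSimpleGraph : Set
  IsSimpleGraph = (∀ i j → G i j ≡ G j i) × (∀ i → G i i ≡ false)

  degree : Fin n → ℕ
  degree i = length (filter (λ j → T? (G i j)) (allVertices n))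

  IsCubic : Set
  IsCubic = ∀ i → degree i ≡ 3

  Connected : Set
  Connected = ∀ i j → Star Edge i j

  IsEdgeColouring : (k : ℕ) → (Fin n → Fin n → Fin k) → Set
  IsEdgeColouring k c =
    (∀ i j → Edge i j → c i j ≡ c j i) ×
    (∀ i j l → Edge i j → Edge i l → j ≢ l → c i j ≢ c i l)

  EdgeColourable : ℕ → Set
  EdgeColourable k = Σ (Fin n → Fin n → Fin k) (IsEdgeColouring k)

  HasChromaticIndex : ℕ → Set
  HasChromaticIndex k = EdgeColourable k × (∀ m → m < k → ¬ EdgeColourable m)

  Cycle : Set
  Cycle = Σ ℕ λ m → Σ (Fin (3 + m) → Fin n) λ f →
            Injective _≡_ _≡_ f ×
            (∀ (i : Fin (2 + m)) → Edge (f (inject₁ i)) (f (suc i))) ×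
            Edge (f (fromℕ (2 + m))) (f zero)

onCycle : {n : ℕ} (G : Graph n) (C : Cycle G) → Fin (3 + Data.Product.proj₁ C) → Fin n
onCycle G (m , f , _) = f

sameEdge : {n : ℕ} → Fin n → Fin n → (Fin n × Fin n) → Bool
sameEdge i j (a , b) = (⌊ a ≟ i ⌋ ∧ ⌊ b ≟ j ⌋) ∨ (⌊ a ≟ j ⌋ ∧ ⌊ b ≟ i ⌋)

deleteEdges : {n : ℕ} → Graph n → List (Fin n × Fin n) → Graph n
deleteEdges G F i j = G i j ∧ not (any (sameEdge i j) F)

-- the graph obtained by deleting the vertices u and v (they are kept as
-- isolated vertices, which does not affect edge-colourability)
deleteTwoVertices : {n : ℕ} → Graph n → Fin n → Fin n → Graph n
deleteTwoVertices G u v i j =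
  G i j ∧ not ⌊ i ≟ u ⌋ ∧ not ⌊ i ≟ v ⌋ ∧ not ⌊ j ≟ u ⌋ ∧ not ⌊ j ≟ v ⌋

SeparatesTwoCycles : {n : ℕ} → Graph n → List (Fin n × Fin n) → Set
SeparatesTwoCycles G F =
  Σ (Cycle (deleteEdges G F)) λ C₁ → Σ (Cycle (deleteEdges G F)) λ C₂ →
    ∀ i j → ¬ Star (Edge (deleteEdges G F)) (onCycle (deleteEdges G F) C₁ i)
                                        (onCycle (deleteEdges G F) C₂ j)

CyclicallyConnected : {n : ℕ} → ℕ → Graph n → Set
CyclicallyConnected k G =
  ∀ (F : List _) → length F < k → ¬ SeparatesTwoCycles G F

IsSnark : {n : ℕ} → Graph n → Set
IsSnark G = IsSimpleGraph G × IsCubic G × Connected G × HasChromaticIndex G 4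

IsCritical : {n : ℕ} → Graph n → Set
IsCritical G = IsSnark G ×
  (∀ u v → u ≢ v → Edge G u v → EdgeColourable (deleteTwoVertices G u v) 3)

IsBicritical : {n : ℕ} → Graph n → Set
IsBicritical G = IsSnark G ×
  (∀ u v → u ≢ v → EdgeColourable (deleteTwoVertices G u v) 3)

IsStrictlyCritical : {n : ℕ} → Graph n → Set
IsStrictlyCritical G = IsCritical G × ¬ IsBicritical G

-- Every edge of Petersen's graph is replaced by a (3,3)-pole obtained from a critical
-- snark by deleting two vertices p and q, and every vertex w by three independent
-- vertices, each joined to one semiedge of each of the three connectors at w. Since a
-- pole carries the same nonzero total colour through both its connectors, a
-- 3-edge-colouring would induce one of Petersen's graph; this needs no condition at
-- one of the vertices w, so two of the three vertices there may even be deleted and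
-- the graph is not bicritical. Deleting the ends of an edge makes the total colour
-- zero possible on one pole, and Petersen's graph minus an edge is colourable.
--
-- For cyclic connectivity, let A have at most five edges on its boundary. A pole cuts
-- at least min(o, 6 - o) of them if o of its six outer neighbours lie in A, which
-- forces all but at most one of the new vertices to lie on one side; on that side the
-- poles are cut so often that A (or its complement) has at most three vertices.
--
-- Flower snarks give poles with 18 + 8t vertices and a snark with 26 vertices gives one
-- with 24; with r of the latter and one long flower the order is 300 + 6r + 8t, where
-- r = 0, 1, 2, 3.

module Submission where

open import Defs
open import Data.Bool using (Bool; T; T?; _xor_; _∧_; _∨_; false; if_then_else_; not; true)
open import Data.Bool.ListAction using (any)
open import Data.Bool.Properties using (T-≡; not-involutive)
open import Data.Empty using (⊥; ⊥-elim)
open import Data.Fin using (#_; Fin; fromℕ; suc; zero)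
open import Data.Fin.Induction using (<-weakInduction)
open import Data.List using (List; []; _++_; _∷_; allFin; cartesianProduct; concatMap; drop; filter; filterᵇ; length; map; reverse)
open import Data.List.Membership.Propositional using (_∈_)
open import Data.List.Membership.Propositional.Properties using (∈-++⁺ʳ; ∈-++⁺ˡ; ∈-++⁻; ∈-allFin; ∈-cartesianProduct⁺; ∈-concat⁺′; ∈-filter⁺; ∈-filter⁻; ∈-map⁺; ∈-map⁻; ∈-∃++)
open import Data.List.Properties using (length-++; length-map; map-++; map-cong; map-∘)
open import Data.List.Relation.Unary.All using (All; []; _∷_)
open import Data.List.Relation.Unary.AllPairs using ([]; _∷_)
open import Data.List.Relation.Unary.Any using (here; there)
open import Data.List.Relation.Unary.Any.Properties using (reverse⁺)
open import Data.List.Relation.Unary.Unique.Propositional using (Unique)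
open import Data.Maybe using (Maybe; just; nothing)
open import Data.Maybe.Properties using (just-injective) renaming (≡-dec to Maybe-≡-dec)
open import Data.Nat using (NonZero; _%_; _*_; _+_; _/_; _<_; _<ᵇ_; _∸_; _≡ᵇ_; _≤_; _≤ᵇ_; _⊓_; suc; s≤s; zero; z≤n; ℕ)
open import Data.Nat.DivMod using (/-monoˡ-≤; _mod_; m*n/n≡m; m≡m%n+[m/n]*n)
open import Data.Nat.ListAction using (sum)
open import Data.Nat.ListAction.Properties using (sum-++; sum-↭)
open import Data.Nat.Solver using (module +-*-Solver)
open import Data.Product using (_,_; _×_; map₁; proj₁; proj₂; Σ; ∃)
open import Data.Product.Properties using () renaming (≡-dec to ×-≡-dec)
open import Data.String using (String; toList)
open import Data.Sum using (_⊎_; inj₁; inj₂)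
open import Data.Sum.Function.Propositional using (_⊎-↔_)
open import Data.Sum.Properties using (inj₁-injective; inj₂-injective) renaming (≡-dec to ⊎-≡-dec)
open import Data.Unit using (tt; ⊤)
open import Function using (Equivalence; Inverse; _↔_; _∘_; id; mk↔ₛ′)
open import Function.Construct.Composition using (_↔-∘_)
open import Function.Construct.Identity using (↔-id)
open import Function.Construct.Symmetry using (↔-sym)
open import Relation.Binary.Construct.Closure.ReflexiveTransitive using (Star; _◅_; _◅◅_; gmap; ε)
open import Relation.Binary.Definitions using (DecidableEquality)
open import Relation.Binary.PropositionalEquality
open import Relation.Nullary using (Dec; does; no; yes; ¬_)
open import Relation.Nullary.Decidable using (_×-dec_; _→-dec_; _⊎-dec_; dec-false; dec-true; map′; toWitness; ¬?; ⌊_⌋)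
import Data.Bool
import Data.Char as Char
import Data.Fin as Fin
import Data.Fin.Properties as Fin
import Data.List.Relation.Binary.Permutation.Propositional.Properties as ↭
import Data.List.Relation.Unary.All as All
import Data.List.Relation.Unary.Unique.Propositional.Properties as Unique
import Data.Nat.Properties as ℕ
import Data.Sum

-- Take the colours to be the nonzero elements of Z₂². They add up to zero at every vertex, so both
-- connectors of a pole have the same total. Total zero means three distinct colours on each
-- connector, and then `p` and `q` could be put back, giving a 3-edge-colouring of the snark. The
-- three totals at a triple of new vertices also add up to zero, so if they are nonzero they are
-- distinct. Every line of the final graph belongs to exactly one pole, the lines to the new
-- vertices included. Criticality is therefore checked in one pole at a time, but that pole, with
-- the ends of a line deleted, has to fit the other fourteen: at an end of the missing edge of
-- Petersen's graph two edges have the same colour, and their connectors must show patterns that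
-- complete the three new vertices. The flowers are unbounded, and this shapes the proof. What is
-- finite is certified by tables or decided by one backtracking search that the type checker
-- evaluates. Colourings of a long flower come from the shortest one by inserting pairs of segments,
-- and its cuts are compared with those of a shorter flower by removing a segment.

∧-true : ∀ a {b} → a ∧ b ≡ true → a ≡ true × b ≡ true
∧-true true eq = refl , eq

if-≤ : ∀ {m n} {b : Bool} → (if m ≤ᵇ n then b else true) ≡ true → m ≤ n → b ≡ true
if-≤ {m} {n} eq m≤n with m ≤ᵇ n | ℕ.≤⇒≤ᵇ m≤n
... | true | _ = eq

every : {A : Set} → (A → Bool) → List A → Bool
every p []       = true
every p (a ∷ as) = p a ∧ every p as

every-sound : {A : Set} (p : A → Bool) → ∀ {as a} → a ∈ as → every p as ≡ true → p a ≡ true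
every-sound p (here refl) eq = proj₁ (∧-true (p _) eq)
every-sound p (there a∈)  eq = every-sound p a∈ (proj₂ (∧-true (p _) eq))

-- Exhaustive search with a budget

module Exhaustion {X D : Set} (_≟_ : DecidableEquality X) (dom : List D) (δ : D → D → ℕ) (d₀ : D) where

  data Item : Set where
    var : X → Item
    pay : X → X → Item

  -- An item list with the variables of its payments replaced by their positions
  -- on the stack of values chosen so far.
  data Code : Set where
    new  : Code
    cost : ℕ → ℕ → Code

  position : X → List X → ℕ
  position x []       = 0
  position x (y ∷ ys) = if does (x ≟ y) then 0 else suc (position x ys)

  _!_ : List D → ℕ → D
  []       ! _     = d₀
  (a ∷ as) ! zero  = a
  (a ∷ as) ! suc i = as ! i

  bound : X → List X → Bool
  bound x []       = false
  bound x (y ∷ ys) = does (x ≟ y) ∨ bound x ys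

  -- Done once before the search, so that evaluating the search never decides equality in `X`.
  compile : List Item → List X → List Code
  compile []             xs = []
  compile (var x ∷ is)   xs = new ∷ compile is (x ∷ xs)
  compile (pay x y ∷ is) xs = cost (position x xs) (position y xs) ∷ compile is xs

  closed : List Item → List X → Bool
  closed []             xs = true
  closed (var x ∷ is)   xs = closed is (x ∷ xs)
  closed (pay x y ∷ is) xs = bound x xs ∧ bound y xs ∧ closed is xs

  -- Proper colourings are assignments of cost 0 for `clash`, small edge cuts are assignments of
  -- small cost for `differ`; a budget covers both. At a leaf, `fin` sees the chosen values, latest
  -- first, and what is left of the budget.
  search : (List D → ℕ → Bool) → List Code → ℕ → List D → Bool
  charge : (List D → ℕ → Bool) → List Code → ℕ → List D → ℕ → Bool
  search fin []             r acc = fin acc r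
  search fin (new ∷ cs)     r acc = every (λ a → search fin cs r (a ∷ acc)) dom
  search fin (cost i j ∷ cs) r acc = charge fin cs r acc (δ (acc ! i) (acc ! j))
  charge fin cs r acc c = if c ≤ᵇ r then search fin cs (r ∸ c) acc else true

  variables : List Item → List X → List X
  variables []             xs = xs
  variables (var x ∷ is)   xs = variables is (x ∷ xs)
  variables (pay x y ∷ is) xs = variables is xs

  total : (X → D) → List Item → ℕ
  total f []             = 0
  total f (var x ∷ is)   = total f is
  total f (pay x y ∷ is) = δ (f x) (f y) + total f is

  lookup-position : ∀ (f : X → D) x xs → bound x xs ≡ true → map f xs ! position x xs ≡ f x
  lookup-position f x (y ∷ ys) eq with x ≟ y
  ... | yes refl = refl
  ... | no _     = lookup-position f x ys eq

  -- The search branches over all of `dom`, so one branch follows `f`. Costs are natural numbers,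
  -- hence no prefix of the payments of `f` exceeds `r` if the total does not; this branch is never
  -- pruned and its leaf is evaluated.
  search-sound : ∀ fin (f : X → D) → (∀ x → f x ∈ dom) → ∀ is xs r →
    closed is xs ≡ true → search fin (compile is xs) r (map f xs) ≡ true →
    total f is ≤ r → fin (map f (variables is xs)) (r ∸ total f is) ≡ true
  search-sound fin f f∈ []             xs r cl eq le = eq
  search-sound fin f f∈ (var x ∷ is)   xs r cl eq le =
    search-sound fin f f∈ is (x ∷ xs) r cl
      (every-sound (λ a → search fin (compile is (x ∷ xs)) r (a ∷ map f xs)) (f∈ x) eq) le
  search-sound fin f f∈ (pay x y ∷ is) xs r cl eq le =
    subst (λ k → fin (map f (variables is xs)) k ≡ true) (ℕ.∸-+-assoc r c (total f is))
      (search-sound fin f f∈ is xs (r ∸ c) (proj₂ clʳ)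
        (if-≤ (subst (λ k → charge fin (compile is xs) r (map f xs) k ≡ true) paid eq)
          (ℕ.≤-trans (ℕ.m≤m+n c (total f is)) le))
        (subst (_≤ r ∸ c) (ℕ.m+n∸m≡n c (total f is)) (ℕ.∸-monoˡ-≤ c le)))
    where
    c : ℕ
    c = δ (f x) (f y)
    clʳ : bound y xs ≡ true × closed is xs ≡ true
    clʳ = ∧-true (bound y xs) (proj₂ (∧-true (bound x xs) cl))
    paid : δ (map f xs ! position x xs) (map f xs ! position y xs) ≡ c
    paid = cong₂ δ (lookup-position f x xs (proj₁ (∧-true (bound x xs) cl)))
                   (lookup-position f y xs (proj₁ clʳ))

-- Poles and what is required of them

Colour : Set
Colour = Fin 3

Rainbow : {K : Set} → (Fin 3 → K) → Set
Rainbow f = ∀ i j → f i ≡ f j → i ≡ j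

Port : Set
Port = Fin 2 × Fin 3

-- A (3,3)-pole, given by its half-edges: those at the vertices (three at each)
-- and the six semiedges, paired up into lines.
record Pole : Set₁ where
  field
    V Line    : Set
    dart      : Line × Bool → (V × Fin 3) ⊎ Port
    line      : (V × Fin 3) ⊎ Port → Line × Bool
    dart-line : ∀ x → dart (line x) ≡ x
    line-dart : ∀ l → line (dart l) ≡ l

  Owner : Set
  Owner = V ⊎ Port

  owner : (V × Fin 3) ⊎ Port → Owner
  owner (inj₁ (v , _)) = inj₁ v
  owner (inj₂ p)       = inj₂ p

  opposite : Line × Bool → Line × Bool
  opposite (l , b) = l , not b

  far : (V × Fin 3) ⊎ Port → (V × Fin 3) ⊎ Port
  far x = dart (opposite (line x))

  inc : V → Fin 3 → Line
  inc v i = proj₁ (line (inj₁ (v , i)))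

  pline : Fin 2 → Fin 3 → Line
  pline σ i = proj₁ (line (inj₂ (σ , i)))

  end : Line → Bool → Owner
  end l b = owner (dart (l , b))

  Adj : V → V → Set
  Adj v w = ∃ λ i → owner (far (inj₁ (v , i))) ≡ inj₁ w

nth : {A : Set} → A → List A → ℕ → A
nth a []       _       = a
nth a (x ∷ xs) zero    = x
nth a (x ∷ xs) (suc i) = nth a xs i

rainbow? : ∀ {k} (f : Fin 3 → Fin k) → Dec (Rainbow f)
rainbow? f = Fin.all? λ i → Fin.all? λ j → (f i Fin.≟ f j) →-dec (i Fin.≟ j)

-- The colour carried by a connector: three nonzero elements of Z₂² that are
-- not pairwise distinct add up to one of themselves.
net : (Fin 3 → Colour) → Maybe Colour
net f = if does (f (# 0) Fin.≟ f (# 1)) then just (f (# 2)) else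
        if does (f (# 0) Fin.≟ f (# 2)) then just (f (# 1)) else
        if does (f (# 1) Fin.≟ f (# 2)) then just (f (# 0)) else nothing

triple : {A : Set} → A → A → A → Fin 3 → A
triple a b c zero             = a
triple a b c (suc zero)       = b
triple a b c (suc (suc zero)) = c

_⊕_ : Colour → ℕ → Colour
c ⊕ k = (Fin.toℕ c + k) mod 3

-- Connector colourings with net colour 0; flower poles do not admit the one singling
-- out position 2 when the other connector is coloured 0 throughout.
pattern₅ : Fin 5 → Fin 3 → Colour
pattern₅ zero                         i    = zero
pattern₅ (suc zero)                   zero = zero
pattern₅ (suc zero)                   i    = # 1
pattern₅ (suc (suc zero))             zero = zero
pattern₅ (suc (suc zero))             i    = # 2
pattern₅ (suc (suc (suc zero)))       (suc zero) = zero
pattern₅ (suc (suc (suc zero)))       i    = # 1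
pattern₅ (suc (suc (suc (suc zero)))) (suc zero) = zero
pattern₅ (suc (suc (suc (suc zero)))) i    = # 2

other : Fin 2 → Fin 2
other zero    = # 1
other (suc _) = # 0

bit : Bool → ℕ
bit false = 0
bit true  = 1

differ : Bool → Bool → ℕ
differ false b = bit b
differ true  b = bit (not b)

ports : List Port
ports = cartesianProduct (allFin 2) (allFin 3)

ones : (Port → Bool) → ℕ
ones b = sum (map (λ p → bit (b p)) ports)

module Cut (X : Pole) where
  open Pole X

  side : (V → Bool) → (Port → Bool) → Owner → Bool
  side A b (inj₁ v) = A v
  side A b (inj₂ p) = b p

  cut : (V → Bool) → (Port → Bool) → Line → ℕ
  cut A b l = differ (side A b (end l false)) (side A b (end l true))

  cutSize : List Line → (V → Bool) → (Port → Bool) → ℕ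
  cutSize ls A b = sum (map (cut A b) ls)

  weight : List V → (V → Bool) → ℕ
  weight vs A = sum (map (λ v → bit (A v)) vs)

  weight-reverse : ∀ vs A → weight (reverse vs) A ≡ weight vs A
  weight-reverse vs A = sum-↭ (↭.map⁺ (λ v → bit (A v)) (↭.↭-reverse vs))

-- net-flow says that every colouring carries one and the same nonzero colour through
-- both connectors; linked bounds cuts from below by the trivial ones.
record IsSuperedge (X : Pole) : Set where
  open Pole X
  open Cut X
  field
    size        : ℕ
    index       : V ↔ Fin size
    _≟ᴸ_        : DecidableEquality Line
    no-loop     : ∀ v i → owner (far (inj₁ (v , i))) ≢ inj₁ v
    no-parallel : ∀ v i j → owner (far (inj₁ (v , i))) ≡ owner (far (inj₁ (v , j))) → i ≡ j
    port-inner  : ∀ p → ∃ λ x → far (inj₂ p) ≡ inj₁ x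
    connected   : ∀ v w → Star Adj v w

    net-flow : ∀ (f : Line → Colour) → (∀ v → Rainbow (f ∘ inc v)) →
               ∃ λ s → ∀ σ → net (f ∘ pline σ) ≡ just s
    -- This is the source of criticality: the ends of `l` are deleted, so nothing is asked of the
    -- vertices on `l` or of a connector containing `l`; any other connector has total zero.
    broken   : ∀ l → ∃ λ (f : Line → Colour) →
               (∀ v → (∀ i → inc v i ≢ l) → Rainbow (f ∘ inc v)) ×
               (∀ σ → (∀ i → pline σ i ≢ l) → Rainbow (f ∘ pline σ))
    -- For the poles away from the deleted line. A pattern can be chosen on one connector only, with
    -- net colour 0; `rotate` provides the other net colours.
    through  : ∀ σ p → ∃ λ (f : Line → Colour) →
               (∀ v → Rainbow (f ∘ inc v)) ×
               (∀ i → f (pline σ i) ≡ pattern₅ p i) ×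
               (∀ i → f (pline (other σ) i) ≡ zero)

    lines        : List Line
    lines-unique : Unique lines
    vertices     : List V
    ∈-vertices   : ∀ v → v ∈ vertices
    linked       : ∀ A b → ones b ⊓ (6 ∸ ones b) ≤ cutSize lines A b
    -- A tree with w vertices in a cubic graph has w + 2 lines on its boundary, and each cycle would
    -- lower this number. So a set that meets at most five lines of the cut has at most three
    -- vertices.
    expanding    : ∀ A → weight vertices A ≡ 0 ⊎
                   6 ⊓ (2 + weight vertices A) ≤ cutSize lines A (λ _ → false)

-- Searches for colourings and for small cuts

∨-true : ∀ a {b} → a ∨ b ≡ true → a ≡ true ⊎ b ≡ true
∨-true true  eq = inj₁ refl
∨-true false eq = inj₂ eq

clash : Colour → Colour → ℕ
clash a b = if does (a Fin.≟ b) then 1 else 0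

∈-Fin3 : (a : Fin 3) → a ∈ allFin 3
∈-Fin3 = ∈-allFin

some : {A : Set} → (A → Bool) → List A → Bool
some p []       = false
some p (a ∷ as) = p a ∨ some p as

some-sound : {A : Set} (p : A → Bool) → ∀ as → some p as ≡ true → ∃ λ a → a ∈ as × p a ≡ true
some-sound p (a ∷ as) eq with p a in pa
... | true  = a , here refl , pa
... | false = let b , b∈ , pb = some-sound p as eq in b , there b∈ , pb

module ColourSearch {X : Set} (_≟_ : DecidableEquality X) (triples : List (Fin 3 → X)) where
  open Exhaustion _≟_ (allFin 3) clash zero public

  meets : X → X → (Fin 3 → X) → Fin 3 → Bool
  meets x y t i = does (x ≟ t i) ∧ some (λ j → not (does (i Fin.≟ j)) ∧ does (y ≟ t j)) (allFin 3)

  touch : X → X → Bool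
  touch x y = some (λ t → some (meets x y t) (allFin 3)) triples

  conflicts : X → List X → List Item
  conflicts x []       = []
  conflicts x (y ∷ ys) = if touch x y then pay x y ∷ conflicts x ys else conflicts x ys

  -- On its introduction a line pays for every earlier line with which it shares a vertex, so budget
  -- 0 admits only proper partial colourings.
  items : List X → List X → List Item
  items []       prev = []
  items (x ∷ xs) prev = var x ∷ conflicts x prev ++ items xs (x ∷ prev)

  reversed : List X → List X → List X
  reversed []       prev = prev
  reversed (x ∷ xs) prev = reversed xs (x ∷ prev)

  variables-items : ∀ xs prev → variables (items xs prev) prev ≡ reversed xs prev
  variables-items []       prev = refl
  variables-items (x ∷ xs) prev = trans (skip prev) (variables-items xs (x ∷ prev))
    where
    skip : ∀ ys → variables (conflicts x ys ++ items xs (x ∷ prev)) (x ∷ prev) ≡ variables (items xs (x ∷ prev)) (x ∷ prev)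
    skip []       = refl
    skip (y ∷ ys) with touch x y
    ... | true  = skip ys
    ... | false = skip ys

  module _ (f : X → Colour) (rainbow : ∀ t → t ∈ triples → Rainbow (f ∘ t)) where

    proper : ∀ x y → touch x y ≡ true → f x ≢ f y
    proper x y eq same with some-sound (λ t → some (meets x y t) (allFin 3)) triples eq
    ... | t , t∈ , eq₁ with some-sound (meets x y t) (allFin 3) eq₁
    ...   | i , _ , eq₂ = contradiction (∧-true (does (x ≟ t i)) eq₂)
      where
      contradiction : does (x ≟ t i) ≡ true × some (λ j → not (does (i Fin.≟ j)) ∧ does (y ≟ t j)) (allFin 3) ≡ true → ⊥
      contradiction (x≡ , eq₃) with some-sound (λ j → not (does (i Fin.≟ j)) ∧ does (y ≟ t j)) (allFin 3) eq₃
      ... | j , _ , eq₄ with i Fin.≟ j | x ≟ t i | y ≟ t j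
      ...   | no i≢j | yes refl | yes refl = i≢j (rainbow t t∈ i j same)

    total-conflicts : ∀ x ys is → total f (conflicts x ys ++ is) ≡ total f is
    total-conflicts x []       is = refl
    total-conflicts x (y ∷ ys) is with touch x y in eq
    ... | false = total-conflicts x ys is
    ... | true with f x Fin.≟ f y
    ...   | yes same = ⊥-elim (proper x y eq same)
    ...   | no _     = total-conflicts x ys is

    total-items : ∀ xs prev → total f (items xs prev) ≡ 0
    total-items []       prev = refl
    total-items (x ∷ xs) prev = trans (total-conflicts x prev (items xs (x ∷ prev))) (total-items xs (x ∷ prev))

    colour-search : ∀ fin xs → closed (items xs []) [] ≡ true →
      search fin (compile (items xs []) []) 0 [] ≡ true →
      fin (map f (reversed xs [])) 0 ≡ true
    colour-search fin xs cl eq =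
      subst₂ (λ ys k → fin (map f ys) k ≡ true) (variables-items xs []) (ℕ.0∸n≡0 (total f (items xs [])))
        (search-sound fin f (λ x → ∈-Fin3 (f x)) (items xs []) [] 0 cl eq (ℕ.≤-reflexive (total-items xs [])))

module CutSearch (X : Pole) (_≟ⱽ_ : DecidableEquality (Pole.V X)) where
  open Pole X
  open Cut X

  _≟ᴼ_ : DecidableEquality Owner
  _≟ᴼ_ = ⊎-≡-dec _≟ⱽ_ (×-≡-dec Fin._≟_ Fin._≟_)

  open Exhaustion _≟ᴼ_ (false ∷ true ∷ []) differ false public

  ∈-Bool : (a : Bool) → a ∈ false ∷ true ∷ []
  ∈-Bool false = here refl
  ∈-Bool true  = there (here refl)

  -- Lines are paid in the order of `ls`, each as soon as both ends have a value. For a concrete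
  -- pole the total is then the sum `cutSize` term by term; a line left unpaid would make the
  -- hypothesis on `total` in the searches below fail.
  schedule : List Owner → List Owner → List Line → List Item
  settle   : List Owner → List Owner → List Line → List Item
  schedule []       prev ls = []
  schedule (o ∷ os) prev ls = var o ∷ settle os (o ∷ prev) ls
  settle os prev []       = schedule os prev []
  settle os prev (l ∷ ls) =
    if bound (end l false) prev ∧ bound (end l true) prev
    then pay (end l false) (end l true) ∷ settle os prev ls
    else schedule os prev (l ∷ ls)

  count : List Bool → ℕ
  count []       = 0
  count (b ∷ bs) = bit b + count bs

  truncate : ∀ {m n} → m ≤ n → n ∸ (n ∸ m) ≡ m
  truncate {m} {n} m≤n = ℕ.m∸[m∸n]≡n m≤n

  half≤3 : ∀ o → o ⊓ (6 ∸ o) ≤ 3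
  half≤3 o with ℕ.≤-total o 3
  ... | inj₁ o≤3 = ℕ.≤-trans (ℕ.m⊓n≤m o (6 ∸ o)) o≤3
  ... | inj₂ 3≤o = ℕ.≤-trans (ℕ.m⊓n≤n o (6 ∸ o)) (ℕ.∸-monoʳ-≤ 6 3≤o)

  -- In the first list the semiedges are chosen before all vertices and in reverse, so that they end
  -- up below the vertices on the stack in the order of `ports`. In the second they are on the stack
  -- from the beginning, with value `false`.
  linked-items expanding-items : List V → List Line → List Item
  linked-items    vs ls = schedule (map inj₂ (reverse ports) ++ map inj₁ vs) [] ls
  expanding-items vs ls = schedule (map inj₁ vs) (map inj₂ ports) ls

  -- The budgets are 2 and 5, so `2 ∸ r` and `5 ∸ r` are the sizes of the cuts found.
  linked-test expanding-test : ℕ → List Bool → ℕ → Bool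
  linked-test    n acc r = let o = count (drop n acc) in (o ⊓ (6 ∸ o)) ≤ᵇ (2 ∸ r)
  expanding-test _ acc r = (count acc ≡ᵇ 0) ∨ ((6 ⊓ (2 + count acc)) ≤ᵇ (5 ∸ r))

  module _ (vs : List V) (ls : List Line) where

    -- The left side never exceeds 3, so only cuts with at most two lines could violate the bound;
    -- hence budget 2. For `expanding-search` the left side is capped at 6 and the budget is 5.
    linked-search : ∀ A b → let is = linked-items vs ls in
      closed is [] ≡ true →
      search (linked-test (length vs)) (compile is []) 2 [] ≡ true →
      total (side A b) is ≡ cutSize ls A b →
      count (drop (length vs) (map (side A b) (variables is []))) ≡ ones b →
      ones b ⊓ (6 ∸ ones b) ≤ cutSize ls A b
    linked-search A b cl eq tot cnt with ℕ.≤-<-connex (cutSize ls A b) 2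
    ... | inj₂ 3≤c = ℕ.≤-trans (half≤3 (ones b)) 3≤c
    ... | inj₁ c≤2 = subst₂ (λ o c → o ⊓ (6 ∸ o) ≤ c) cnt (trans (truncate total≤2) tot)
      (ℕ.≤ᵇ⇒≤ _ _ (Equivalence.from T-≡
        (search-sound (linked-test (length vs)) (side A b) (λ o → ∈-Bool (side A b o)) (linked-items vs ls) [] 2 cl eq total≤2)))
      where
      total≤2 : total (side A b) (linked-items vs ls) ≤ 2
      total≤2 = subst (_≤ 2) (sym tot) c≤2

    expanding-search : ∀ A → let is = expanding-items vs ls; xs = map inj₂ ports in
      closed is xs ≡ true →
      search (expanding-test 0) (compile is xs) 5 (false ∷ false ∷ false ∷ false ∷ false ∷ false ∷ []) ≡ true →
      total (side A (λ _ → false)) is ≡ cutSize ls A (λ _ → false) →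
      count (map (side A (λ _ → false)) (variables is xs)) ≡ weight (reverse vs) A →
      weight vs A ≡ 0 ⊎ 6 ⊓ (2 + weight vs A) ≤ cutSize ls A (λ _ → false)
    expanding-search A cl eq tot cnt with ℕ.≤-<-connex (cutSize ls A (λ _ → false)) 5
    ... | inj₂ 6≤c = inj₂ (ℕ.≤-trans (ℕ.m⊓n≤m 6 _) 6≤c)
    ... | inj₁ c≤5 with ∨-true _ (search-sound (expanding-test 0) (side A (λ _ → false)) (λ o → ∈-Bool (side A (λ _ → false) o))
                          (expanding-items vs ls) (map inj₂ ports) 5 cl eq total≤5)
      where
      total≤5 : total (side A (λ _ → false)) (expanding-items vs ls) ≤ 5
      total≤5 = subst (_≤ 5) (sym tot) c≤5
    ...   | inj₁ empty = inj₁ (trans (sym (trans cnt (weight-reverse vs A))) (ℕ.≡ᵇ⇒≡ _ 0 (Equivalence.from T-≡ empty)))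
    ...   | inj₂ large = inj₂ (subst₂ (λ w c → 6 ⊓ (2 + w) ≤ c) (trans cnt (weight-reverse vs A))
                           (trans (truncate (subst (_≤ 5) (sym tot) c≤5)) tot) (ℕ.≤ᵇ⇒≤ _ _ (Equivalence.from T-≡ large)))

-- The code of the character 0 is 48, a multiple of both moduli 3 and 4 that occur, so a digit below
-- `k` is read as itself.
digits : ∀ k .{{_ : NonZero k}} → String → List (Fin k)
digits k s = map (λ c → Char.toℕ c mod k) (toList s)

equal : Maybe Colour → Maybe Colour → Bool
equal (just s) (just t) = does (s Fin.≟ t)
equal _        _        = false

equal-sound : ∀ a b → equal a b ≡ true → ∃ λ s → a ≡ just s × b ≡ just s
equal-sound (just s) (just t) eq with s Fin.≟ t
... | yes refl = s , refl , refl

module PoleLemmas (X : Pole) where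
  open Pole X

  far-far : ∀ x → far (far x) ≡ x
  far-far x = trans (cong (dart ∘ opposite) (line-dart (opposite (line x))))
    (trans (cong (λ b → dart (proj₁ (line x) , b)) (not-involutive (proj₂ (line x)))) (dart-line x))

  owner⁻¹ : ∀ x {v} → owner x ≡ inj₁ v → ∃ λ i → x ≡ inj₁ (v , i)
  owner⁻¹ (inj₁ (v , i)) refl = i , refl

  owner-port : ∀ x {p} → owner x ≡ inj₂ p → x ≡ inj₂ p
  owner-port (inj₂ p) refl = refl

  adj-sym : ∀ {v w} → Adj v w → Adj w v
  adj-sym {v} (i , eq) with owner⁻¹ (far (inj₁ (v , i))) eq
  ... | j , eq′ = j , cong owner (trans (cong far (sym eq′)) (far-far (inj₁ (v , i))))

  star-sym : ∀ {v w} → Star Adj v w → Star Adj w v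
  star-sym ε       = ε
  star-sym (a ◅ s) = star-sym s ◅◅ (adj-sym a ◅ ε)

  module _ (rank : V → ℕ) (root : V)
           (descend : ∀ v → v ≡ root ⊎ ∃ λ i → ∃ λ w → owner (far (inj₁ (v , i))) ≡ inj₁ w × rank w < rank v) where

    to-root : ∀ k v → rank v < k → Star Adj v root
    to-root (suc k) v (s≤s v≤k) with descend v
    ... | inj₁ refl                = ε
    ... | inj₂ (i , w , eq , w<v) = (i , eq) ◅ to-root k w (ℕ.<-≤-trans w<v v≤k)

    rooted⇒connected : ∀ v w → Star Adj v w
    rooted⇒connected v w = to-root _ v ℕ.≤-refl ◅◅ star-sym (to-root _ w ℕ.≤-refl)

  same-line : ∀ x y → proj₁ (line x) ≡ proj₁ (line y) → x ≡ y ⊎ far x ≡ y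
  same-line x y eq with line x in ex | line y in ey
  same-line x y refl | l , true  | .l , true  = inj₁ (trans (sym (dart-line x)) (trans (cong dart (trans ex (sym ey))) (dart-line y)))
  same-line x y refl | l , true  | .l , false = inj₂ (trans (cong dart (sym ey)) (dart-line y))
  same-line x y refl | l , false | .l , true  = inj₂ (trans (cong dart (sym ey)) (dart-line y))
  same-line x y refl | l , false | .l , false = inj₁ (trans (sym (dart-line x)) (trans (cong dart (trans ex (sym ey))) (dart-line y)))

  module NetFlow (_≟ᴸ_ : DecidableEquality Line) (vertices : List V) (order : List Line) where
    open ColourSearch _≟ᴸ_ (map inc vertices)

    balanced : List ℕ → List Colour → ℕ → Bool
    balanced (i₀ ∷ i₁ ∷ i₂ ∷ j₀ ∷ j₁ ∷ j₂ ∷ []) acc _ =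
      equal (net (triple (acc ! i₀) (acc ! i₁) (acc ! i₂))) (net (triple (acc ! j₀) (acc ! j₁) (acc ! j₂)))
    balanced _ _ _ = true

    port-line : Port → Line
    port-line (σ , i) = pline σ i

    positions : List ℕ
    positions = map (λ p → position (port-line p) (reversed order [])) ports

    -- The third equation guarantees that every semiedge has a value on the stack; a missing one
    -- would silently be read as colour 0.
    net-flow-search :
      closed (items order []) [] ≡ true →
      search (balanced positions) (compile (items order []) []) 0 [] ≡ true →
      every (λ x → x) (map (λ p → bound (port-line p) (reversed order [])) ports) ≡ true →
      ∀ (f : Line → Colour) → (∀ v → Rainbow (f ∘ inc v)) → ∃ λ s → ∀ σ → net (f ∘ pline σ) ≡ just s
    net-flow-search cl eq bd f proper = s , λ { zero → trans net₀ eq₀ ; (suc zero) → trans net₁ eq₁ }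
      where
      rainbow : ∀ t → t ∈ map inc vertices → Rainbow (f ∘ t)
      rainbow t t∈ = let v , _ , t≡ = ∈-map⁻ inc t∈ in subst (λ t → Rainbow (f ∘ t)) (sym t≡) (proper v)
      at : Port → Colour
      at p = map f (reversed order []) ! position (port-line p) (reversed order [])
      at≡ : ∀ p → p ∈ ports → at p ≡ f (port-line p)
      at≡ p p∈ = lookup-position f (port-line p) (reversed order []) (every-sound (λ x → x) (∈-map⁺ (λ p → bound (port-line p) (reversed order [])) p∈) bd)
      found : ∃ λ s → net (triple (at (zero , # 0)) (at (zero , # 1)) (at (zero , # 2))) ≡ just s
                    × net (triple (at (# 1 , # 0)) (at (# 1 , # 1)) (at (# 1 , # 2))) ≡ just s
      found = equal-sound _ _ (colour-search f rainbow (balanced positions) order cl eq)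
      s : Colour
      s = proj₁ found
      eq₀ = proj₁ (proj₂ found)
      eq₁ = proj₂ (proj₂ found)
      net-cong : ∀ {a a′ b b′ c c′ : Colour} → a ≡ a′ → b ≡ b′ → c ≡ c′ → net (triple a b c) ≡ net (triple a′ b′ c′)
      net-cong refl refl refl = refl
      net₀ : net (f ∘ pline zero) ≡ net (triple (at (zero , # 0)) (at (zero , # 1)) (at (zero , # 2)))
      net₀ = sym (net-cong (at≡ _ (here refl)) (at≡ _ (there (here refl))) (at≡ _ (there (there (here refl)))))
      net₁ : net (f ∘ pline (# 1)) ≡ net (triple (at (# 1 , # 0)) (at (# 1 , # 1)) (at (# 1 , # 2)))
      net₁ = sym (net-cong (at≡ _ (there (there (there (here refl))))) (at≡ _ (there (there (there (there (here refl))))))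
                           (at≡ _ (there (there (there (there (there (here refl))))))))

-- In Petersen's graph, replace two adjacent pairs of vertices at distance 2 by dot
-- products with Petersen's graphs from which two opposite edges of the hexagon
-- around p, respectively q, are deleted; this gives a snark on 26 vertices in which
-- every cyclic edge cut with at most five edges separates p from q. The pole results
-- from deleting p and q.
module Pole₂₄ where

  -- Half-edges are numbered 3v + i (v < 24) and, for the semiedges, 72 + 3σ + i;
  -- the two halves of line l have numbers 2l and 2l + 1 in the list of line ends.
  HalfEdge : Set
  HalfEdge = (Fin 24 × Fin 3) ⊎ Port

  dart-table line-table : List ℕ
  dart-table = 74 ∷ 0 ∷ 1 ∷ 3 ∷ 2 ∷ 6 ∷ 4 ∷ 9 ∷ 72 ∷ 12 ∷ 10 ∷ 13 ∷ 7 ∷ 15 ∷ 14 ∷ 16 ∷ 5 ∷ 18 ∷ 73 ∷ 21 ∷ 19 ∷ 22 ∷ 8 ∷ 24 ∷ 23 ∷ 25 ∷ 11 ∷ 27 ∷ 17 ∷ 30 ∷ 28 ∷ 33 ∷ 31 ∷ 34 ∷ 20 ∷ 36 ∷ 35 ∷ 39 ∷ 37 ∷ 40 ∷ 26 ∷ 42 ∷ 41 ∷ 43 ∷ 29 ∷ 45 ∷ 76 ∷ 48 ∷ 46 ∷ 49 ∷ 32 ∷ 51 ∷ 50 ∷ 52 ∷ 38 ∷ 54 ∷ 53 ∷ 57 ∷ 55 ∷ 58 ∷ 75 ∷ 60 ∷ 56 ∷ 61 ∷ 44 ∷ 63 ∷ 62 ∷ 64 ∷ 47 ∷ 66 ∷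 65 ∷ 67 ∷ 77 ∷ 69 ∷ 59 ∷ 70 ∷ 68 ∷ 71 ∷ []
  line-table = 1 ∷ 2 ∷ 4 ∷ 3 ∷ 6 ∷ 16 ∷ 5 ∷ 12 ∷ 22 ∷ 7 ∷ 10 ∷ 26 ∷ 9 ∷ 11 ∷ 14 ∷ 13 ∷ 15 ∷ 28 ∷ 17 ∷ 20 ∷ 34 ∷ 19 ∷ 21 ∷ 24 ∷ 23 ∷ 25 ∷ 40 ∷ 27 ∷ 30 ∷ 44 ∷ 29 ∷ 32 ∷ 50 ∷ 31 ∷ 33 ∷ 36 ∷ 35 ∷ 38 ∷ 54 ∷ 37 ∷ 39 ∷ 42 ∷ 41 ∷ 43 ∷ 64 ∷ 45 ∷ 48 ∷ 68 ∷ 47 ∷ 49 ∷ 52 ∷ 51 ∷ 53 ∷ 56 ∷ 55 ∷ 58 ∷ 62 ∷ 57 ∷ 59 ∷ 74 ∷ 61 ∷ 63 ∷ 66 ∷ 65 ∷ 67 ∷ 70 ∷ 69 ∷ 71 ∷ 76 ∷ 73 ∷ 75 ∷ 77 ∷ 8 ∷ 18 ∷ 0 ∷ 60 ∷ 46 ∷ 72 ∷ []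

  dart₂₄ : Fin 39 × Bool → HalfEdge
  dart₂₄ (l , b) = decode (nth 0 dart-table (2 * Fin.toℕ l + bit b))
    where
    decode : ℕ → HalfEdge
    decode d = if d <ᵇ 72 then inj₁ ((d / 3) mod 24 , d mod 3) else inj₂ ((d / 3) mod 2 , d mod 3)

  line₂₄ : HalfEdge → Fin 39 × Bool
  line₂₄ x = decode (nth 0 line-table (code x))
    where
    code : HalfEdge → ℕ
    code (inj₁ (v , i)) = 3 * Fin.toℕ v + Fin.toℕ i
    code (inj₂ (σ , i)) = 72 + 3 * Fin.toℕ σ + Fin.toℕ i
    decode : ℕ → Fin 39 × Bool
    decode e = (e / 2) mod 39 , (e % 2 ≡ᵇ 1)

  _≟ᴴ_ : DecidableEquality HalfEdge
  _≟ᴴ_ = ⊎-≡-dec (×-≡-dec Fin._≟_ Fin._≟_) (×-≡-dec Fin._≟_ Fin._≟_)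

  dart-line₂₄ : ∀ x → dart₂₄ (line₂₄ x) ≡ x
  dart-line₂₄ (inj₁ (v , i)) = toWitness {a? = Fin.all? λ v → Fin.all? λ i → dart₂₄ (line₂₄ (inj₁ (v , i))) ≟ᴴ inj₁ (v , i)} _ v i
  dart-line₂₄ (inj₂ (σ , i)) = toWitness {a? = Fin.all? λ σ → Fin.all? λ i → dart₂₄ (line₂₄ (inj₂ (σ , i))) ≟ᴴ inj₂ (σ , i)} _ σ i

  line-dart₂₄ : ∀ l → line₂₄ (dart₂₄ l) ≡ l
  line-dart₂₄ (l , true)  = toWitness {a? = Fin.all? λ l → ×-≡-dec Fin._≟_ Data.Bool._≟_ (line₂₄ (dart₂₄ (l , true))) (l , true)} _ l
  line-dart₂₄ (l , false) = toWitness {a? = Fin.all? λ l → ×-≡-dec Fin._≟_ Data.Bool._≟_ (line₂₄ (dart₂₄ (l , false))) (l , false)} _ l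

  pole₂₄ : Pole
  pole₂₄ = record { V = Fin 24 ; Line = Fin 39 ; dart = dart₂₄ ; line = line₂₄
                  ; dart-line = dart-line₂₄ ; line-dart = line-dart₂₄ }

  open Pole pole₂₄
  open Cut pole₂₄

  -- Certificates with one digit per line of the pole: row `l` of the first table is the colouring
  -- for `broken l`, row 5σ + p of the second is the one for `through σ p`.
  broken-table through-table : List String
  broken-table =
    "000120212211020010212012021201101220021" ∷
    "000210122212010020121021012102202110012" ∷
    "000110022200121021122011002012011220201" ∷
    "012012101200122102202100112102100221210" ∷
    "012002122010210020121021012102202110012" ∷
    "012020022101201201100212021201101220021" ∷
    "012012002212010020121021012102202110012" ∷
    "012011102200121021122011002012011220201" ∷
    "012110020211021021122011002012011220201" ∷
    "012001022001021021122011002012011220201" ∷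
    "012012102200212012211022001021022110102" ∷
    "012012202200111021121022001021022110102" ∷
    "012210020221011021121022001021022110102" ∷
    "012010122200100011202102120210010221120" ∷
    "012012002211010020122022021102101210012" ∷
    "012012102200112001022111210021020102201" ∷
    "012012102200112001022122021001020112120" ∷
    "012210120200110010212022021102101210012" ∷
    "012021102100222001001011012201202120021" ∷
    "012012102200112201102100112102100221210" ∷
    "012012102210012200120000112102100221210" ∷
    "012012102200112011222022001021022110102" ∷
    "012012102200112101202101210220010221210" ∷
    "012012102200112011202120101221100201102" ∷
    "012012102200112011202121001220010221210" ∷
    "012012102200112021122022001012011210102" ∷
    "012012102200112011202120000201200112120" ∷
    "012012102200112011212022001021011210102" ∷
    "012012102200112011202122100201100201012" ∷
    "012012102200112011202122001220020112120" ∷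
    "012012102200112011202122001220010112210" ∷
    "012012102200112011202120102212200201102" ∷
    "012012102200112201102200112201200121120" ∷
    "012012102200112011202122001220110010012" ∷
    "012012102200112011202120201221200102102" ∷
    "012012102200112011202121002210210010021" ∷
    "012012102200112011202122001221200112000" ∷
    "012012102200112011202121002211200112000" ∷
    "012012102200112011202122001220010211110" ∷ []
  through-table =
    "012001022011221120010200102210011220021" ∷
    "102201021121001120022120102110020102021" ∷
    "201102012212002210011210201220010201012" ∷
    "102110022011221120010200102210011220021" ∷
    "201220011022112210010200102210011220021" ∷
    "012001022011221120010200102210011220021" ∷
    "012201020011201122010221002012011210102" ∷
    "012001122010220120011202110220010221210" ∷
    "012001022011221120010200201221101210102" ∷
    "012001022011221120010200201220211012210" ∷ []

  colouring : List String → ℕ → Line → Colour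
  colouring table k l = nth zero (digits 3 (nth "" table k)) (Fin.toℕ l)

  broken₂₄ : ∀ l → (∀ v → (∀ i → inc v i ≢ l) → Rainbow (colouring broken-table (Fin.toℕ l) ∘ inc v)) ×
                   (∀ σ → (∀ i → pline σ i ≢ l) → Rainbow (colouring broken-table (Fin.toℕ l) ∘ pline σ))
  broken₂₄ = toWitness {a? = Fin.all? λ l →
    (Fin.all? λ v → (Fin.all? λ i → ¬? (inc v i Fin.≟ l)) →-dec rainbow? (colouring broken-table (Fin.toℕ l) ∘ inc v)) ×-dec
    (Fin.all? λ σ → (Fin.all? λ i → ¬? (pline σ i Fin.≟ l)) →-dec rainbow? (colouring broken-table (Fin.toℕ l) ∘ pline σ))} _

  through₂₄ : ∀ σ p → let f = colouring through-table (5 * Fin.toℕ σ + Fin.toℕ p) in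
    (∀ v → Rainbow (f ∘ inc v)) × (∀ i → f (pline σ i) ≡ pattern₅ p i) × (∀ i → f (pline (other σ) i) ≡ zero)
  through₂₄ = toWitness {a? = Fin.all? λ σ → Fin.all? λ p → let f = colouring through-table (5 * Fin.toℕ σ + Fin.toℕ p) in
    (Fin.all? λ v → rainbow? (f ∘ inc v)) ×-dec
    (Fin.all? λ i → f (pline σ i) Fin.≟ pattern₅ p i) ×-dec (Fin.all? λ i → f (pline (other σ) i) Fin.≟ zero)} _

  _≟ᴼ_ : DecidableEquality Owner
  _≟ᴼ_ = ⊎-≡-dec Fin._≟_ (×-≡-dec Fin._≟_ Fin._≟_)

  no-loop₂₄ : ∀ v i → owner (far (inj₁ (v , i))) ≢ inj₁ v
  no-loop₂₄ = toWitness {a? = Fin.all? λ v → Fin.all? λ i → ¬? (owner (far (inj₁ (v , i))) ≟ᴼ inj₁ v)} _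

  no-parallel₂₄ : ∀ v i j → owner (far (inj₁ (v , i))) ≡ owner (far (inj₁ (v , j))) → i ≡ j
  no-parallel₂₄ = toWitness {a? = Fin.all? λ v → Fin.all? λ i → Fin.all? λ j →
    (owner (far (inj₁ (v , i))) ≟ᴼ owner (far (inj₁ (v , j)))) →-dec (i Fin.≟ j)} _

  port-inner₂₄ : ∀ p → ∃ λ x → far (inj₂ p) ≡ inj₁ x
  port-inner₂₄ (σ , i) = let v , j , eq = table σ i in (v , j) , eq
    where
    table : ∀ σ i → ∃ λ v → ∃ λ j → far (inj₂ (σ , i)) ≡ inj₁ (v , j)
    table = toWitness {a? = Fin.all? λ σ → Fin.all? λ i → Fin.any? λ v → Fin.any? λ j → far (inj₂ (σ , i)) ≟ᴴ inj₁ (v , j)} _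

  open PoleLemmas pole₂₄

  Below : Fin 24 → Owner → Set
  Below v (inj₁ w) = w Fin.< v
  Below v (inj₂ _) = ⊥

  below? : ∀ v o → Dec (Below v o)
  below? v (inj₁ w) = w Fin.<? v
  below? v (inj₂ _) = no (λ ())

  descend : ∀ v → v ≡ zero ⊎ ∃ λ i → Below v (owner (far (inj₁ (v , i))))
  descend = toWitness {a? = Fin.all? λ v → (v Fin.≟ zero) ⊎-dec Fin.any? λ i → below? v (owner (far (inj₁ (v , i))))} _

  below⇒ : ∀ v o → Below v o → ∃ λ w → o ≡ inj₁ w × w Fin.< v
  below⇒ v (inj₁ w) lt = w , refl , lt

  connected₂₄ : ∀ v w → Star Adj v w
  connected₂₄ = rooted⇒connected Fin.toℕ zero (λ v → Data.Sum.map₂ (λ (i , lt) → i , below⇒ v _ lt) (descend v))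

  -- Ordered so that vertices are completed soon after they are first met; clashes then appear early
  -- and the search stays small.
  colour-order : List Line
  colour-order = map (_mod 39) (0 ∷ 1 ∷ 2 ∷ 3 ∷ 8 ∷ 5 ∷ 13 ∷ 4 ∷ 7 ∷ 6 ∷ 11 ∷ 14 ∷ 10 ∷ 17 ∷ 12 ∷ 9 ∷ 20 ∷ 15 ∷ 22 ∷ 16 ∷ 18 ∷ 25 ∷ 19 ∷ 21 ∷ 27 ∷ 32 ∷ 24 ∷ 34 ∷ 26 ∷ 23 ∷ 28 ∷ 29 ∷ 31 ∷ 37 ∷ 33 ∷ 35 ∷ 38 ∷ 30 ∷ 36 ∷ [])

  net-flow₂₄ : ∀ (f : Line → Colour) → (∀ v → Rainbow (f ∘ inc v)) → ∃ λ s → ∀ σ → net (f ∘ pline σ) ≡ just s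
  net-flow₂₄ = NetFlow.net-flow-search Fin._≟_ (allFin 24) colour-order refl refl refl

  module KS = CutSearch pole₂₄ Fin._≟_

  lines₂₄ : List Line
  lines₂₄ = allFin 39

  linked₂₄ : ∀ A b → ones b ⊓ (6 ∸ ones b) ≤ cutSize lines₂₄ A b
  linked₂₄ A b = KS.linked-search (allFin 24) lines₂₄ A b refl refl refl refl

  expanding₂₄ : ∀ A → weight (allFin 24) A ≡ 0 ⊎ 6 ⊓ (2 + weight (allFin 24) A) ≤ cutSize lines₂₄ A (λ _ → false)
  expanding₂₄ A = KS.expanding-search (allFin 24) lines₂₄ A refl refl refl refl

  superedge₂₄ : IsSuperedge pole₂₄
  superedge₂₄ = record
    { size         = 24
    ; index        = ↔-id (Fin 24)
    ; _≟ᴸ_         = Fin._≟_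
    ; no-loop      = no-loop₂₄
    ; no-parallel  = no-parallel₂₄
    ; port-inner   = port-inner₂₄
    ; connected    = connected₂₄
    ; net-flow     = net-flow₂₄
    ; broken       = λ l → colouring broken-table (Fin.toℕ l) , broken₂₄ l
    ; through      = λ σ p → colouring through-table (5 * Fin.toℕ σ + Fin.toℕ p) , through₂₄ σ p
    ; lines        = lines₂₄
    ; lines-unique = Unique.allFin⁺ 39
    ; vertices     = allFin 24
    ; ∈-vertices   = ∈-allFin
    ; linked       = linked₂₄
    ; expanding    = expanding₂₄
    }

-- Flower poles

-- A ladder of claws, each with centre `hub` and leaves `rail r`; equal rails of consecutive claws
-- are joined. `up` leads past the first segment, so adding or removing a segment in front is a
-- matter of constructors.
data LV : ℕ → Set where
  rail : ∀ {L} → Fin 3 → LV (suc L)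
  hub  : ∀ {L} → LV (suc L)
  up   : ∀ {L} → LV L → LV (suc L)

-- railˡ r is the line of rail r entering the first segment, and last r the one
-- leaving the last segment.
data LL : ℕ → Set where
  last  : Fin 3 → LL 0
  railˡ : ∀ {L} → Fin 3 → LL (suc L)
  spoke : ∀ {L} → Fin 3 → LL (suc L)
  up    : ∀ {L} → LL L → LL (suc L)

-- inj₂ (false , r) and inj₂ (true , r) are the two open ends of rail r.
LDart : ℕ → Set
LDart L = (LV L × Fin 3) ⊎ (Bool × Fin 3)

lift : ∀ {L} → LDart L → LDart (suc L)
lift (inj₁ (v , i))     = inj₁ (up v , i)
lift (inj₂ (false , r)) = inj₁ (rail r , # 1)
lift (inj₂ (true , r))  = inj₂ (true , r)

ldart : ∀ {L} → LL L × Bool → LDart L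
ldart (last r , b)      = inj₂ (b , r)
ldart (railˡ r , false) = inj₂ (false , r)
ldart (railˡ r , true)  = inj₁ (rail r , zero)
ldart (spoke r , false) = inj₁ (rail r , # 2)
ldart (spoke r , true)  = inj₁ (hub , r)
ldart (up l , b)        = lift (ldart (l , b))

lline : ∀ L → LDart L → LL L × Bool
lline zero    (inj₂ (b , r))                   = last r , b
lline (suc L) (inj₁ (rail r , zero))           = railˡ r , true
lline (suc L) (inj₁ (rail r , suc zero))       = map₁ up (lline L (inj₂ (false , r)))
lline (suc L) (inj₁ (rail r , suc (suc zero))) = spoke r , false
lline (suc L) (inj₁ (hub , r))                 = spoke r , true
lline (suc L) (inj₁ (up v , i))                = map₁ up (lline L (inj₁ (v , i)))
lline (suc L) (inj₂ (false , r))               = railˡ r , false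
lline (suc L) (inj₂ (true , r))                = map₁ up (lline L (inj₂ (true , r)))

ldart-lline : ∀ L x → ldart (lline L x) ≡ x
ldart-lline zero    (inj₂ (b , r))                   = refl
ldart-lline (suc L) (inj₁ (rail r , zero))           = refl
ldart-lline (suc L) (inj₁ (rail r , suc zero))       = cong lift (ldart-lline L (inj₂ (false , r)))
ldart-lline (suc L) (inj₁ (rail r , suc (suc zero))) = refl
ldart-lline (suc L) (inj₁ (hub , r))                 = refl
ldart-lline (suc L) (inj₁ (up v , i))                = cong lift (ldart-lline L (inj₁ (v , i)))
ldart-lline (suc L) (inj₂ (false , r))               = refl
ldart-lline (suc L) (inj₂ (true , r))                = cong lift (ldart-lline L (inj₂ (true , r)))

lline-lift : ∀ L x → lline (suc L) (lift x) ≡ map₁ up (lline L x)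
lline-lift L (inj₁ x)           = refl
lline-lift L (inj₂ (false , r)) = refl
lline-lift L (inj₂ (true , r))  = refl

lline-ldart : ∀ L l → lline L (ldart l) ≡ l
lline-ldart zero    (last r , b)      = refl
lline-ldart (suc L) (railˡ r , false) = refl
lline-ldart (suc L) (railˡ r , true)  = refl
lline-ldart (suc L) (spoke r , false) = refl
lline-ldart (suc L) (spoke r , true)  = refl
lline-ldart (suc L) (up l , b)        = trans (lline-lift L (ldart (l , b))) (cong (map₁ up) (lline-ldart L (l , b)))

linc : ∀ {L} → LV L → Fin 3 → LL L
linc {L} v i = proj₁ (lline L (inj₁ (v , i)))

start stop : ∀ L → Fin 3 → LL L
start L r = proj₁ (lline L (inj₂ (false , r)))
stop  L r = proj₁ (lline L (inj₂ (true , r)))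

lfar : ∀ L → LDart L → LDart L
lfar L x = let l , b = lline L x in ldart (l , not b)

LOwner : ℕ → Set
LOwner L = LV L ⊎ (Bool × Fin 3)

lowner : ∀ {L} → LDart L → LOwner L
lowner (inj₁ (v , i)) = inj₁ v
lowner (inj₂ e)       = inj₂ e

raise : ∀ {L} → LOwner L → LOwner (suc L)
raise (inj₁ v)           = inj₁ (up v)
raise (inj₂ (false , r)) = inj₁ (rail r)
raise (inj₂ (true , r))  = inj₂ (true , r)

lowner-lift : ∀ {L} (x : LDart L) → lowner (lift x) ≡ raise (lowner x)
lowner-lift (inj₁ x)           = refl
lowner-lift (inj₂ (false , r)) = refl
lowner-lift (inj₂ (true , r))  = refl

raise-injective : ∀ {L} (o p : LOwner L) → raise o ≡ raise p → o ≡ p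
raise-injective (inj₁ v)           (inj₁ .v)           refl = refl
raise-injective (inj₂ (false , r)) (inj₂ (false , .r)) refl = refl
raise-injective (inj₂ (true , r))  (inj₂ (true , .r))  refl = refl
raise-injective (inj₁ v)           (inj₂ (false , r))  ()
raise-injective (inj₁ v)           (inj₂ (true , r))   ()

distinct₃ : {A : Set} (f : Fin 3 → A) → f zero ≢ f (# 1) → f zero ≢ f (# 2) → f (# 1) ≢ f (# 2) → Rainbow f
distinct₃ f a b c zero             zero             eq = refl
distinct₃ f a b c zero             (suc zero)       eq = ⊥-elim (a eq)
distinct₃ f a b c zero             (suc (suc zero)) eq = ⊥-elim (b eq)
distinct₃ f a b c (suc zero)       zero             eq = ⊥-elim (a (sym eq))
distinct₃ f a b c (suc zero)       (suc zero)       eq = refl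
distinct₃ f a b c (suc zero)       (suc (suc zero)) eq = ⊥-elim (c eq)
distinct₃ f a b c (suc (suc zero)) zero             eq = ⊥-elim (b (sym eq))
distinct₃ f a b c (suc (suc zero)) (suc zero)       eq = ⊥-elim (c (sym eq))
distinct₃ f a b c (suc (suc zero)) (suc (suc zero)) eq = refl

raise≢start : ∀ {L} (o : LOwner L) {r} → raise o ≢ inj₂ (false , r)
raise≢start (inj₂ (true , r)) ()

raise≢hub : ∀ {L} (o : LOwner L) → raise o ≢ inj₁ hub
raise≢hub (inj₁ v) ()
raise≢hub (inj₂ (false , r)) ()
raise≢hub (inj₂ (true , r)) ()

lfar-start : ∀ L r {s} → lowner (lfar L (inj₂ (false , r))) ≢ inj₂ (false , s)
lfar-start zero    r ()
lfar-start (suc L) r ()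

lowner-up : ∀ {L} (x : LDart L) {o} → lowner (lift x) ≡ o → raise (lowner x) ≡ o
lowner-up x eq = trans (sym (lowner-lift x)) eq

raise≡rail : ∀ {L} (o : LOwner L) {r} → raise o ≡ inj₁ (rail r) → o ≡ inj₂ (false , r)
raise≡rail (inj₂ (false , r)) refl = refl

raise≡up : ∀ {L} (o : LOwner L) {v} → raise o ≡ inj₁ (up v) → o ≡ inj₁ v
raise≡up (inj₁ v) refl = refl
raise≡up (inj₂ (false , r)) ()
raise≡up (inj₂ (true , r)) ()

lno-loop : ∀ {L} (v : LV L) i → lowner (lfar L (inj₁ (v , i))) ≢ inj₁ v
lno-loop {suc L} (rail r) (suc zero) eq =
  lfar-start L r (raise≡rail _ (lowner-up (lfar L (inj₂ (false , r))) eq))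
lno-loop {suc L} (rail r) (suc (suc zero)) ()
lno-loop {suc L} (up v) i eq = lno-loop v i (raise≡up _ (lowner-up (lfar L (inj₁ (v , i))) eq))

lno-parallel : ∀ {L} (v : LV L) → Rainbow (λ i → lowner (lfar L (inj₁ (v , i))))
lno-parallel {suc L} (rail r) = distinct₃ _
  (λ eq → raise≢start _ (lowner-up (lfar L (inj₂ (false , r))) (sym eq)))
  (λ ())
  (λ eq → raise≢hub _ (lowner-up (lfar L (inj₂ (false , r))) eq))
lno-parallel {suc L} hub i j refl = refl
lno-parallel {suc L} (up v) i j eq = lno-parallel v i j (raise-injective _ _
  (lowner-up (lfar L (inj₁ (v , i))) (trans eq (lowner-lift (lfar L (inj₁ (v , j)))))))

lfar-stop : ∀ L r → ∃ λ x → lfar (suc L) (inj₂ (true , r)) ≡ inj₁ x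
lfar-stop zero    r = _ , refl
lfar-stop (suc L) r = let (v , i) , eq = lfar-stop L r in (up v , i) , cong lift eq

LAdj : ∀ {L} → LV L → LV L → Set
LAdj {L} v w = ∃ λ i → lowner (lfar L (inj₁ (v , i))) ≡ inj₁ w

ladj-up : ∀ {L} {v w : LV L} → LAdj v w → LAdj (up v) (up w)
ladj-up {L} {v} (i , eq) = i , trans (lowner-lift (lfar L (inj₁ (v , i)))) (cong raise eq)

lconnected : ∀ {L} (v : LV (suc L)) → Star LAdj v (rail zero)
lconnected (rail zero)          = ε
lconnected (rail r@(suc _))     = (# 2 , refl) ◅ (zero , refl) ◅ ε
lconnected hub                  = (zero , refl) ◅ ε
lconnected {suc L} (up v)       = gmap up (λ {x} {y} → ladj-up {v = x} {w = y}) (lconnected v) ◅◅ ((zero , refl) ◅ ε)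

up-injective : ∀ {L} {l m : LL L} → LL.up l ≡ up m → l ≡ m
up-injective refl = refl

_≟ᴸᴸ_ : ∀ {L} → DecidableEquality (LL L)
last r  ≟ᴸᴸ last s  = map′ (cong last) (λ { refl → refl }) (r Fin.≟ s)
railˡ r ≟ᴸᴸ railˡ s = map′ (cong railˡ) (λ { refl → refl }) (r Fin.≟ s)
railˡ _ ≟ᴸᴸ spoke _ = no λ ()
railˡ _ ≟ᴸᴸ up _    = no λ ()
spoke _ ≟ᴸᴸ railˡ _ = no λ ()
spoke r ≟ᴸᴸ spoke s = map′ (cong spoke) (λ { refl → refl }) (r Fin.≟ s)
spoke _ ≟ᴸᴸ up _    = no λ ()
up _    ≟ᴸᴸ railˡ _ = no λ ()
up _    ≟ᴸᴸ spoke _ = no λ ()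
up l    ≟ᴸᴸ up m    = map′ (cong up) up-injective (l ≟ᴸᴸ m)

_≟ᴸⱽ_ : ∀ {L} → DecidableEquality (LV L)
rail r ≟ᴸⱽ rail s = map′ (cong rail) (λ { refl → refl }) (r Fin.≟ s)
rail _ ≟ᴸⱽ hub    = no λ ()
rail _ ≟ᴸⱽ up _   = no λ ()
hub    ≟ᴸⱽ rail _ = no λ ()
hub    ≟ᴸⱽ hub    = yes refl
hub    ≟ᴸⱽ up _   = no λ ()
up _   ≟ᴸⱽ rail _ = no λ ()
up _   ≟ᴸⱽ hub    = no λ ()
up v   ≟ᴸⱽ up w   = map′ (cong up) (λ { refl → refl }) (v ≟ᴸⱽ w)

lvertices : ∀ L → List (LV L)
lvertices zero    = []
lvertices (suc L) = map rail (allFin 3) ++ hub ∷ map up (lvertices L)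

∈-lvertices : ∀ {L} (v : LV L) → v ∈ lvertices L
∈-lvertices (rail r) = ∈-++⁺ˡ (∈-map⁺ rail (∈-allFin r))
∈-lvertices hub      = ∈-++⁺ʳ (map rail (allFin 3)) (here refl)
∈-lvertices (up v)   = ∈-++⁺ʳ (map rail (allFin 3)) (there (∈-map⁺ up (∈-lvertices v)))

llines : ∀ L → List (LL L)
llines zero    = map last (allFin 3)
llines (suc L) = map railˡ (allFin 3) ++ map spoke (allFin 3) ++ map up (llines L)

∈-llines : ∀ {L} (l : LL L) → l ∈ llines L
∈-llines (last r)  = ∈-map⁺ last (∈-allFin r)
∈-llines (railˡ r) = ∈-++⁺ˡ (∈-map⁺ railˡ (∈-allFin r))
∈-llines {suc L} (spoke r) = ∈-++⁺ʳ (map railˡ (allFin 3)) (∈-++⁺ˡ {ys = map up (llines L)} (∈-map⁺ spoke (∈-allFin r)))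
∈-llines (up l)    = ∈-++⁺ʳ (map railˡ (allFin 3)) (∈-++⁺ʳ (map spoke (allFin 3)) (∈-map⁺ up (∈-llines l)))

llines-unique : ∀ L → Unique (llines L)
llines-unique zero    = Unique.map⁺ {f = last} (λ { refl → refl }) (Unique.allFin⁺ 3)
llines-unique (suc L) =
  Unique.++⁺ (Unique.map⁺ {f = railˡ} (λ { refl → refl }) (Unique.allFin⁺ 3))
    (Unique.++⁺ (Unique.map⁺ {f = spoke} (λ { refl → refl }) (Unique.allFin⁺ 3)) (Unique.map⁺ {f = up} up-injective (llines-unique L)) spoke-up)
    railˡ-rest
  where
  spoke-up : ∀ {l} → l ∈ map spoke (allFin 3) × l ∈ map up (llines L) → ⊥
  spoke-up (p , q) with ∈-map⁻ spoke p | ∈-map⁻ up q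
  ... | _ , _ , refl | _ , _ , ()
  railˡ-rest : ∀ {l} → l ∈ map railˡ (allFin 3) × l ∈ map spoke (allFin 3) ++ map up (llines L) → ⊥
  railˡ-rest (p , q) with ∈-map⁻ railˡ p | ∈-++⁻ (map spoke (allFin 3)) q
  ... | _ , _ , refl | inj₁ q′ with ∈-map⁻ spoke q′
  ...   | _ , _ , ()
  railˡ-rest (p , q) | _ , _ , refl | inj₂ q′ with ∈-map⁻ up q′
  ...   | _ , _ , ()

-- What remains of the two segments from which a vertex is deleted: aᵢ, bᵢ, cᵢ are
-- the rail vertices of segment i and zᵢ is its centre; a₀ and b₁ are deleted.
Cap CapLine : Set
Cap     = Fin 6
CapLine = Fin 9

pattern b₀ = Fin.zero
pattern c₀ = Fin.suc b₀
pattern z₀ = Fin.suc c₀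
pattern a₁ = Fin.suc z₀
pattern c₁ = Fin.suc a₁
pattern z₁ = Fin.suc c₁

-- pᵢ and qᵢ are the semiedges (0 , i) and (1 , i); those with i = 2 are rails.
pattern z₀b₀ = Fin.zero
pattern z₀c₀ = Fin.suc z₀b₀
pattern c₀c₁ = Fin.suc z₀c₀
pattern a₁z₁ = Fin.suc c₀c₁
pattern c₁z₁ = Fin.suc a₁z₁
pattern p₀   = Fin.suc c₁z₁
pattern p₁   = Fin.suc p₀
pattern q₀   = Fin.suc p₁
pattern q₁   = Fin.suc q₀

-- The ladder starts on rails 0, 1, 2 at the places of a, b, c in segment 1, but its rails 0, 1, 2
-- end at those of a, c, b in segment 0. This exchange is the twist of the flower snarks.
capline : Cap → Fin 3 → (CapLine × Bool) ⊎ (Bool × Fin 3)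
capline b₀ zero             = inj₁ (z₀b₀ , true)
capline b₀ (suc zero)       = inj₁ (q₀ , false)
capline b₀ (suc (suc zero)) = inj₂ (true , # 2)
capline c₀ zero             = inj₁ (z₀c₀ , true)
capline c₀ (suc zero)       = inj₁ (c₀c₁ , false)
capline c₀ (suc (suc zero)) = inj₂ (true , # 1)
capline z₀ zero             = inj₁ (z₀b₀ , false)
capline z₀ (suc zero)       = inj₁ (z₀c₀ , false)
capline z₀ (suc (suc zero)) = inj₁ (p₀ , false)
capline a₁ zero             = inj₁ (a₁z₁ , false)
capline a₁ (suc zero)       = inj₁ (p₁ , false)
capline a₁ (suc (suc zero)) = inj₂ (false , zero)
capline c₁ zero             = inj₁ (c₀c₁ , true)
capline c₁ (suc zero)       = inj₁ (c₁z₁ , false)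
capline c₁ (suc (suc zero)) = inj₂ (false , # 2)
capline z₁ zero             = inj₁ (a₁z₁ , true)
capline z₁ (suc zero)       = inj₁ (c₁z₁ , true)
capline z₁ (suc (suc zero)) = inj₁ (q₁ , false)

portline : Port → (CapLine × Bool) ⊎ (Bool × Fin 3)
portline (zero , zero)                 = inj₁ (p₀ , true)
portline (zero , suc zero)             = inj₁ (p₁ , true)
portline (zero , suc (suc zero))       = inj₂ (true , zero)
portline (suc zero , zero)             = inj₁ (q₀ , true)
portline (suc zero , suc zero)         = inj₁ (q₁ , true)
portline (suc zero , suc (suc zero))   = inj₂ (false , # 1)

source : (Cap × Fin 3) ⊎ Port → (CapLine × Bool) ⊎ (Bool × Fin 3)
source (inj₁ (c , i)) = capline c i
source (inj₂ p)       = portline p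

ends : (CapLine × Bool) ⊎ (Bool × Fin 3) → (Cap × Fin 3) ⊎ Port
ends (inj₁ (z₀b₀ , false))             = inj₁ (z₀ , zero)
ends (inj₁ (z₀b₀ , true))              = inj₁ (b₀ , zero)
ends (inj₁ (z₀c₀ , false))             = inj₁ (z₀ , # 1)
ends (inj₁ (z₀c₀ , true))              = inj₁ (c₀ , zero)
ends (inj₁ (c₀c₁ , false))             = inj₁ (c₀ , # 1)
ends (inj₁ (c₀c₁ , true))              = inj₁ (c₁ , zero)
ends (inj₁ (a₁z₁ , false))             = inj₁ (a₁ , zero)
ends (inj₁ (a₁z₁ , true))              = inj₁ (z₁ , zero)
ends (inj₁ (c₁z₁ , false))             = inj₁ (c₁ , # 1)
ends (inj₁ (c₁z₁ , true))              = inj₁ (z₁ , # 1)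
ends (inj₁ (p₀ , false))               = inj₁ (z₀ , # 2)
ends (inj₁ (p₀ , true))                = inj₂ (zero , zero)
ends (inj₁ (p₁ , false))               = inj₁ (a₁ , # 1)
ends (inj₁ (p₁ , true))                = inj₂ (zero , # 1)
ends (inj₁ (q₀ , false))               = inj₁ (b₀ , # 1)
ends (inj₁ (q₀ , true))                = inj₂ (# 1 , zero)
ends (inj₁ (q₁ , false))               = inj₁ (z₁ , # 2)
ends (inj₁ (q₁ , true))                = inj₂ (# 1 , # 1)
ends (inj₂ (false , zero))             = inj₁ (a₁ , # 2)
ends (inj₂ (false , suc zero))         = inj₂ (# 1 , # 2)
ends (inj₂ (false , suc (suc zero)))   = inj₁ (c₁ , # 2)
ends (inj₂ (true , zero))              = inj₂ (zero , # 2)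
ends (inj₂ (true , suc zero))          = inj₁ (c₀ , # 2)
ends (inj₂ (true , suc (suc zero)))    = inj₁ (b₀ , # 2)

ends-source : ∀ x → ends (source x) ≡ x
ends-source (inj₁ (c , i)) = toWitness {a? = Fin.all? λ c → Fin.all? λ i → ⊎-≡-dec (×-≡-dec Fin._≟_ Fin._≟_) (×-≡-dec Fin._≟_ Fin._≟_)
  (ends (source (inj₁ (c , i)))) (inj₁ (c , i))} _ c i
ends-source (inj₂ (σ , i)) = toWitness {a? = Fin.all? λ σ → Fin.all? λ i → ⊎-≡-dec (×-≡-dec Fin._≟_ Fin._≟_) (×-≡-dec Fin._≟_ Fin._≟_)
  (ends (source (inj₂ (σ , i)))) (inj₂ (σ , i))} _ σ i

source-ends : ∀ y → source (ends y) ≡ y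
source-ends (inj₁ (c , true))  = toWitness {a? = Fin.all? λ c → ⊎-≡-dec (×-≡-dec Fin._≟_ Data.Bool._≟_) (×-≡-dec Data.Bool._≟_ Fin._≟_)
  (source (ends (inj₁ (c , true)))) (inj₁ (c , true))} _ c
source-ends (inj₁ (c , false)) = toWitness {a? = Fin.all? λ c → ⊎-≡-dec (×-≡-dec Fin._≟_ Data.Bool._≟_) (×-≡-dec Data.Bool._≟_ Fin._≟_)
  (source (ends (inj₁ (c , false)))) (inj₁ (c , false))} _ c
source-ends (inj₂ (true , r))  = toWitness {a? = Fin.all? λ r → ⊎-≡-dec (×-≡-dec Fin._≟_ Data.Bool._≟_) (×-≡-dec Data.Bool._≟_ Fin._≟_)
  (source (ends (inj₂ (true , r)))) (inj₂ (true , r))} _ r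
source-ends (inj₂ (false , r)) = toWitness {a? = Fin.all? λ r → ⊎-≡-dec (×-≡-dec Fin._≟_ Data.Bool._≟_) (×-≡-dec Data.Bool._≟_ Fin._≟_)
  (source (ends (inj₂ (false , r)))) (inj₂ (false , r))} _ r

module Flower (L : ℕ) where

  HalfEdge : Set
  HalfEdge = ((Cap ⊎ LV L) × Fin 3) ⊎ Port

  embed : (Cap × Fin 3) ⊎ Port → HalfEdge
  embed (inj₁ (c , i)) = inj₁ (inj₁ c , i)
  embed (inj₂ p)       = inj₂ p

  graft : LDart L → HalfEdge
  graft (inj₁ (v , i)) = inj₁ (inj₂ v , i)
  graft (inj₂ e)       = embed (ends (inj₂ e))

  dart : (CapLine ⊎ LL L) × Bool → HalfEdge
  dart (inj₁ c , b) = embed (ends (inj₁ (c , b)))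
  dart (inj₂ l , b) = graft (ldart (l , b))

  extend : (CapLine × Bool) ⊎ (Bool × Fin 3) → (CapLine ⊎ LL L) × Bool
  extend (inj₁ c) = map₁ inj₁ c
  extend (inj₂ e) = map₁ inj₂ (lline L (inj₂ e))

  line : HalfEdge → (CapLine ⊎ LL L) × Bool
  line (inj₁ (inj₁ c , i)) = extend (capline c i)
  line (inj₁ (inj₂ v , i)) = map₁ inj₂ (lline L (inj₁ (v , i)))
  line (inj₂ p)            = extend (portline p)

  dart-extend : ∀ y → dart (extend y) ≡ embed (ends y)
  dart-extend (inj₁ c) = refl
  dart-extend (inj₂ e) = cong graft (ldart-lline L (inj₂ e))

  dart-line : ∀ x → dart (line x) ≡ x
  dart-line (inj₁ (inj₂ v , i)) = cong graft (ldart-lline L (inj₁ (v , i)))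
  dart-line (inj₁ (inj₁ c , i)) = trans (dart-extend (capline c i)) (cong embed (ends-source (inj₁ (c , i))))
  dart-line (inj₂ p)            = trans (dart-extend (portline p)) (cong embed (ends-source (inj₂ p)))

  line-embed : ∀ x → line (embed x) ≡ extend (source x)
  line-embed (inj₁ x) = refl
  line-embed (inj₂ p) = refl

  line-graft : ∀ x → line (graft x) ≡ map₁ inj₂ (lline L x)
  line-graft (inj₁ x) = refl
  line-graft (inj₂ e) = trans (line-embed (ends (inj₂ e))) (cong extend (source-ends (inj₂ e)))

  line-dart : ∀ l → line (dart l) ≡ l
  line-dart (inj₁ c , b) = trans (line-embed (ends (inj₁ (c , b)))) (cong extend (source-ends (inj₁ (c , b))))
  line-dart (inj₂ l , b) = trans (line-graft (ldart (l , b))) (cong (map₁ inj₂) (lline-ldart L (l , b)))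

  pole : Pole
  pole = record { V = Cap ⊎ LV L ; Line = CapLine ⊎ LL L ; dart = dart ; line = line
                ; dart-line = dart-line ; line-dart = line-dart }

caps : List Cap
caps = allFin 6

capLines : List CapLine
capLines = allFin 9

LV↔ : ∀ L → LV L ↔ Fin (L * 4)
LV↔ zero    = mk↔ₛ′ (λ ()) (λ ()) (λ ()) (λ ())
LV↔ (suc L) = split ↔-∘ ((mk↔ₛ′ to′ from′ to-from from-to) )
  where
  split : (Fin 4 ⊎ LV L) ↔ Fin (suc L * 4)
  split = ↔-sym (Fin.+↔⊎ {4} {L * 4}) ↔-∘ (↔-id (Fin 4) ⊎-↔ LV↔ L)
  to′ : LV (suc L) → Fin 4 ⊎ LV L
  to′ hub      = inj₁ zero
  to′ (rail r) = inj₁ (suc r)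
  to′ (up v)   = inj₂ v
  from′ : Fin 4 ⊎ LV L → LV (suc L)
  from′ (inj₁ zero)    = hub
  from′ (inj₁ (suc r)) = rail r
  from′ (inj₂ v)       = up v
  to-from : ∀ x → to′ (from′ x) ≡ x
  to-from (inj₁ zero)    = refl
  to-from (inj₁ (suc r)) = refl
  to-from (inj₂ v)       = refl
  from-to : ∀ v → from′ (to′ v) ≡ v
  from-to hub      = refl
  from-to (rail r) = refl
  from-to (up v)   = refl

-- Cuts of ladders and removal of segments

lside : ∀ {L} → (LV L → Bool) → (s t : Fin 3 → Bool) → LOwner L → Bool
lside B s t (inj₁ v)           = B v
lside B s t (inj₂ (false , r)) = s r
lside B s t (inj₂ (true , r))  = t r

lcut : ∀ {L} → (LV L → Bool) → (s t : Fin 3 → Bool) → LL L → ℕ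
lcut B s t l = differ (lside B s t (lowner (ldart (l , false)))) (lside B s t (lowner (ldart (l , true))))

add₃ : (Fin 3 → ℕ) → ℕ → ℕ
add₃ f n = f zero + (f (# 1) + (f (# 2) + n))

lcost : ∀ L → (LV L → Bool) → (s t : Fin 3 → Bool) → ℕ
lcost zero    B s t = add₃ (λ r → differ (s r) (t r)) 0
lcost (suc L) B s t = add₃ (λ r → differ (s r) (B (rail r)))
                     (add₃ (λ r → differ (B (rail r)) (B hub)) (lcost L (B ∘ up) (B ∘ rail) t))

lside-raise : ∀ {L} (B : LV (suc L) → Bool) s t o → lside B s t (raise o) ≡ lside (B ∘ up) (B ∘ rail) t o
lside-raise B s t (inj₁ v)           = refl
lside-raise B s t (inj₂ (false , r)) = refl
lside-raise B s t (inj₂ (true , r))  = refl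

lcut-up : ∀ {L} (B : LV (suc L) → Bool) s t l → lcut B s t (up l) ≡ lcut (B ∘ up) (B ∘ rail) t l
lcut-up B s t l = cong₂ differ (at false) (at true)
  where
  at : ∀ b → lside B s t (lowner (lift (ldart (l , b)))) ≡ lside (B ∘ up) (B ∘ rail) t (lowner (ldart (l , b)))
  at b = trans (cong (lside B s t) (lowner-lift (ldart (l , b)))) (lside-raise B s t (lowner (ldart (l , b))))

sum-lcut : ∀ L B s t → sum (map (lcut B s t) (llines L)) ≡ lcost L B s t
sum-lcut zero    B s t = refl
sum-lcut (suc L) B s t = cong (λ n → add₃ (λ r → differ (s r) (B (rail r))) (add₃ (λ r → differ (B (rail r)) (B hub)) n))
  (trans (cong sum (trans (sym (map-∘ (llines L))) (map-cong (lcut-up B s t) (llines L)))) (sum-lcut L (B ∘ up) (B ∘ rail) t))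

lweight : ∀ L → (LV L → Bool) → ℕ
lweight zero    B = 0
lweight (suc L) B = add₃ (λ r → bit (B (rail r))) (bit (B hub) + lweight L (B ∘ up))

sum-lweight : ∀ L B → sum (map (λ v → bit (B v)) (lvertices L)) ≡ lweight L B
sum-lweight zero    B = refl
sum-lweight (suc L) B = cong (λ n → add₃ (λ r → bit (B (rail r))) (bit (B hub) + n))
  (trans (cong sum (sym (map-∘ (lvertices L)))) (sum-lweight L (B ∘ up)))

add₃-mono : ∀ f {m n} → m ≤ n → add₃ f m ≤ add₃ f n
add₃-mono f m≤n = ℕ.+-monoʳ-≤ (f zero) (ℕ.+-monoʳ-≤ (f (# 1)) (ℕ.+-monoʳ-≤ (f (# 2)) m≤n))

add₃-≥ : ∀ f n → n ≤ add₃ f n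
add₃-≥ f n = ℕ.≤-trans (ℕ.m≤n+m n (f (# 2))) (ℕ.≤-trans (ℕ.m≤n+m _ (f (# 1))) (ℕ.m≤n+m _ (f zero)))

differ-triangle : ∀ a b c → differ a c ≤ differ a b + differ b c
differ-triangle false false c     = ℕ.≤-refl
differ-triangle false true  false = z≤n
differ-triangle false true  true  = ℕ.≤-refl
differ-triangle true  true  c     = ℕ.≤-refl
differ-triangle true  false false = ℕ.≤-refl
differ-triangle true  false true  = z≤n

add₃-triangle : ∀ f g h n → (∀ r → f r ≤ g r + h r) → add₃ f n ≤ add₃ g (add₃ h n)
add₃-triangle f g h n le = ℕ.≤-trans
  (ℕ.+-mono-≤ (le zero) (ℕ.+-mono-≤ (le (# 1)) (ℕ.+-monoˡ-≤ n (le (# 2)))))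
  (ℕ.≤-reflexive (solve 7 (λ a b c d e f n → a :+ d :+ (b :+ e :+ (c :+ f :+ n)) := a :+ (b :+ (c :+ (d :+ (e :+ (f :+ n)))))) refl
    (g zero) (g (# 1)) (g (# 2)) (h zero) (h (# 1)) (h (# 2)) n))
  where open +-*-Solver

restart : ∀ L B s s′ t → lcost L B s t ≤ add₃ (λ r → differ (s r) (s′ r)) (lcost L B s′ t)
restart zero    B s s′ t = add₃-triangle _ (λ r → differ (s r) (s′ r)) (λ r → differ (s′ r) (t r)) _ (λ r → differ-triangle (s r) (s′ r) (t r))
restart (suc L) B s s′ t = add₃-triangle _ (λ r → differ (s r) (s′ r)) (λ r → differ (s′ r) (B (rail r))) _ (λ r → differ-triangle (s r) (s′ r) (B (rail r)))

-- Without the segment, the two lines of a rail at its vertex merge into one, which is cut only if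
-- one of the two was; the spokes merely disappear.
skip-segment : ∀ L B s t → lcost L (B ∘ up) s t ≤ lcost (suc L) B s t
skip-segment L B s t = ℕ.≤-trans (restart L (B ∘ up) s (B ∘ rail) t)
  (add₃-mono (λ r → differ (s r) (B (rail r))) (add₃-≥ (λ r → differ (B (rail r)) (B hub)) _))

-- The bounds carry a remainder `n` so that they apply to `lweight` and `lcost` as these unfold,
-- with the rest of the ladder in place of `n`.
data Segment (x y z h : Bool) : Set where
  empty : (∀ n → bit x + (bit y + (bit z + (bit h + n))) ≡ n) → Segment x y z h
  full  : (∀ n → suc n ≤ bit x + (bit y + (bit z + (bit h + n)))) → Segment x y z h
  mixed : (∀ n → suc n ≤ bit x + (bit y + (bit z + (bit h + n)))) →
          (∀ n → suc n ≤ differ x h + (differ y h + (differ z h + n))) → Segment x y z h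

segment : ∀ x y z h → Segment x y z h
segment false false false false = empty λ n → refl
segment false false false true  = mixed (λ n → ℕ.m≤n+m (suc n) 0) (λ n → ℕ.m≤n+m (suc n) 2)
segment false false true  false = mixed (λ n → ℕ.m≤n+m (suc n) 0) (λ n → ℕ.m≤n+m (suc n) 0)
segment false false true  true  = mixed (λ n → ℕ.m≤n+m (suc n) 1) (λ n → ℕ.m≤n+m (suc n) 1)
segment false true  false false = mixed (λ n → ℕ.m≤n+m (suc n) 0) (λ n → ℕ.m≤n+m (suc n) 0)
segment false true  false true  = mixed (λ n → ℕ.m≤n+m (suc n) 1) (λ n → ℕ.m≤n+m (suc n) 1)
segment false true  true  false = mixed (λ n → ℕ.m≤n+m (suc n) 1) (λ n → ℕ.m≤n+m (suc n) 1)
segment false true  true  true  = mixed (λ n → ℕ.m≤n+m (suc n) 2) (λ n → ℕ.m≤n+m (suc n) 0)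
segment true  false false false = mixed (λ n → ℕ.m≤n+m (suc n) 0) (λ n → ℕ.m≤n+m (suc n) 0)
segment true  false false true  = mixed (λ n → ℕ.m≤n+m (suc n) 1) (λ n → ℕ.m≤n+m (suc n) 1)
segment true  false true  false = mixed (λ n → ℕ.m≤n+m (suc n) 1) (λ n → ℕ.m≤n+m (suc n) 1)
segment true  false true  true  = mixed (λ n → ℕ.m≤n+m (suc n) 2) (λ n → ℕ.m≤n+m (suc n) 0)
segment true  true  false false = mixed (λ n → ℕ.m≤n+m (suc n) 1) (λ n → ℕ.m≤n+m (suc n) 1)
segment true  true  false true  = mixed (λ n → ℕ.m≤n+m (suc n) 2) (λ n → ℕ.m≤n+m (suc n) 0)
segment true  true  true  false = mixed (λ n → ℕ.m≤n+m (suc n) 2) (λ n → ℕ.m≤n+m (suc n) 2)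
segment true  true  true  true  = full λ n → ℕ.m≤n+m (suc n) 3

keep : ∀ {L} → (LV (suc (suc L)) → Bool) → (LV L → Bool) → LV (suc L) → Bool
keep B C (rail r) = B (rail r)
keep B C hub      = B hub
keep B C (up v)   = C v

-- If every segment contains a vertex of B, then either some segment lies in B, or
-- each of them contributes to the cut.
Deletion : ∀ L → (LV (suc L) → Bool) → (s t : Fin 3 → Bool) → Set
Deletion L B s t =
  (∃ λ C → lcost L C s t ≤ lcost (suc L) B s t × lweight L C ≡ lweight (suc L) B) ⊎
  suc L ≤ lweight (suc L) B ×
    ((∃ λ C → lcost L C s t ≤ lcost (suc L) B s t × L ≤ lweight L C) ⊎ suc L ≤ lcost (suc L) B s t)

-- A mixed segment cuts one of its own spokes, so contributions of different segments never
-- coincide. A full segment can be removed at once: each of the others still contains a vertex of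
-- `B`, which is why the weight is carried through the induction.
delete : ∀ L B s t → Deletion L B s t
delete zero B s t with segment (B (rail zero)) (B (rail (# 1))) (B (rail (# 2))) (B hub)
... | empty e   = inj₁ (B ∘ up , skip-segment 0 B s t , sym (e 0))
... | full f    = inj₂ (f 0 , inj₁ (B ∘ up , skip-segment 0 B s t , z≤n))
... | mixed f c = inj₂ (f 0 , inj₂ (ℕ.≤-trans (s≤s z≤n) (ℕ.≤-trans (c (lcost 0 (B ∘ up) (B ∘ rail) t)) (add₃-≥ (λ r → differ (s r) (B (rail r))) _))))
delete (suc L) B s t with segment (B (rail zero)) (B (rail (# 1))) (B (rail (# 2))) (B hub)
... | empty e = inj₁ (B ∘ up , skip-segment (suc L) B s t , sym (e (lweight (suc L) (B ∘ up))))
... | full f with delete L (B ∘ up) (B ∘ rail) t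
...   | inj₁ (C , le , w) = inj₁ (keep B C , add₃-mono (λ r → differ (s r) (B (rail r))) (add₃-mono (λ r → differ (B (rail r)) (B hub)) le) ,
                              cong (λ n → add₃ (λ r → bit (B (rail r))) (bit (B hub) + n)) w)
...   | inj₂ (w , _) = inj₂ (ℕ.≤-trans (s≤s w) (f _) , inj₁ (B ∘ up , skip-segment (suc L) B s t , w))
delete (suc L) B s t | mixed f c with delete L (B ∘ up) (B ∘ rail) t
...   | inj₁ (C , le , w) = inj₁ (keep B C , add₃-mono (λ r → differ (s r) (B (rail r))) (add₃-mono (λ r → differ (B (rail r)) (B hub)) le) ,
                              cong (λ n → add₃ (λ r → bit (B (rail r))) (bit (B hub) + n)) w)
...   | inj₂ (w , inj₁ (C , le , w′)) = inj₂ (ℕ.≤-trans (s≤s w) (f _) ,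
        inj₁ (keep B C , add₃-mono (λ r → differ (s r) (B (rail r))) (add₃-mono (λ r → differ (B (rail r)) (B hub)) le) , ℕ.≤-trans (s≤s w′) (f _)))
...   | inj₂ (w , inj₂ le) = inj₂ (ℕ.≤-trans (s≤s w) (f _) ,
        inj₂ (ℕ.≤-trans (s≤s le) (ℕ.≤-trans (c _) (add₃-≥ (λ r → differ (s r) (B (rail r))) _))))

sum-map-++ : {A : Set} (f : A → ℕ) (xs ys : List A) → sum (map f (xs ++ ys)) ≡ sum (map f xs) + sum (map f ys)
sum-map-++ f xs ys = trans (cong sum (map-++ f xs ys)) (sum-++ (map f xs) (map f ys))

sum-map-map : {A B : Set} (f : B → ℕ) (g : A → B) (xs : List A) → sum (map f (map g xs)) ≡ sum (map (f ∘ g) xs)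
sum-map-map f g xs = cong sum (sym (map-∘ {g = f} {f = g} xs))

module FlowerStructure (M : ℕ) where
  L : ℕ
  L = suc M

  open Flower L hiding (dart; line; dart-line; line-dart)
  open Pole pole
  open Cut pole
  open PoleLemmas pole

  graftᴼ : LOwner L → Owner
  graftᴼ (inj₁ v)                          = inj₁ (inj₂ v)
  graftᴼ (inj₂ (false , zero))             = inj₁ (inj₁ a₁)
  graftᴼ (inj₂ (false , suc zero))         = inj₂ (# 1 , # 2)
  graftᴼ (inj₂ (false , suc (suc zero)))   = inj₁ (inj₁ c₁)
  graftᴼ (inj₂ (true , zero))              = inj₂ (zero , # 2)
  graftᴼ (inj₂ (true , suc zero))          = inj₁ (inj₁ c₀)
  graftᴼ (inj₂ (true , suc (suc zero)))    = inj₁ (inj₁ b₀)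

  owner-graft : ∀ x → owner (graft x) ≡ graftᴼ (lowner x)
  owner-graft (inj₁ x)                        = refl
  owner-graft (inj₂ (false , zero))           = refl
  owner-graft (inj₂ (false , suc zero))       = refl
  owner-graft (inj₂ (false , suc (suc zero))) = refl
  owner-graft (inj₂ (true , zero))            = refl
  owner-graft (inj₂ (true , suc zero))        = refl
  owner-graft (inj₂ (true , suc (suc zero)))  = refl

  ungraft : Owner → LOwner L
  ungraft (inj₁ (inj₂ v))      = inj₁ v
  ungraft (inj₁ (inj₁ a₁))     = inj₂ (false , zero)
  ungraft (inj₁ (inj₁ c₁))     = inj₂ (false , # 2)
  ungraft (inj₁ (inj₁ c₀))     = inj₂ (true , # 1)
  ungraft (inj₁ (inj₁ _))      = inj₂ (true , # 2)
  ungraft (inj₂ (zero , _))    = inj₂ (true , zero)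
  ungraft (inj₂ (suc zero , _)) = inj₂ (false , # 1)

  ungraft-graft : ∀ o → ungraft (graftᴼ o) ≡ o
  ungraft-graft (inj₁ v)                        = refl
  ungraft-graft (inj₂ (false , zero))           = refl
  ungraft-graft (inj₂ (false , suc zero))       = refl
  ungraft-graft (inj₂ (false , suc (suc zero))) = refl
  ungraft-graft (inj₂ (true , zero))            = refl
  ungraft-graft (inj₂ (true , suc zero))        = refl
  ungraft-graft (inj₂ (true , suc (suc zero)))  = refl

  graft-lowner : ∀ x {o} → owner (graft x) ≡ o → lowner x ≡ ungraft o
  graft-lowner x eq = trans (sym (ungraft-graft (lowner x))) (cong ungraft (trans (sym (owner-graft x)) eq))

  stop-owner : ∀ r → ∃ λ v → owner (graft (lfar L (inj₂ (true , r)))) ≡ inj₁ (inj₂ v)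
  stop-owner r = let (v , i) , eq = lfar-stop M r in v , cong (owner ∘ graft) eq

  stop≢ : ∀ r {o} → (∀ v → inj₁ (inj₂ v) ≢ o) → owner (graft (lfar L (inj₂ (true , r)))) ≢ o
  stop≢ r ne eq = let v , eq′ = stop-owner r in ne v (trans (sym eq′) eq)

  no-loop : ∀ v i → owner (far (inj₁ (v , i))) ≢ inj₁ v
  no-loop (inj₂ v) i eq = lno-loop v i (graft-lowner (lfar L (inj₁ (v , i))) eq)
  no-loop (inj₁ b₀) (suc (suc zero)) eq = stop≢ (# 2) (λ _ ()) eq
  no-loop (inj₁ b₀) zero ()
  no-loop (inj₁ b₀) (suc zero) ()
  no-loop (inj₁ c₀) (suc (suc zero)) eq = stop≢ (# 1) (λ _ ()) eq
  no-loop (inj₁ c₀) zero ()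
  no-loop (inj₁ c₀) (suc zero) ()
  no-loop (inj₁ z₀) zero ()
  no-loop (inj₁ z₀) (suc zero) ()
  no-loop (inj₁ z₀) (suc (suc zero)) ()
  no-loop (inj₁ a₁) zero ()
  no-loop (inj₁ a₁) (suc zero) ()
  no-loop (inj₁ a₁) (suc (suc zero)) ()
  no-loop (inj₁ c₁) zero ()
  no-loop (inj₁ c₁) (suc zero) ()
  no-loop (inj₁ c₁) (suc (suc zero)) ()
  no-loop (inj₁ z₁) zero ()
  no-loop (inj₁ z₁) (suc zero) ()
  no-loop (inj₁ z₁) (suc (suc zero)) ()

  no-parallel : ∀ v → Rainbow (λ i → owner (far (inj₁ (v , i))))
  no-parallel (inj₂ v) i j eq = lno-parallel v i j
    (trans (graft-lowner (lfar L (inj₁ (v , i))) eq) (sym (graft-lowner (lfar L (inj₁ (v , j))) refl)))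
  no-parallel (inj₁ b₀) = distinct₃ _ (λ ()) (λ eq → stop≢ (# 2) (λ _ ()) (sym eq)) (λ eq → stop≢ (# 2) (λ _ ()) (sym eq))
  no-parallel (inj₁ c₀) = distinct₃ _ (λ ()) (λ eq → stop≢ (# 1) (λ _ ()) (sym eq)) (λ eq → stop≢ (# 1) (λ _ ()) (sym eq))
  no-parallel (inj₁ z₀) = distinct₃ _ (λ ()) (λ ()) (λ ())
  no-parallel (inj₁ a₁) = distinct₃ _ (λ ()) (λ ()) (λ ())
  no-parallel (inj₁ c₁) = distinct₃ _ (λ ()) (λ ()) (λ ())
  no-parallel (inj₁ z₁) = distinct₃ _ (λ ()) (λ ()) (λ ())

  port-inner : ∀ p → ∃ λ x → far (inj₂ p) ≡ inj₁ x
  port-inner (zero , zero)               = _ , refl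
  port-inner (zero , suc zero)           = _ , refl
  port-inner (zero , suc (suc zero))     = let _ , eq = lfar-stop M zero in _ , cong graft eq
  port-inner (suc zero , zero)           = _ , refl
  port-inner (suc zero , suc zero)       = _ , refl
  port-inner (suc zero , suc (suc zero)) = _ , refl

  to-z₁ : ∀ v → Star Adj v (inj₁ z₁)
  to-z₁ (inj₁ z₁) = ε
  to-z₁ (inj₁ a₁) = (zero , refl) ◅ ε
  to-z₁ (inj₁ c₁) = (# 1 , refl) ◅ ε
  to-z₁ (inj₁ c₀) = (# 1 , refl) ◅ (# 1 , refl) ◅ ε
  to-z₁ (inj₁ z₀) = (# 1 , refl) ◅ (# 1 , refl) ◅ (# 1 , refl) ◅ ε
  to-z₁ (inj₁ b₀) = (zero , refl) ◅ (# 1 , refl) ◅ (# 1 , refl) ◅ (# 1 , refl) ◅ ε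
  to-z₁ (inj₂ v)  = gmap inj₂ (λ {x} {y} → ladder-adj {x} {y}) (lconnected v) ◅◅ (zero , refl) ◅ (zero , refl) ◅ ε
    where
    ladder-adj : ∀ {x y} → LAdj x y → Adj (inj₂ x) (inj₂ y)
    ladder-adj {x} (i , eq) = i , trans (owner-graft (lfar L (inj₁ (x , i)))) (cong graftᴼ eq)

  connected : ∀ v w → Star Adj v w
  connected v w = to-z₁ v ◅◅ star-sym (to-z₁ w)

  index : V ↔ Fin (6 + L * 4)
  index = ↔-sym (Fin.+↔⊎ {6} {L * 4}) ↔-∘ (↔-id Cap ⊎-↔ LV↔ L)

  _≟ⱽ_ : DecidableEquality V
  _≟ⱽ_ = ⊎-≡-dec Fin._≟_ _≟ᴸⱽ_

  _≟ᴸ_ : DecidableEquality Line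
  _≟ᴸ_ = ⊎-≡-dec Fin._≟_ _≟ᴸᴸ_

  vertices : List V
  vertices = map inj₁ caps ++ map inj₂ (lvertices L)

  ∈-vertices : ∀ v → v ∈ vertices
  ∈-vertices (inj₁ c) = ∈-++⁺ˡ (∈-map⁺ inj₁ (∈-allFin c))
  ∈-vertices (inj₂ v) = ∈-++⁺ʳ (map inj₁ caps) (∈-map⁺ inj₂ (∈-lvertices v))

  lines : List Line
  lines = map inj₁ capLines ++ map inj₂ (llines L)

  ∈-lines : ∀ l → l ∈ lines
  ∈-lines (inj₁ c) = ∈-++⁺ˡ (∈-map⁺ inj₁ (∈-allFin c))
  ∈-lines (inj₂ l) = ∈-++⁺ʳ (map inj₁ capLines) (∈-map⁺ inj₂ (∈-llines l))

  lines-unique : Unique lines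
  lines-unique = Unique.++⁺ (Unique.map⁺ {f = inj₁} (λ { refl → refl }) (Unique.allFin⁺ 9))
                            (Unique.map⁺ {f = inj₂} (λ { refl → refl }) (llines-unique L)) disjoint
    where
    disjoint : ∀ {l} → l ∈ map inj₁ capLines × l ∈ map inj₂ (llines L) → ⊥
    disjoint (p , q) with ∈-map⁻ inj₁ p | ∈-map⁻ inj₂ q
    ... | _ , _ , refl | _ , _ , ()

  entering leaving : (V → Bool) → (Port → Bool) → Fin 3 → Bool
  entering A b = triple (A (inj₁ a₁)) (b (# 1 , # 2)) (A (inj₁ c₁))
  leaving  A b = triple (b (zero , # 2)) (A (inj₁ c₀)) (A (inj₁ b₀))

  side-graft : ∀ A b x → side A b (owner (graft x)) ≡ lside (A ∘ inj₂) (entering A b) (leaving A b) (lowner x)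
  side-graft A b (inj₁ x)                        = refl
  side-graft A b (inj₂ (false , zero))           = refl
  side-graft A b (inj₂ (false , suc zero))       = refl
  side-graft A b (inj₂ (false , suc (suc zero))) = refl
  side-graft A b (inj₂ (true , zero))            = refl
  side-graft A b (inj₂ (true , suc zero))        = refl
  side-graft A b (inj₂ (true , suc (suc zero)))  = refl

  capsCost : (V → Bool) → (Port → Bool) → ℕ
  capsCost A b = sum (map (cut A b) (map inj₁ capLines))

  cutSize-split : ∀ A b → cutSize lines A b ≡ capsCost A b + lcost L (A ∘ inj₂) (entering A b) (leaving A b)
  cutSize-split A b = trans (sum-map-++ (cut A b) (map inj₁ capLines) (map inj₂ (llines L)))
    (cong (capsCost A b +_) (trans (sum-map-map (cut A b) inj₂ (llines L))
      (trans (cong sum (map-cong same (llines L))) (sum-lcut L (A ∘ inj₂) (entering A b) (leaving A b)))))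
    where
    same : ∀ l → cut A b (inj₂ l) ≡ lcut (A ∘ inj₂) (entering A b) (leaving A b) l
    same l = cong₂ differ (side-graft A b (ldart (l , false))) (side-graft A b (ldart (l , true)))

  weight-split : ∀ A → weight vertices A ≡ sum (map (λ c → bit (A (inj₁ c))) caps) + lweight L (A ∘ inj₂)
  weight-split A = trans (sum-map-++ (λ v → bit (A v)) (map inj₁ caps) (map inj₂ (lvertices L)))
    (cong₂ _+_ (sum-map-map (λ v → bit (A v)) inj₁ caps)
      (trans (sum-map-map (λ v → bit (A v)) inj₂ (lvertices L)) (sum-lweight L (A ∘ inj₂))))

replace : ∀ {M N} → (Cap ⊎ LV M → Bool) → (LV N → Bool) → Cap ⊎ LV N → Bool
replace A C (inj₁ c) = A (inj₁ c)
replace A C (inj₂ v) = C v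

Linked : ℕ → Set
Linked M = ∀ A b → ones b ⊓ (6 ∸ ones b) ≤ Cut.cutSize (Flower.pole (suc M)) (FlowerStructure.lines M) A b

-- Removing the first segment of the ladder does not touch `b` and does not enlarge the cut.
linked-suc : ∀ M → Linked M → Linked (suc M)
linked-suc M linked A b = ℕ.≤-trans (linked A′ b) (subst₂ _≤_ (sym (M.cutSize-split A′ b)) (sym (N.cutSize-split A b))
    (ℕ.+-monoʳ-≤ (N.capsCost A b) (skip-segment (suc M) (A ∘ inj₂) (N.entering A b) (N.leaving A b))))
  where
  module M = FlowerStructure M
  module N = FlowerStructure (suc M)
  A′ : Cap ⊎ LV (suc M) → Bool
  A′ = replace A (A ∘ inj₂ ∘ up)

Expanding : ℕ → Set
Expanding M = ∀ A → let w = Cut.weight (Flower.pole (suc M)) (FlowerStructure.vertices M) A in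
  w ≡ 0 ⊎ 6 ⊓ (2 + w) ≤ Cut.cutSize (Flower.pole (suc M)) (FlowerStructure.lines M) A (λ _ → false)

-- If an empty segment is removed, the weight is kept and the bound is inherited. If a full one is
-- removed, at least M + 1 ≥ 5 vertices remain, so the shorter flower already forces six lines. If
-- all M + 2 ≥ 6 segments are mixed, they cut six lines themselves.
expanding-suc : ∀ M → 4 ≤ M → Expanding M → Expanding (suc M)
expanding-suc M 4≤M expanding A with delete (suc M) (A ∘ inj₂) (N.entering A (λ _ → false)) (N.leaving A (λ _ → false))
  where module N = FlowerStructure (suc M)
... | inj₁ (C , le , same) = Data.Sum.map (trans same′) (λ le′ → ℕ.≤-trans (ℕ.≤-reflexive (cong (λ w → 6 ⊓ (2 + w)) same′)) (ℕ.≤-trans le′ cut≤)) (expanding A′)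
  where
  module M = FlowerStructure M
  module N = FlowerStructure (suc M)
  A′ = replace {suc (suc M)} A C
  same′ : Cut.weight (Flower.pole (suc (suc M))) N.vertices A ≡ Cut.weight (Flower.pole (suc M)) M.vertices A′
  same′ = trans (N.weight-split A) (trans (cong (sum (map (λ c → bit (A (inj₁ c))) caps) +_) (sym same)) (sym (M.weight-split A′)))
  cut≤ : Cut.cutSize (Flower.pole (suc M)) M.lines A′ (λ _ → false) ≤ Cut.cutSize (Flower.pole (suc (suc M))) N.lines A (λ _ → false)
  cut≤ = subst₂ _≤_ (sym (M.cutSize-split A′ (λ _ → false))) (sym (N.cutSize-split A (λ _ → false))) (ℕ.+-monoʳ-≤ (N.capsCost A (λ _ → false)) le)
... | inj₂ (_ , inj₂ large) = inj₂ (ℕ.≤-trans (ℕ.m⊓n≤m 6 _) (ℕ.≤-trans (s≤s (s≤s 4≤M))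
        (subst (suc (suc M) ≤_) (sym (FlowerStructure.cutSize-split (suc M) A (λ _ → false)))
          (ℕ.≤-trans large (ℕ.m≤n+m _ (FlowerStructure.capsCost (suc M) A (λ _ → false)))))))
... | inj₂ (_ , inj₁ (C , le , large)) = inj₂ (ℕ.≤-trans (ℕ.m⊓n≤m 6 _) (ℕ.≤-trans six cut≤))
  where
  module M = FlowerStructure M
  module N = FlowerStructure (suc M)
  A′ = replace {suc (suc M)} A C
  cut≤ : Cut.cutSize (Flower.pole (suc M)) M.lines A′ (λ _ → false) ≤ Cut.cutSize (Flower.pole (suc (suc M))) N.lines A (λ _ → false)
  cut≤ = subst₂ _≤_ (sym (M.cutSize-split A′ (λ _ → false))) (sym (N.cutSize-split A (λ _ → false))) (ℕ.+-monoʳ-≤ (N.capsCost A (λ _ → false)) le)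
  heavy : 5 ≤ Cut.weight (Flower.pole (suc M)) M.vertices A′
  heavy = subst (5 ≤_) (sym (M.weight-split A′)) (ℕ.≤-trans (s≤s 4≤M) (ℕ.≤-trans large (ℕ.m≤n+m (lweight (suc M) C) (sum (map (λ c → bit (A (inj₁ c))) caps)))))
  six : 6 ≤ Cut.cutSize (Flower.pole (suc M)) M.lines A′ (λ _ → false)
  six with expanding A′
  ... | inj₁ w≡0 = ⊥-elim (ℕ.<⇒≱ (s≤s z≤n) (subst (5 ≤_) w≡0 heavy))
  ... | inj₂ le′ = ℕ.≤-trans (ℕ.⊓-glb ℕ.≤-refl (s≤s (s≤s (ℕ.≤-trans (ℕ.n≤1+n 4) heavy)))) le′

linked-base : Linked 2
linked-base A b = CutSearch.linked-search pole _≟ⱽ_ vertices lines A b refl refl refl refl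
  where
  open FlowerStructure 2
  open Flower 3 using (pole)

expanding-base : ∀ A → let w = Cut.weight (Flower.pole 3) (FlowerStructure.vertices 2) A in
  w ≡ 0 ⊎ 6 ⊓ (2 + w) ≤ Cut.cutSize (Flower.pole 3) (FlowerStructure.lines 2) A (λ _ → false)
expanding-base A = CutSearch.expanding-search pole _≟ⱽ_ vertices lines A refl refl refl refl
  where
  open FlowerStructure 2
  open Flower 3 using (pole)

-- The induction step needs at least five segments to start from, so the lengths 3 and 5 are both
-- searched.
expanding-base₅ : Expanding 4
expanding-base₅ A = CutSearch.expanding-search pole _≟ⱽ_ vertices lines A refl refl refl refl
  where
  open FlowerStructure 4
  open Flower 5 using (pole)

-- Totals carried by flower poles

-- Minus a + b modulo 3: the remaining colour if `a` and `b` differ, and their common value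
-- otherwise.
third : Colour → Colour → Colour
third a b = (6 ∸ (Fin.toℕ a + Fin.toℕ b)) mod 3

third-involutive : ∀ a b → third a (third a b) ≡ b
third-involutive = toWitness {a? = Fin.all? λ a → Fin.all? λ b → third a (third a b) Fin.≟ b} _

-- Crossing a segment exchanges the two colours other than the net colour s on the
-- rails (kind (s , a) ↦ (s , third s a)), or preserves the orientation of three
-- distinct colours; nothing extends three equal colours.
kind : (Fin 3 → Colour) → Maybe (Colour × Colour)
kind x =
  if does (x zero Fin.≟ x (# 1)) then
    (if does (x zero Fin.≟ x (# 2)) then nothing else just (x (# 2) , x zero)) else
  if does (x zero Fin.≟ x (# 2)) then just (x (# 1) , x zero) else
  if does (x (# 1) Fin.≟ x (# 2)) then just (x zero , x (# 1)) else
  let d = (Fin.toℕ (x (# 1)) + 2 * Fin.toℕ (x zero)) mod 3 in just (d , d)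

cross : Colour × Colour → Colour × Colour
cross (s , a) = s , third s a

_≟²_ : DecidableEquality (Colour × Colour)
_≟²_ = ×-≡-dec Fin._≟_ Fin._≟_

crossed : Maybe (Colour × Colour) → Maybe (Colour × Colour) → Bool
crossed (just k) (just m) = does (m ≟² cross k)
crossed _        _        = false

crossed-sound : ∀ k m → crossed k m ≡ true → ∃ λ c → k ≡ just c × m ≡ just (cross c)
crossed-sound (just k) (just m) eq with m ≟² cross k
... | yes refl = k , refl , refl

values : {K : Set} → (Fin 3 → K) → Fin 3 → K
values f = triple (f zero) (f (# 1)) (f (# 2))

values-≗ : {K : Set} (f : Fin 3 → K) → ∀ i → f i ≡ values f i
values-≗ f zero             = refl
values-≗ f (suc zero)       = refl
values-≗ f (suc (suc zero)) = refl

module OneSegment where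

  X : Set
  X = Fin 3 × Fin 3

  -- Rows of X: the rails before a segment, the rails after it, and its spokes.
  triples : List (Fin 3 → X)
  triples = (λ i → # 2 , i) ∷ map (λ r i → i , r) (allFin 3)

  open ColourSearch {X} (×-≡-dec Fin._≟_ Fin._≟_) triples

  order : List X
  order = cartesianProduct (allFin 3) (allFin 3)

  test : List Colour → ℕ → Bool
  test (_ ∷ _ ∷ _ ∷ y₂ ∷ y₁ ∷ y₀ ∷ x₂ ∷ x₁ ∷ x₀ ∷ []) _ = crossed (kind (triple x₀ x₁ x₂)) (kind (triple y₀ y₁ y₂))
  test _ _ = true

  one-segment : (x y p : Fin 3 → Colour) → (∀ r → Rainbow (triple (x r) (y r) (p r))) → Rainbow p →
    crossed (kind (values x)) (kind (values y)) ≡ true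
  one-segment x y p rails spokes = subst (λ ys → test ys 0 ≡ true) stack (colour-search f rainbow test order refl refl)
    where
    f : X → Colour
    f (i , r) = triple x y p i r
    stack : map f (reversed order []) ≡ p (# 2) ∷ p (# 1) ∷ p zero ∷ y (# 2) ∷ y (# 1) ∷ y zero ∷ x (# 2) ∷ x (# 1) ∷ x zero ∷ []
    stack = refl
    at : ∀ r i → triple (x r) (y r) (p r) i ≡ f (i , r)
    at r zero             = refl
    at r (suc zero)       = refl
    at r (suc (suc zero)) = refl
    rainbow : ∀ t → t ∈ triples → Rainbow (f ∘ t)
    rainbow t (here refl) = spokes
    rainbow t (there t∈) with ∈-map⁻ (λ r i → i , r) t∈
    ... | r , _ , refl = λ i j eq → rails r i j (trans (at r i) (trans eq (sym (at r j))))

Rainbow-cong : {K : Set} {f g : Fin 3 → K} → (∀ i → f i ≡ g i) → Rainbow f → Rainbow g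
Rainbow-cong f≗g rf i j eq = rf i j (trans (f≗g i) (trans eq (sym (f≗g j))))

crosses : ℕ → Colour × Colour → Colour × Colour
crosses zero    k = k
crosses (suc n) k = crosses n (cross k)

ladder-step : ∀ {L} (f : LL (suc L) → Colour) → (∀ v → Rainbow (f ∘ linc v)) →
  crossed (kind (values (f ∘ railˡ))) (kind (values (f ∘ LL.up ∘ start L))) ≡ true
ladder-step {L} f proper = OneSegment.one-segment (f ∘ railˡ) (f ∘ LL.up ∘ start L) (f ∘ spoke)
  (λ r → Rainbow-cong (values-≗ (f ∘ linc (rail r))) (proper (rail r))) (proper hub)

ladder-kind : ∀ L (f : LL L → Colour) → (∀ v → Rainbow (f ∘ linc v)) → ∀ k →
  kind (values (f ∘ start L)) ≡ just k → kind (values (f ∘ stop L)) ≡ just (crosses L k)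
ladder-kind zero    f proper k eq = eq
ladder-kind (suc L) f proper k eq =
  ladder-kind L (f ∘ up) (proper ∘ up) (cross k) (trans (proj₂ (proj₂ step)) (cong (just ∘ cross) (just-injective (trans (sym (proj₁ (proj₂ step))) eq))))
  where
  step : ∃ λ c → kind (values (f ∘ railˡ)) ≡ just c × kind (values (f ∘ LL.up ∘ start L)) ≡ just (cross c)
  step = crossed-sound (kind (values (f ∘ railˡ))) (kind (values (f ∘ LL.up ∘ start L))) (ladder-step f proper)

double : ℕ → ℕ
double zero    = zero
double (suc t) = suc (suc (double t))

-- Two crossings cancel because `third s` is an involution. A ladder with an odd number of segments
-- thus acts like a single one, which is the reason for the lengths 3 + 2t.
crosses-odd : ∀ t k → crosses (3 + double t) k ≡ cross k
crosses-odd zero    (s , a) = cong (λ b → s , third s b) (third-involutive s a)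
crosses-odd (suc t) (s , a) = trans (cong (λ b → crosses (3 + double t) (s , b)) (third-involutive s a)) (crosses-odd t (s , a))

module FlowerNet where

  X : Set
  X = CapLine ⊎ (Bool × Fin 3)

  _≟ˣ_ : DecidableEquality X
  _≟ˣ_ = ⊎-≡-dec Fin._≟_ (×-≡-dec Data.Bool._≟_ Fin._≟_)

  strip : (CapLine × Bool) ⊎ (Bool × Fin 3) → X
  strip (inj₁ (c , _)) = inj₁ c
  strip (inj₂ e)       = inj₂ e

  triples : List (Fin 3 → X)
  triples = map (λ c i → strip (capline c i)) caps

  open ColourSearch _≟ˣ_ triples

  order : List X
  order = map inj₂ (cartesianProduct (false ∷ true ∷ []) (allFin 3)) ++ map inj₁ capLines

  compatible : Maybe (Colour × Colour) → Maybe (Colour × Colour) → Maybe Colour → Maybe Colour → Bool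
  compatible k m a b = if crossed k m then equal a b else true

  test : List Colour → ℕ → Bool
  test (y₁ ∷ y₀ ∷ x₁ ∷ x₀ ∷ _ ∷ _ ∷ _ ∷ _ ∷ _ ∷ t₂ ∷ t₁ ∷ t₀ ∷ s₂ ∷ s₁ ∷ s₀ ∷ []) _ =
    compatible (kind (triple s₀ s₁ s₂)) (kind (triple t₀ t₁ t₂)) (net (triple x₀ x₁ t₀)) (net (triple y₀ y₁ s₁))
  test _ _ = true

  before after : Fin 3 → X
  before r = inj₂ (false , r)
  after  r = inj₂ (true , r)

  ports₀ ports₁ : Fin 3 → X
  ports₀ = triple (inj₁ p₀) (inj₁ p₁) (after zero)
  ports₁ = triple (inj₁ q₀) (inj₁ q₁) (before (# 1))

  -- The caps notice the ladder only through the kinds at its two ends. One search over the nine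
  -- lines of the caps and the six rail ends thus settles all odd lengths; where the kinds are not
  -- related by one crossing, `compatible` asserts nothing.
  cap-search : ∀ g → (∀ τ → τ ∈ triples → Rainbow (g ∘ τ)) →
    compatible (kind (values (g ∘ before))) (kind (values (g ∘ after))) (net (values (g ∘ ports₀))) (net (values (g ∘ ports₁))) ≡ true
  cap-search g rainbow = subst (λ ys → test ys 0 ≡ true) stack (colour-search g rainbow test order refl refl)
    where
    stack : map g (reversed order []) ≡
      g (inj₁ q₁) ∷ g (inj₁ q₀) ∷ g (inj₁ p₁) ∷ g (inj₁ p₀) ∷ g (inj₁ c₁z₁) ∷ g (inj₁ a₁z₁) ∷ g (inj₁ c₀c₁) ∷ g (inj₁ z₀c₀) ∷ g (inj₁ z₀b₀) ∷
      g (after (# 2)) ∷ g (after (# 1)) ∷ g (after zero) ∷ g (before (# 2)) ∷ g (before (# 1)) ∷ g (before zero) ∷ []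
    stack = refl

  compatible-just : ∀ k a b → compatible (just k) (just (cross k)) a b ≡ true → equal a b ≡ true
  compatible-just k a b eq with cross k ≟² cross k
  ... | yes _ = eq
  ... | no ne = ⊥-elim (ne refl)

  module _ (t : ℕ) where
    open FlowerStructure (2 + double t) using (L)
    open Flower L
    open Pole pole using (inc; pline)

    net-flow : ∀ (f : CapLine ⊎ LL L → Colour) → (∀ v → Rainbow (f ∘ inc v)) → ∃ λ s → ∀ σ → net (f ∘ pline σ) ≡ just s
    net-flow f proper = proj₁ found , λ { zero → proj₁ (proj₂ found) ; (suc zero) → proj₂ (proj₂ found) }
      where
      g : X → Colour
      g (inj₁ c)           = f (inj₁ c)
      g (inj₂ (false , r)) = f (inj₂ (start L r))
      g (inj₂ (true , r))  = f (inj₂ (stop L r))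
      g-strip : ∀ x → f (proj₁ (extend x)) ≡ g (strip x)
      g-strip (inj₁ c)           = refl
      g-strip (inj₂ (false , r)) = refl
      g-strip (inj₂ (true , r))  = refl
      rainbow : ∀ τ → τ ∈ triples → Rainbow (g ∘ τ)
      rainbow τ τ∈ = let c , _ , τ≡ = ∈-map⁻ (λ c i → strip (capline c i)) τ∈ in
        subst (λ τ → Rainbow (g ∘ τ)) (sym τ≡) (Rainbow-cong (λ i → g-strip (capline c i)) (proper (inj₁ c)))
      entry : ∃ λ k → kind (values (f ∘ inj₂ ∘ LL.railˡ)) ≡ just k × kind (values (f ∘ inj₂ ∘ LL.up ∘ start (2 + double t))) ≡ just (cross k)
      entry = crossed-sound (kind (values (f ∘ inj₂ ∘ LL.railˡ))) (kind (values (f ∘ inj₂ ∘ LL.up ∘ start (2 + double t)))) (ladder-step (f ∘ inj₂) (proper ∘ inj₂))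
      k = proj₁ entry
      exit : kind (values (f ∘ inj₂ ∘ stop L)) ≡ just (cross k)
      exit = trans (ladder-kind L (f ∘ inj₂) (proper ∘ inj₂) k (proj₁ (proj₂ entry))) (cong just (crosses-odd t k))
      found : ∃ λ s → net (values (g ∘ ports₀)) ≡ just s × net (values (g ∘ ports₁)) ≡ just s
      found = equal-sound (net (values (g ∘ ports₀))) (net (values (g ∘ ports₁))) (compatible-just k (net (values (g ∘ ports₀))) (net (values (g ∘ ports₁))) (subst₂ (λ a b → compatible a b (net (values (g ∘ ports₀))) (net (values (g ∘ ports₁))) ≡ true)
                (proj₁ (proj₂ entry)) exit (cap-search g rainbow)))

-- Spokes for a segment entered with colours s, which are then s ↦ third s spokes
-- when leaving it; the next segment may have the same spokes and restores s.
spokes : (Fin 3 → Colour) → Fin 3 → Colour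
spokes s =
  if does (s zero Fin.≟ s (# 1)) then triple (s zero ⊕ 1) (s zero ⊕ 2) (s zero) else
  if does (s zero Fin.≟ s (# 2)) then triple (s zero ⊕ 1) (s zero) (s zero ⊕ 2) else
  if does (s (# 1) Fin.≟ s (# 2)) then triple (s (# 1)) (s (# 1) ⊕ 1) (s (# 1) ⊕ 2) else
  (λ r → s r ⊕ 1)

between : (Fin 3 → Colour) → Fin 3 → Colour
between s r = third (s r) (spokes s r)

-- Two segments with equal spokes can be inserted where the rails carry `s`: the first leads from
-- `s` to `between s`, the second back to `s`.
Fits : (Fin 3 → Colour) → Set
Fits s = Rainbow (spokes s) × (∀ r → Rainbow (triple (s r) (between s r) (spokes s r)) × Rainbow (triple (between s r) (s r) (spokes s r)))

Fits-cong : {s t : Fin 3 → Colour} → (∀ r → t r ≡ s r) → Fits (values s) → Fits (values t)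
Fits-cong eq = subst Fits (sym (triple-≡ (eq zero) (eq (# 1)) (eq (# 2))))
  where
  triple-≡ : ∀ {a b c a′ b′ c′ : Colour} → a ≡ a′ → b ≡ b′ → c ≡ c′ → triple a b c ≡ triple a′ b′ c′
  triple-≡ refl refl refl = refl

fits? : ∀ s → Dec (Fits s)
fits? s = rainbow? (spokes s) ×-dec Fin.all? λ r → rainbow? (triple (s r) (between s r) (spokes s r)) ×-dec rainbow? (triple (between s r) (s r) (spokes s r))

cutline : ∀ {L} → Fin (suc L) → Fin 3 → LL L
cutline {L}     zero    r = start L r
cutline {suc L} (suc d) r = up (cutline d r)

cutline-last : ∀ L r → cutline (fromℕ L) r ≡ stop L r
cutline-last zero    r = refl
cutline-last (suc L) r = cong up (cutline-last L r)

insert : ∀ {L} → Fin (suc L) → (Fin 3 → Colour) → (LL L → Colour) → LL (2 + L) → Colour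
insert {L}     zero    s f (railˡ r)      = s r
insert {L}     zero    s f (spoke r)      = spokes s r
insert {L}     zero    s f (up (railˡ r)) = between s r
insert {L}     zero    s f (up (spoke r)) = spokes s r
insert {L}     zero    s f (up (up l))    = f l
insert {suc L} (suc d) s f (railˡ r)      = f (railˡ r)
insert {suc L} (suc d) s f (spoke r)      = f (spoke r)
insert {suc L} (suc d) s f (up l)         = insert d s (f ∘ up) l

shift : ∀ {L} → Fin (suc L) → LL L → LL (2 + L)
shift {L}     zero    l         = up (up l)
shift {suc L} (suc d) (railˡ r) = railˡ r
shift {suc L} (suc d) (spoke r) = spoke r
shift {suc L} (suc d) (up l)    = up (shift d l)

shift-stop : ∀ {L} d r → shift {L} d (stop L r) ≡ stop (2 + L) r
shift-stop {L}     zero    r = refl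
shift-stop {suc L} (suc d) r = cong up (shift-stop d r)

insert-start : ∀ {L} (d : Fin (suc L)) (f : LL L → Colour) (s : Fin 3 → Colour) → (∀ r → s r ≡ f (cutline d r)) →
  ∀ r → insert d s f (start (2 + L) r) ≡ f (start L r)
insert-start {L}     zero    f s s≡ r = s≡ r
insert-start {suc L} (suc d) f s s≡ r = refl

insert-stop : ∀ {L} (d : Fin (suc L)) (f : LL L → Colour) (s : Fin 3 → Colour) → (∀ r → s r ≡ f (cutline d r)) →
  ∀ r → insert d s f (stop (2 + L) r) ≡ f (stop L r)
insert-stop {L}     zero    f s s≡ r = refl
insert-stop {suc L} (suc d) f s s≡ r = insert-stop d (f ∘ up) s s≡ r

-- `Ex` stands for the broken line, at whose ends nothing is required. The cut has to avoid it,
-- because every rail line there is divided into three.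
insert-rainbow : ∀ {L} (d : Fin (suc L)) (f : LL L → Colour) (s : Fin 3 → Colour) → (∀ r → s r ≡ f (cutline d r)) → Fits s →
  (Ex : LL L → Set) (Ex⁺ : LL (2 + L) → Set) → (∀ l → Ex l → Ex⁺ (shift d l)) → (∀ r → ¬ Ex (cutline d r)) →
  (∀ v → (∀ i → ¬ Ex (linc v i)) → Rainbow (f ∘ linc v)) →
  ∀ w → (∀ i → ¬ Ex⁺ (linc w i)) → Rainbow (insert d s f ∘ linc w)
insert-rainbow {L} zero f s s≡ (hub-ok , rails) Ex Ex⁺ ex cut ok (rail r) n =
  Rainbow-cong (λ { zero → refl ; (suc zero) → refl ; (suc (suc zero)) → refl }) (proj₁ (rails r))
insert-rainbow {L} zero f s s≡ (hub-ok , rails) Ex Ex⁺ ex cut ok hub n = hub-ok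
insert-rainbow {L} zero f s s≡ (hub-ok , rails) Ex Ex⁺ ex cut ok (up (rail r)) n =
  Rainbow-cong (λ { zero → refl ; (suc zero) → s≡ r ; (suc (suc zero)) → refl }) (proj₂ (rails r))
insert-rainbow {L} zero f s s≡ (hub-ok , rails) Ex Ex⁺ ex cut ok (up hub) n = hub-ok
insert-rainbow {L} zero f s s≡ (hub-ok , rails) Ex Ex⁺ ex cut ok (up (up v)) n = ok v (λ i e → n i (ex _ e))
insert-rainbow {suc L} (suc d) f s s≡ fits Ex Ex⁺ ex cut ok (rail r) n =
  Rainbow-cong (λ { zero → refl ; (suc zero) → sym (insert-start d (f ∘ up) s s≡ r) ; (suc (suc zero)) → refl })
    (ok (rail r) (λ { zero e → n zero (ex _ e) ; (suc zero) e → next d {Ex} {Ex⁺} ex cut e (n (suc zero)) ; (suc (suc zero)) e → n (suc (suc zero)) (ex _ e) }))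
  where
  next : ∀ {L} (d : Fin (suc L)) {Ex : LL (suc L) → Set} {Ex⁺ : LL (3 + L) → Set} → (∀ l → Ex l → Ex⁺ (shift (suc d) l)) →
         (∀ r → ¬ Ex (cutline (suc d) r)) → Ex (up (start L r)) → ¬ Ex⁺ (up (start (2 + L) r)) → ⊥
  next zero ex cut e n = cut r e
  next {suc L} (suc d) ex cut e n = n (ex _ e)
insert-rainbow {suc L} (suc d) f s s≡ fits Ex Ex⁺ ex cut ok hub n = ok hub (λ i e → n i (ex _ e))
insert-rainbow {suc L} (suc d) f s s≡ fits Ex Ex⁺ ex cut ok (up w) n =
  insert-rainbow d (f ∘ up) s s≡ fits (Ex ∘ up) (Ex⁺ ∘ up) (λ l → ex (up l)) cut (ok ∘ up) w n

-- The two `Fits` fields keep the induction going: they survive an insertion, so further segments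
-- can be inserted at either end.
record Colouring (M : ℕ) (Ex : CapLine ⊎ LL (suc M) → Set) : Set where
  open Pole (Flower.pole (suc M))
  field
    colour  : CapLine ⊎ LL (suc M) → Colour
    rainbow : ∀ v → (∀ i → ¬ Ex (inc v i)) → Rainbow (colour ∘ inc v)
    fits-start : Fits (values (λ r → colour (inj₂ (start (suc M) r))))
    fits-stop  : Fits (values (λ r → colour (inj₂ (stop (suc M) r))))

shiftF : ∀ {M} → Fin (2 + M) → CapLine ⊎ LL (suc M) → CapLine ⊎ LL (3 + M)
shiftF d (inj₁ c) = inj₁ c
shiftF d (inj₂ l) = inj₂ (shift d l)

module Insertion {M : ℕ} (d : Fin (2 + M)) (Ex : CapLine ⊎ LL (suc M) → Set) (C : Colouring M Ex)
                 (fits : Fits (values (λ r → Colouring.colour C (inj₂ (cutline d r))))) where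
  open Colouring C
  module X = Pole (Flower.pole (suc M))
  module Y = Pole (Flower.pole (3 + M))

  state : Fin 3 → Colour
  state = values (λ r → colour (inj₂ (cutline d r)))

  colour⁺ : CapLine ⊎ LL (3 + M) → Colour
  colour⁺ (inj₁ c) = colour (inj₁ c)
  colour⁺ (inj₂ l) = insert d state (colour ∘ inj₂) l

  state≡ : ∀ r → state r ≡ colour (inj₂ (cutline d r))
  state≡ r = sym (values-≗ (λ r → colour (inj₂ (cutline d r))) r)

  colour-extend : ∀ x → colour⁺ (proj₁ (Flower.extend (3 + M) x)) ≡ colour (proj₁ (Flower.extend (suc M) x))
  colour-extend (inj₁ c)           = refl
  colour-extend (inj₂ (false , r)) = insert-start d (colour ∘ inj₂) state state≡ r
  colour-extend (inj₂ (true , r))  = insert-stop d (colour ∘ inj₂) state state≡ r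

  colour-pline : ∀ σ i → colour⁺ (Y.pline σ i) ≡ colour (X.pline σ i)
  colour-pline σ i = colour-extend (portline (σ , i))

  module _ (Ex⁺ : CapLine ⊎ LL (3 + M) → Set) (ex : ∀ l → Ex l → Ex⁺ (shiftF d l)) (cut : ∀ r → ¬ Ex (inj₂ (cutline d r))) where

    extend-Ex : ∀ x → Ex (proj₁ (Flower.extend (suc M) x)) → Ex⁺ (proj₁ (Flower.extend (3 + M) x))
    extend-Ex (inj₁ c)           e = ex _ e
    extend-Ex (inj₂ (true , r))  e = subst (Ex⁺ ∘ inj₂) (shift-stop d r) (ex _ e)
    extend-Ex (inj₂ (false , r)) e = at d ex cut e
      where
      at : ∀ d → (∀ l → Ex l → Ex⁺ (shiftF d l)) → (∀ r → ¬ Ex (inj₂ (cutline d r))) → Ex (inj₂ (start (suc M) r)) → Ex⁺ (inj₂ (start (3 + M) r))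
      at zero    ex cut e = ⊥-elim (cut r e)
      at (suc d) ex cut e = ex _ e

    rainbow⁺ : ∀ v → (∀ i → ¬ Ex⁺ (Y.inc v i)) → Rainbow (colour⁺ ∘ Y.inc v)
    rainbow⁺ (inj₁ c) n = Rainbow-cong (λ i → sym (colour-extend (capline c i))) (rainbow (inj₁ c) (λ i e → n i (extend-Ex (capline c i) e)))
    rainbow⁺ (inj₂ v) n = insert-rainbow d (colour ∘ inj₂) state state≡ fits (Ex ∘ inj₂) (Ex⁺ ∘ inj₂) (λ l → ex (inj₂ l)) cut (rainbow ∘ inj₂) v n

    inserted : Colouring (2 + M) Ex⁺
    inserted = record
      { colour     = colour⁺
      ; rainbow    = rainbow⁺
      ; fits-start = Fits-cong (insert-start d (colour ∘ inj₂) state state≡) fits-start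
      ; fits-stop  = Fits-cong (insert-stop d (colour ∘ inj₂) state state≡) fits-stop
      }

-- Tables for the shortest flower pole

position : ∀ L → LL L → ℕ
position zero    (last r)  = Fin.toℕ r
position (suc L) (railˡ r) = Fin.toℕ r
position (suc L) (spoke r) = 3 + Fin.toℕ r
position (suc L) (up l)    = 6 + position L l

positionF : ∀ L → CapLine ⊎ LL L → ℕ
positionF L (inj₁ c) = Fin.toℕ c
positionF L (inj₂ l) = 9 + position L l

-- Certificates for three segments, with lines numbered by `positionF 3`: row `l` serves `broken`,
-- row 5σ + p serves `through σ p`. Each colouring also satisfies `Fits` at both ends of the ladder,
-- as insertion demands.
broken-table through-table : List String
broken-table =
  "002200121001120212120001120212" ∷
  "002100212001120212120001210122" ∷
  "120100202010102221102010201122" ∷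
  "010022012001120212120001210122" ∷
  "120200102010102221012100021212" ∷
  "002100212001120212120001120212" ∷
  "010022021001120212021100012221" ∷
  "210120200001120212120001210122" ∷
  "120220100001120212120001120212" ∷
  "012102112001012020102211120002" ∷
  "012202111001102200012121210002" ∷
  "020101212001210120012201120012" ∷
  "012202121001022010201122210001" ∷
  "012202121001202100021212120001" ∷
  "021121220010220100021212120001" ∷
  "012202121001012020201212120001" ∷
  "012202121001102200021122210001" ∷
  "021121220010120200012122210001" ∷
  "102202121001120212000221102010" ∷
  "102202121001210122000221102010" ∷
  "012202121001120212000122210001" ∷
  "012202121001120212201020012001" ∷
  "012202121001210122021200102001" ∷
  "102202121001210122012200120010" ∷
  "012202121001210122201010022001" ∷
  "012202121001120212021100202001" ∷
  "102202121001120212021100220010" ∷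
  "012102212001210122201010021002" ∷
  "022101212001120212021100201002" ∷
  "212200121001210122201010120200" ∷ []
through-table =
  "210210000102021210021102210021" ∷
  "120210100002120211102020201112" ∷
  "120120200001120212120001120212" ∷
  "201121000200012121210002210121" ∷
  "102212000100012221012100021212" ∷
  "210210000102021210021102210021" ∷
  "121200001112021200012121210002" ∷
  "212100002221012100021212120001" ∷
  "210210010112021200021112201020" ∷
  "120210020122201010201122201010" ∷ []

-- A proper colouring with four colours in which each connector shows 0, 1, 2 in some order. The
-- fourth colour stays inside, so the rest of the graph can be coloured as if the edge of this pole
-- were missing from Petersen's graph.
four-table : String
four-table = "010012112202013120012201130022"
module Base where
  open FlowerStructure 2 hiding (L)
  open Pole (Flower.pole 3)

  colouring : ∀ k .{{_ : NonZero k}} → String → Line → Fin (suc (Data.Nat.pred k))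
  colouring (suc k) s l = nth zero (digits (suc k) s) (positionF 3 l)

  row : List String → ℕ → Line → Colour
  row table k = colouring 3 (nth "" table k)

  Broken : Line → (Line → Colour) → Set
  Broken l f = ((All.All (λ v → (∀ i → inc v i ≢ l) → Rainbow (f ∘ inc v)) vertices ×
                 Fits (values (λ r → f (inj₂ (start 3 r))))) ×
                 Fits (values (λ r → f (inj₂ (stop 3 r))))) ×
                 (∀ σ → (∀ i → pline σ i ≢ l) → Rainbow (f ∘ pline σ))

  broken? : ∀ l f → Dec (Broken l f)
  broken? l f = ((All.all? (λ v → (Fin.all? λ i → ¬? (inc v i ≟ᴸ l)) →-dec rainbow? (f ∘ inc v)) vertices ×-dec
                 fits? (values (λ r → f (inj₂ (start 3 r))))) ×-dec
                 fits? (values (λ r → f (inj₂ (stop 3 r))))) ×-dec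
                 (Fin.all? λ σ → (Fin.all? λ i → ¬? (pline σ i ≟ᴸ l)) →-dec rainbow? (f ∘ pline σ))

  broken-rows : All.All (λ l → Broken l (row broken-table (positionF 3 l))) lines
  broken-rows = toWitness {a? = All.all? (λ l → broken? l (row broken-table (positionF 3 l))) lines} _

  Through : Fin 2 → Fin 5 → (Line → Colour) → Set
  Through σ p f = ((All.All (λ v → Rainbow (f ∘ inc v)) vertices ×
                   Fits (values (λ r → f (inj₂ (start 3 r))))) ×
                   Fits (values (λ r → f (inj₂ (stop 3 r))))) ×
                   (∀ i → f (pline σ i) ≡ pattern₅ p i) × (∀ i → f (pline (other σ) i) ≡ zero)

  through-rows : ∀ σ p → Through σ p (row through-table (5 * Fin.toℕ σ + Fin.toℕ p))
  through-rows = toWitness {a? = Fin.all? λ σ → Fin.all? λ p → let f = row through-table (5 * Fin.toℕ σ + Fin.toℕ p) in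
    ((All.all? (λ v → rainbow? (f ∘ inc v)) vertices ×-dec
     fits? (values (λ r → f (inj₂ (start 3 r))))) ×-dec
     fits? (values (λ r → f (inj₂ (stop 3 r))))) ×-dec
    (Fin.all? λ i → f (pline σ i) Fin.≟ pattern₅ p i) ×-dec (Fin.all? λ i → f (pline (other σ) i) Fin.≟ zero)} _

  four : Line → Fin 4
  four = colouring 4 four-table

  four-rainbow : All.All (λ v → Rainbow (four ∘ inc v)) vertices
  four-rainbow = toWitness {a? = All.all? (λ v → rainbow? (four ∘ inc v)) vertices} _

  four-ports : Fin 2 → Fin 3 → Colour
  four-ports σ i = nth zero (digits 3 four-table) (positionF 3 (pline σ i))

  four-ports-≡ : ∀ σ i → four (pline σ i) ≡ Fin.inject₁ (four-ports σ i)
  four-ports-≡ = toWitness {a? = Fin.all? λ σ → Fin.all? λ i → four (pline σ i) Fin.≟ Fin.inject₁ (four-ports σ i)} _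

  four-ports-rainbow : ∀ σ → Rainbow (four-ports σ)
  four-ports-rainbow = toWitness {a? = Fin.all? λ σ → rainbow? (four-ports σ)} _

-- Flower poles of every odd length

module Pm (t : ℕ) = Pole (Flower.pole (3 + double t))

BrokenAt : ∀ t → CapLine ⊎ LL (3 + double t) → Set
BrokenAt t l = Σ (Colouring (2 + double t) (_≡ l)) λ C → ∀ σ → (∀ i → Pm.pline t σ i ≢ l) → Rainbow (Colouring.colour C ∘ Pm.pline t σ)

broken-base : ∀ l → BrokenAt 0 l
broken-base l = record
  { colour     = Base.row broken-table (positionF 3 l)
  ; rainbow    = λ v → All.lookup (proj₁ (proj₁ (proj₁ row))) (FlowerStructure.∈-vertices 2 v)
  ; fits-start = proj₂ (proj₁ (proj₁ row))
  ; fits-stop  = proj₂ (proj₁ row)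
  } , proj₂ row
  where
  row : Base.Broken l (Base.row broken-table (positionF 3 l))
  row = All.lookup Base.broken-rows (FlowerStructure.∈-lines 2 l)

broken-insert : ∀ t (d : Fin (4 + double t)) l → BrokenAt t l → (∀ r → inj₂ (cutline d r) ≢ l) →
  (∀ (C : Colouring (2 + double t) (_≡ l)) → Fits (values (λ r → Colouring.colour C (inj₂ (cutline d r))))) → BrokenAt (suc t) (shiftF d l)
broken-insert t d l (C , ports) cut fits = inserted (_≡ shiftF d l) (λ m → cong (shiftF d)) cut ,
    λ σ n → Rainbow-cong (λ i → sym (colour-pline σ i)) (ports σ (λ i e → n i (on-port σ i e)))
  where
  open Insertion d (_≡ l) C (fits C)
  on-port : ∀ σ i → Pm.pline t σ i ≡ l → Pm.pline (suc t) σ i ≡ shiftF d l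
  on-port σ i e = extend-Ex (_≡ shiftF d l) (λ m → cong (shiftF d)) cut (portline (σ , i)) e

broken-front : ∀ t l → BrokenAt t l → (∀ r → inj₂ (start (3 + double t) r) ≢ l) → BrokenAt (suc t) (shiftF zero l)
broken-front t l B cut = broken-insert t zero l B cut Colouring.fits-start

broken-back : ∀ t l → BrokenAt t l → (∀ r → inj₂ (cutline (fromℕ (3 + double t)) r) ≢ l) → BrokenAt (suc t) (shiftF (fromℕ (3 + double t)) l)
broken-back t l B cut = broken-insert t (fromℕ (3 + double t)) l B cut λ C →
  Fits-cong (λ r → cong (Colouring.colour C ∘ inj₂) (cutline-last (3 + double t) r)) (Colouring.fits-stop C)

-- Segments are inserted away from the broken line. Insertion in front moves a line by two `up` and
-- needs the entering rails intact, so the rails entering the third segment and all lines before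
-- them are obtained by insertion at the back.
broken-flower : ∀ t l → BrokenAt t l
broken-flower zero    l                              = broken-base l
broken-flower (suc t) (inj₁ c)                       = broken-front t (inj₁ c) (broken-flower t (inj₁ c)) (λ r ())
broken-flower (suc t) (inj₂ (railˡ r))               = broken-back t (inj₂ (railˡ r)) (broken-flower t (inj₂ (railˡ r))) (λ r ())
broken-flower (suc t) (inj₂ (spoke r))               = broken-back t (inj₂ (spoke r)) (broken-flower t (inj₂ (spoke r))) (λ r ())
broken-flower (suc t) (inj₂ (up (railˡ r)))          = broken-back t (inj₂ (up (railˡ r))) (broken-flower t (inj₂ (up (railˡ r)))) (λ r ())
broken-flower (suc t) (inj₂ (up (spoke r)))          = broken-back t (inj₂ (up (spoke r))) (broken-flower t (inj₂ (up (spoke r)))) (λ r ())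
broken-flower (suc t) (inj₂ (up (up (railˡ r))))     = broken-back t (inj₂ (up (up (railˡ r)))) (broken-flower t (inj₂ (up (up (railˡ r))))) (λ r ())
broken-flower (suc t) (inj₂ (up (up (spoke r))))     = broken-front t (inj₂ (spoke r)) (broken-flower t (inj₂ (spoke r))) (λ r ())
broken-flower (suc t) (inj₂ (up (up (up l))))        = broken-front t (inj₂ (up l)) (broken-flower t (inj₂ (up l))) (λ r ())

ThroughAt : ∀ t → Fin 2 → Fin 5 → Set
ThroughAt t σ p = Σ (Colouring (2 + double t) (λ _ → ⊥)) λ C →
  (∀ i → Colouring.colour C (Pm.pline t σ i) ≡ pattern₅ p i) × (∀ i → Colouring.colour C (Pm.pline t (other σ) i) ≡ zero)

through-flower : ∀ t σ p → ThroughAt t σ p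
through-flower zero σ p = record
  { colour     = Base.row through-table (5 * Fin.toℕ σ + Fin.toℕ p)
  ; rainbow    = λ v _ → All.lookup (proj₁ (proj₁ (proj₁ row))) (FlowerStructure.∈-vertices 2 v)
  ; fits-start = proj₂ (proj₁ (proj₁ row))
  ; fits-stop  = proj₂ (proj₁ row)
  } , proj₂ row
  where
  row : Base.Through σ p (Base.row through-table (5 * Fin.toℕ σ + Fin.toℕ p))
  row = Base.through-rows σ p
through-flower (suc t) σ p with through-flower t σ p
... | C , at-σ , at-other = inserted (λ _ → ⊥) (λ _ ()) (λ _ ()) ,
    (λ i → trans (colour-pline σ i) (at-σ i)) , (λ i → trans (colour-pline (other σ) i) (at-other i))
  where open Insertion zero (λ _ → ⊥) C (Colouring.fits-start C)

linked-flower : ∀ t → Linked (2 + double t)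
linked-flower zero    = linked-base
linked-flower (suc t) = linked-suc _ (linked-suc _ (linked-flower t))

-- Even lengths occur in passing: parity matters for the colourings, not for the cuts.
expanding-flower : ∀ t → Expanding (2 + double t)
expanding-flower zero          = expanding-base
expanding-flower (suc zero)    = expanding-base₅
expanding-flower (suc (suc t)) = expanding-suc _ (s≤s (s≤s (s≤s (s≤s z≤n)))) (expanding-suc _ (s≤s (s≤s (s≤s (s≤s z≤n)))) (expanding-flower (suc t)))

flower : ℕ → Pole
flower t = Flower.pole (3 + double t)

superedge-flower : ∀ t → IsSuperedge (flower t)
superedge-flower t = record
  { size         = 6 + (3 + double t) * 4
  ; index        = index
  ; _≟ᴸ_         = _≟ᴸ_
  ; no-loop      = no-loop
  ; no-parallel  = no-parallel
  ; port-inner   = port-inner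
  ; connected    = connected
  ; net-flow     = FlowerNet.net-flow t
  ; broken       = λ l → let C , ports = broken-flower t l in Colouring.colour C , Colouring.rainbow C , ports
  ; through      = λ σ p → let C , ports = through-flower t σ p in Colouring.colour C , (λ v → Colouring.rainbow C v (λ _ ())) , ports
  ; lines        = lines
  ; lines-unique = lines-unique
  ; vertices     = vertices
  ; ∈-vertices   = ∈-vertices
  ; linked       = linked-flower t
  ; expanding    = expanding-flower t
  }
  where open FlowerStructure (2 + double t)

-- Petersen's graph

module Petersen where

  -- The three edges at vertex w have codes number 3w, 3w + 1, 3w + 2 of edge-table;
  -- 2e + σ stands for end σ of the edge e, whose code 3w + k is in end-table.
  edge-table end-table : List ℕ
  edge-table = 0 ∷ 6 ∷ 10 ∷ 1 ∷ 2 ∷ 12 ∷ 3 ∷ 4 ∷ 14 ∷ 5 ∷ 8 ∷ 18 ∷ 7 ∷ 9 ∷ 24 ∷ 11 ∷ 16 ∷ 20 ∷ 13 ∷ 22 ∷ 26 ∷ 15 ∷ 17 ∷ 28 ∷ 19 ∷ 21 ∷ 23 ∷ 25 ∷ 27 ∷ 29 ∷ []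
  end-table  = 0 ∷ 3 ∷ 4 ∷ 6 ∷ 7 ∷ 9 ∷ 1 ∷ 12 ∷ 10 ∷ 13 ∷ 2 ∷ 15 ∷ 5 ∷ 18 ∷ 8 ∷ 21 ∷ 16 ∷ 22 ∷ 11 ∷ 24 ∷ 17 ∷ 25 ∷ 19 ∷ 26 ∷ 14 ∷ 27 ∷ 20 ∷ 28 ∷ 23 ∷ 29 ∷ []

  -- Row `e` is a colouring of Petersen's graph without `e`: proper at the eight vertices off `e`,
  -- and with equal colours on the two remaining edges at each end of `e`, as if these ends were
  -- suppressed.
  flow-table : List String
  flow-table =
    "001020021021120" ∷
    "000122001102012" ∷
    "010122210210012" ∷
    "010020221120210" ∷
    "010201220021201" ∷
    "010010220201201" ∷
    "001102020210201" ∷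
    "011102200210210" ∷
    "010122220120012" ∷
    "010102220011201" ∷
    "012102202101201" ∷
    "010122220110021" ∷
    "010112220210011" ∷
    "010122221102000" ∷
    "010211222201000" ∷ []

  opaque
    inc : Fin 10 → Fin 3 → Fin 15 × Fin 2
    inc w k = let c = nth 0 edge-table (3 * Fin.toℕ w + Fin.toℕ k) in (c / 2) mod 15 , c mod 2

    end : Fin 15 → Fin 2 → Fin 10 × Fin 3
    end e σ = let c = nth 0 end-table (2 * Fin.toℕ e + Fin.toℕ σ) in (c / 3) mod 10 , c mod 3

    flow : Fin 15 → Fin 15 → Colour
    flow e f = nth zero (digits 3 (nth "" flow-table (Fin.toℕ e))) (Fin.toℕ f)

  edge : Fin 10 → Fin 3 → Fin 15
  edge w k = proj₁ (inc w k)

  vertex : Fin 15 → Fin 2 → Fin 10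
  vertex e σ = proj₁ (end e σ)

  flow-end : Fin 15 → Fin 2 → Colour
  flow-end e σ = let w , k = end e σ in flow e (edge w (k ⊕ 1))

  incident : Fin 10 → Fin 15 → Bool
  incident w e = does (vertex e zero Fin.≟ w) ∨ does (vertex e (# 1) Fin.≟ w)

  module Colourings = ColourSearch {Fin 15} Fin._≟_ (map (λ w → edge (Fin.suc w)) (allFin 9))

  -- The lower bound from `linked` for the lines cut in a pole whose two triples of new vertices
  -- have `a` and `b` members on one side.
  load : ℕ → ℕ → ℕ
  load a b = (a + b) ⊓ (6 ∸ (a + b))

  open Exhaustion {Fin 10} {ℕ} Fin._≟_ (0 ∷ 1 ∷ 2 ∷ 3 ∷ []) load 0 using (Item; var; pay; compile; closed; search; search-sound; total)

  -- End 1 of an edge is its larger end, and the edges are numbered by increasing larger end. So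
  -- each edge is paid when its second end gets a value, and the payments come in the order of the
  -- sum in `concentrated`.
  arrivals : Fin 10 → List Item
  arrivals w = var w ∷ map (λ e → pay (vertex e zero) (vertex e (# 1))) (filter (λ e → vertex e (# 1) Fin.≟ w) (allFin 15))

  load-items : List Item
  load-items = Data.List.concatMap arrivals (allFin 10)

  light : List ℕ → ℕ → Bool
  light as _ = (sum as ≤ᵇ 1) ∨ (29 ≤ᵇ sum as)

  ∈-≤3 : ∀ {a} → a ≤ 3 → a ∈ 0 ∷ 1 ∷ 2 ∷ 3 ∷ []
  ∈-≤3 {0} _ = here refl
  ∈-≤3 {1} _ = there (here refl)
  ∈-≤3 {2} _ = there (there (here refl))
  ∈-≤3 {3} _ = there (there (there (here refl)))
  ∈-≤3 {suc (suc (suc (suc _)))} (s≤s (s≤s (s≤s ())))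

  opaque
    unfolding inc end flow

    end-inc : ∀ w k → end (proj₁ (inc w k)) (proj₂ (inc w k)) ≡ (w , k)
    end-inc = toWitness {a? = Fin.all? λ w → Fin.all? λ k → ×-≡-dec Fin._≟_ Fin._≟_ (end (proj₁ (inc w k)) (proj₂ (inc w k))) (w , k)} _

    inc-end : ∀ e σ → inc (proj₁ (end e σ)) (proj₂ (end e σ)) ≡ (e , σ)
    inc-end = toWitness {a? = Fin.all? λ e → Fin.all? λ σ → ×-≡-dec Fin._≟_ Fin._≟_ (inc (proj₁ (end e σ)) (proj₂ (end e σ))) (e , σ)} _

    vertex-injective : ∀ e σ τ → vertex e σ ≡ vertex e τ → σ ≡ τ
    vertex-injective = toWitness {a? = Fin.all? λ e → Fin.all? λ σ → Fin.all? λ τ → (vertex e σ Fin.≟ vertex e τ) →-dec (σ Fin.≟ τ)} _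

    edge-injective : ∀ w k m → edge w k ≡ edge w m → k ≡ m
    edge-injective = toWitness {a? = Fin.all? λ w → Fin.all? λ k → Fin.all? λ m → (edge w k Fin.≟ edge w m) →-dec (k Fin.≟ m)} _

    -- Needed because `through` gives a choice of pattern at one end only: an edge other than `e₀`
    -- shares at most one end with it, so a special pattern is requested there alone.
    no-triangle : ∀ e f → e ≢ f → ∀ σ τ → vertex e zero ≡ vertex f σ → vertex e (# 1) ≡ vertex f τ → ⊥
    no-triangle e f e≢f σ τ p q = toWitness {a? = Fin.all? λ e → Fin.all? λ f → Fin.all? λ σ → Fin.all? λ τ →
      ¬? (e Fin.≟ f) →-dec (vertex e zero Fin.≟ vertex f σ) →-dec ¬? (vertex e (# 1) Fin.≟ vertex f τ)} _ e f σ τ e≢f p q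

    descend : ∀ e → e ≡ zero ⊎ ∃ λ σ → ∃ λ k → edge (vertex e σ) k Fin.< e
    descend = toWitness {a? = Fin.all? λ e → (e Fin.≟ zero) ⊎-dec Fin.any? λ σ → Fin.any? λ k → edge (vertex e σ) k Fin.<? e} _

    flow-away : ∀ e w → (∀ k → edge w k ≢ e) → Rainbow (λ k → flow e (edge w k))
    flow-away = toWitness {a? = Fin.all? λ e → Fin.all? λ w → (Fin.all? λ k → ¬? (edge w k Fin.≟ e)) →-dec rainbow? (λ k → flow e (edge w k))} _

    flow-at : ∀ e σ k → k ≢ proj₂ (end e σ) → flow e (edge (vertex e σ) k) ≡ flow-end e σ
    flow-at = toWitness {a? = Fin.all? λ e → Fin.all? λ σ → Fin.all? λ k →
      ¬? (k Fin.≟ proj₂ (end e σ)) →-dec (flow e (edge (vertex e σ) k) Fin.≟ flow-end e σ)} _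

    three-edges : ∀ w → sum (map (λ e → bit (incident w e)) (allFin 15)) ≡ 3
    three-edges = toWitness {a? = Fin.all? λ w → sum (map (λ e → bit (incident w e)) (allFin 15)) ℕ.≟ 3} _

    incident-slot : ∀ w e → incident w e ≡ true → ∃ λ k → edge w k ≡ e
    incident-slot = toWitness {a? = Fin.all? λ w → Fin.all? λ e → (incident w e Data.Bool.≟ true) →-dec Fin.any? λ k → edge w k Fin.≟ e} _

    not-incident : ∀ w e → incident w e ≡ false → vertex e zero ≢ w × vertex e (# 1) ≢ w
    not-incident w e eq with vertex e zero Fin.≟ w | vertex e (# 1) Fin.≟ w
    ... | no p | no q = p , q

    next-edge : ∀ w k → edge w (k ⊕ 1) ≢ edge w k
    next-edge = toWitness {a? = Fin.all? λ w → Fin.all? λ k → ¬? (edge w (k ⊕ 1) Fin.≟ edge w k)} _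

    ends-cover : ∀ w k → vertex (edge w k) zero ≡ w ⊎ vertex (edge w k) (# 1) ≡ w
    ends-cover = toWitness {a? = Fin.all? λ w → Fin.all? λ k → (vertex (edge w k) zero Fin.≟ w) ⊎-dec (vertex (edge w k) (# 1) Fin.≟ w)} _

    -- By parity the condition at vertex 0 follows from the others, so it can be dropped.
    uncolourable : ∀ (f : Fin 15 → Colour) → ¬ (∀ w → Rainbow (λ k → f (edge (Fin.suc w) k)))
    uncolourable f proper = absurd (Colourings.colour-search f rainbow (λ _ _ → false) (allFin 15) refl refl)
      where
      absurd : false ≡ true → ⊥
      absurd ()
      rainbow : ∀ t → t ∈ map (λ w → edge (Fin.suc w)) (allFin 9) → Rainbow (f ∘ t)
      rainbow t t∈ = let w , _ , t≡ = ∈-map⁻ (λ w → edge (Fin.suc w)) {xs = allFin 9} t∈ in subst (λ t → Rainbow (f ∘ t)) (sym t≡) (proper w)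

    -- An edge is free only if its ends have sizes 0 and 0 or 3 and 3, and Petersen's graph expands
    -- too well for an intermediate distribution to cost at most 5. The number 29 is one less than
    -- that of all new vertices.
    concentrated : ∀ (a : Fin 10 → ℕ) → (∀ w → a w ≤ 3) →
      sum (map (λ e → load (a (vertex e zero)) (a (vertex e (# 1)))) (allFin 15)) ≤ 5 →
      sum (map a (reverse (allFin 10))) ≤ 1 ⊎ 29 ≤ sum (map a (reverse (allFin 10)))
    concentrated a a≤3 le = Data.Sum.map (ℕ.≤ᵇ⇒≤ _ 1 ∘ Equivalence.from T-≡) (ℕ.≤ᵇ⇒≤ 29 _ ∘ Equivalence.from T-≡)
      (∨-true (sum (map a (reverse (allFin 10))) ≤ᵇ 1) (search-sound light a (λ w → ∈-≤3 (a≤3 w)) load-items [] 5 refl refl le))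

-- Position on the k-th connector of the semiedge joined to the i-th of the three
-- vertices, and its inverse: the connector positions that pattern₅ never singles
-- out (position 2) go to distinct vertices.
place unplace : Fin 3 → Fin 3 → Fin 3
place i k   = i ⊕ Fin.toℕ k
unplace p k = p ⊕ (3 ∸ Fin.toℕ k)

unplace-place : ∀ i k → unplace (place i k) k ≡ i
unplace-place = toWitness {a? = Fin.all? λ i → Fin.all? λ k → unplace (place i k) k Fin.≟ i} _

place-unplace : ∀ p k → place (unplace p k) k ≡ p
place-unplace = toWitness {a? = Fin.all? λ p → Fin.all? λ k → place (unplace p k) k Fin.≟ p} _

-- A cyclic permutation of the colours that takes 0 to `s`; it keeps colourings proper and turns
-- patterns of net colour 0 into patterns of net colour `s`.
rotate : Colour → Colour → Colour
rotate s c = c ⊕ Fin.toℕ s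

rotate-injective : ∀ s c d → rotate s c ≡ rotate s d → c ≡ d
rotate-injective = toWitness {a? = Fin.all? λ s → Fin.all? λ c → Fin.all? λ d → (rotate s c Fin.≟ rotate s d) →-dec (c Fin.≟ d)} _

rotate-zero : ∀ s → rotate s zero ≡ s
rotate-zero = toWitness {a? = Fin.all? λ s → rotate s zero Fin.≟ s} _

rotate-onto : ∀ s t → rotate (s ⊕ (3 ∸ Fin.toℕ t)) t ≡ s
rotate-onto = toWitness {a? = Fin.all? λ s → Fin.all? λ t → rotate (s ⊕ (3 ∸ Fin.toℕ t)) t Fin.≟ s} _

-- The colours at vertex i of a cluster: on connector k₀ they are given by c, on the
-- next two connectors by the patterns p and q with net colour s.
cluster : Fin 3 → (Fin 3 → Colour) → Colour → Fin 5 → Fin 5 → Fin 3 → Fin 3 → Colour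
cluster k₀ c s p q i k =
  if does (k Fin.≟ k₀) then c (place i k) else
  if does (k Fin.≟ k₀ ⊕ 1) then rotate s (pattern₅ p (place i k)) else rotate s (pattern₅ q (place i k))

-- Total zero on connector `k₀` forces equal totals on the other two, namely the colour shared by
-- the two edges at an end of the missing edge. That every `s` can be realised is a finite check.
complete : ∀ k₀ a b c s → Rainbow (triple a b c) → ∃ λ p → ∃ λ q → ∀ i → Rainbow (cluster k₀ (triple a b c) s p q i)
complete = toWitness {a? = Fin.all? λ k₀ → Fin.all? λ a → Fin.all? λ b → Fin.all? λ c → Fin.all? λ s →
  rainbow? (triple a b c) →-dec Fin.any? λ p → Fin.any? λ q → Fin.all? λ i → rainbow? (cluster k₀ (triple a b c) s p q i)} _

-- Here the vertex at position `h` of the connector is deleted and the colours on the connector are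
-- arbitrary. In exchange `s` cannot be prescribed, and the colouring of Petersen's graph must be
-- rotated to match it.
complete-except : ∀ k₀ h a b c → ∃ λ s → ∃ λ p → ∃ λ q → ∀ i → place i k₀ ≢ h → Rainbow (cluster k₀ (triple a b c) s p q i)
complete-except = toWitness {a? = Fin.all? λ k₀ → Fin.all? λ h → Fin.all? λ a → Fin.all? λ b → Fin.all? λ c →
  Fin.any? λ s → Fin.any? λ p → Fin.any? λ q → Fin.all? λ i → ¬? (place i k₀ Fin.≟ h) →-dec rainbow? (cluster k₀ (triple a b c) s p q i)} _

module ClusterNet where

  X : Set
  X = Fin 3 × Fin 3

  -- (i , k) is the line from vertex i to connector k.
  open ColourSearch {X} (×-≡-dec Fin._≟_ Fin._≟_) (map (λ i k → i , k) (allFin 3))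

  distinct : Maybe Colour → Maybe Colour → Maybe Colour → Bool
  distinct (just a) (just b) (just c) = does (rainbow? (triple a b c))
  -- A connector of total zero passes the test; the hypothesis of `net-cluster` excludes it.
  distinct _        _        _        = true

  distinct-sound : ∀ a b c → distinct (just a) (just b) (just c) ≡ true → Rainbow (triple a b c)
  distinct-sound a b c = holds (rainbow? (triple a b c))
    where
    holds : {P : Set} (p? : Dec P) → does p? ≡ true → P
    holds (yes p) _ = p

  order : List X
  order = cartesianProduct (allFin 3) (allFin 3)

  test : List Colour → ℕ → Bool
  test (c₂₂ ∷ c₂₁ ∷ c₂₀ ∷ c₁₂ ∷ c₁₁ ∷ c₁₀ ∷ c₀₂ ∷ c₀₁ ∷ c₀₀ ∷ []) _ =
    -- Within connector k the entries follow its positions: position p belongs to vertex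
    -- `unplace p k`.
    distinct (net (triple c₀₀ c₁₀ c₂₀)) (net (triple c₂₁ c₀₁ c₁₁)) (net (triple c₁₂ c₂₂ c₀₂))
  test _ _ = true

  searched : ∀ g → (∀ i → Rainbow (λ k → g (i , k))) →
    distinct (net (values (λ p → g (unplace p zero , zero)))) (net (values (λ p → g (unplace p (# 1) , # 1)))) (net (values (λ p → g (unplace p (# 2) , # 2)))) ≡ true
  searched g rainbow = subst (λ ys → test ys 0 ≡ true) stack (colour-search g rainbow′ test order refl refl)
    where
    stack : map g (reversed order []) ≡ g (# 2 , # 2) ∷ g (# 2 , # 1) ∷ g (# 2 , # 0) ∷ g (# 1 , # 2) ∷ g (# 1 , # 1) ∷ g (# 1 , # 0) ∷ g (# 0 , # 2) ∷ g (# 0 , # 1) ∷ g (# 0 , # 0) ∷ []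
    stack = refl
    rainbow′ : ∀ t → t ∈ map (λ i k → i , k) (allFin 3) → Rainbow (g ∘ t)
    rainbow′ t t∈ = let i , _ , t≡ = ∈-map⁻ (λ i k → i , k) {xs = allFin 3} t∈ in subst (λ t → Rainbow (g ∘ t)) (sym t≡) (rainbow i)

  -- Summed over the three vertices the colours vanish, so the three totals add up to zero; nonzero
  -- elements of Z₂² with this property are distinct.
  net-cluster : ∀ (g : X → Colour) → (∀ i → Rainbow (λ k → g (i , k))) → ∀ (s : Fin 3 → Colour) →
    (∀ k → net (λ p → g (unplace p k , k)) ≡ just (s k)) → Rainbow s
  net-cluster g rainbow s nets = Rainbow-cong (λ k → sym (values-≗ s k)) (distinct-sound (s zero) (s (# 1)) (s (# 2))
    (subst₂ (λ a b → distinct a b (just (s (# 2))) ≡ true) (nets zero) (nets (# 1))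
      (subst (λ c → distinct (net (values (λ p → g (unplace p zero , zero)))) (net (values (λ p → g (unplace p (# 1) , # 1)))) c ≡ true) (nets (# 2)) (searched g rainbow))))

-- Superposition

record Cubic : Set₁ where
  field
    V Line    : Set
    dart      : Line × Bool → V × Fin 3
    line      : V × Fin 3 → Line × Bool
    dart-line : ∀ x → dart (line x) ≡ x
    line-dart : ∀ l → line (dart l) ≡ l

  inc : V → Fin 3 → Line
  inc v i = proj₁ (line (v , i))

  far : V × Fin 3 → V × Fin 3
  far x = let l , b = line x in dart (l , not b)

  nb : V → Fin 3 → V
  nb v i = proj₁ (far (v , i))

  far-far : ∀ x → far (far x) ≡ x
  far-far x = trans (cong (λ (l , b) → dart (l , not b)) (line-dart (proj₁ (line x) , not (proj₂ (line x)))))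
    (trans (cong (λ b → dart (proj₁ (line x) , b)) (not-involutive (proj₂ (line x)))) (dart-line x))

  far-line : ∀ x → proj₁ (line (far x)) ≡ proj₁ (line x)
  far-line x = cong proj₁ (line-dart (proj₁ (line x) , not (proj₂ (line x))))

  Cross : (V → Bool) → List Line → Set
  Cross A F = ∀ v i → A v ≢ A (nb v i) → inc v i ∈ F

  -- For nonempty `A` this says |A| + 2 ≤ |F|, expressed by duplicate-free lists so that `A` itself
  -- need not be counted.
  Sparse : (V → Bool) → List Line → Set
  Sparse A F = ∀ xs → 1 ≤ length xs → Unique xs → (∀ {x} → x ∈ xs → A x ≡ true) → 2 + length xs ≤ length F

module Assembly (S : Fin 15 → Pole) (superedge : ∀ e → IsSuperedge (S e)) where
  open Petersen using (edge; vertex)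
  module S (e : Fin 15) = Pole (S e)
  module I (e : Fin 15) = IsSuperedge (superedge e)

  V Line : Set
  V    = (Fin 10 × Fin 3) ⊎ Σ (Fin 15) S.V
  Line = Σ (Fin 15) S.Line

  global : ∀ e → (S.V e × Fin 3) ⊎ Port → V × Fin 3
  global e (inj₁ (v , i)) = inj₂ (e , v) , i
  global e (inj₂ (σ , p)) = let w , k = Petersen.end e σ in inj₁ (w , unplace p k) , k

  at : ∀ e → S.Line e × Bool → Line × Bool
  at e (l , b) = (e , l) , b

  dart : Line × Bool → V × Fin 3
  dart ((e , l) , b) = global e (S.dart e (l , b))

  line : V × Fin 3 → Line × Bool
  line (inj₂ (e , v) , i) = at e (S.line e (inj₁ (v , i)))
  line (inj₁ (w , i) , k) = let e , σ = Petersen.inc w k in at e (S.line e (inj₂ (σ , place i k)))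

  dart-line : ∀ x → dart (line x) ≡ x
  dart-line (inj₂ (e , v) , i) = cong (global e) (S.dart-line e (inj₁ (v , i)))
  dart-line (inj₁ (w , i) , k) = let e , σ = Petersen.inc w k in
    trans (cong (global e) (S.dart-line e (inj₂ (σ , place i k)))) (back (Petersen.end-inc w k))
    where
    back : ∀ {x} → x ≡ (w , k) → (inj₁ (proj₁ x , unplace (place i k) (proj₂ x)) , proj₂ x) ≡ (inj₁ (w , i) , k)
    back refl = cong (λ j → inj₁ (w , j) , k) (unplace-place i k)

  line-global : ∀ e x → line (global e x) ≡ at e (S.line e x)
  line-global e (inj₁ x)       = refl
  line-global e (inj₂ (σ , p)) = back (Petersen.inc-end e σ)
    where
    k : Fin 3
    k = proj₂ (Petersen.end e σ)
    back : ∀ {x} → x ≡ (e , σ) → at (proj₁ x) (S.line (proj₁ x) (inj₂ (proj₂ x , place (unplace p k) k))) ≡ at e (S.line e (inj₂ (σ , p)))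
    back refl = cong (λ q → at e (S.line e (inj₂ (σ , q)))) (place-unplace p k)

  line-dart : ∀ l → line (dart l) ≡ l
  line-dart ((e , l) , b) = trans (line-global e (S.dart e (l , b))) (cong (at e) (S.line-dart e (l , b)))

  cubic : Cubic
  cubic = record { V = V ; Line = Line ; dart = dart ; line = line ; dart-line = dart-line ; line-dart = line-dart }

  open Cubic cubic using (inc; far; nb; far-far)

  inner : ∀ e → S.Owner e → V
  inner e (inj₁ v)       = inj₂ (e , v)
  inner e (inj₂ (σ , p)) = let w , k = Petersen.end e σ in inj₁ (w , unplace p k)

  global-owner : ∀ e x → proj₁ (global e x) ≡ inner e (S.owner e x)
  global-owner e (inj₁ x)       = refl
  global-owner e (inj₂ (σ , p)) = refl

  nb-inner : ∀ e v i → nb (inj₂ (e , v)) i ≡ inner e (S.owner e (S.far e (inj₁ (v , i))))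
  nb-inner e v i = global-owner e (S.far e (inj₁ (v , i)))

  unplace-injective : ∀ p q k → unplace p k ≡ unplace q k → p ≡ q
  unplace-injective p q k eq = trans (sym (place-unplace p k)) (trans (cong (λ i → place i k) eq) (place-unplace q k))

  inner-injective : ∀ e o o′ → inner e o ≡ inner e o′ → o ≡ o′
  inner-injective e (inj₁ v)       (inj₁ .v)        refl = refl
  inner-injective e (inj₂ (σ , p)) (inj₂ (τ , q)) eq with Petersen.vertex-injective e σ τ (cong proj₁ (inj₁-injective eq))
  ... | refl = cong (λ p → inj₂ (σ , p)) (unplace-injective p q (proj₂ (Petersen.end e σ)) (cong proj₂ (inj₁-injective eq)))

  portV : ∀ e → Port → S.V e
  portV e p = proj₁ (proj₁ (I.port-inner e p))

  nb-cluster : ∀ w i k → let e , σ = Petersen.inc w k in nb (inj₁ (w , i)) k ≡ inj₂ (e , portV e (σ , place i k))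
  nb-cluster w i k = let e , σ = Petersen.inc w k in cong (proj₁ ∘ global e) (proj₂ (I.port-inner e (σ , place i k)))

  no-loop : ∀ v i → nb v i ≢ v
  no-loop (inj₂ (e , v)) i eq = I.no-loop e v i (inner-injective e _ (inj₁ v) (trans (sym (nb-inner e v i)) eq))
  no-loop (inj₁ (w , i)) k eq = contra (trans (sym (nb-cluster w i k)) eq)
    where
    contra : ∀ {x : Σ (Fin 15) S.V} {y : Fin 10 × Fin 3} → inj₂ x ≢ inj₁ y
    contra ()

  no-parallel : ∀ v → Rainbow (nb v)
  no-parallel (inj₂ (e , v)) i j eq = I.no-parallel e v i j
    (inner-injective e _ _ (trans (sym (nb-inner e v i)) (trans eq (nb-inner e v j))))
  no-parallel (inj₁ (w , i)) k m eq = Petersen.edge-injective w k m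
    (cong proj₁ (inj₂-injective (trans (sym (nb-cluster w i k)) (trans eq (nb-cluster w i m)))))

  Adj : V → V → Set
  Adj v w = ∃ λ i → nb v i ≡ w

  adj-sym : ∀ {v w} → Adj v w → Adj w v
  adj-sym {v} (i , refl) = proj₂ (far (v , i)) , cong proj₁ (far-far (v , i))

  star-sym : ∀ {v w} → Star Adj v w → Star Adj w v
  star-sym ε       = ε
  star-sym (a ◅ s) = star-sym s ◅◅ (adj-sym a ◅ ε)

  inside : ∀ e {v w} → Star (S.Adj e) v w → Star Adj (inj₂ (e , v)) (inj₂ (e , w))
  inside e = gmap (λ v → inj₂ (e , v)) (λ { {v} (i , eq) → i , trans (nb-inner e v i) (cong (inner e) eq) })

  hubV : Fin 15 → V
  hubV e = inj₂ (e , portV e (zero , zero))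

  to-cluster : ∀ w i k → Star Adj (hubV (edge w k)) (inj₁ (w , i))
  to-cluster w i k = inside e (I.connected e _ _) ◅◅ star-sym ((k , nb-cluster w i k) ◅ ε)
    where
    e = edge w k

  to-root : ∀ n e → Fin.toℕ e < n → Star Adj (hubV e) (hubV zero)
  to-root (suc n) e (s≤s e≤n) with Petersen.descend e
  ... | inj₁ refl = ε
  ... | inj₂ (σ , k , lt) = subst (λ f → Star Adj (hubV f) (inj₁ (vertex e σ , zero))) (cong proj₁ (Petersen.inc-end e σ)) (to-cluster (vertex e σ) zero (proj₂ (Petersen.end e σ)))
      ◅◅ star-sym (to-cluster (vertex e σ) zero k) ◅◅ to-root n (edge (vertex e σ) k) (ℕ.<-≤-trans lt e≤n)

  rooted : ∀ v → Star Adj v (hubV zero)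
  rooted (inj₂ (e , v)) = inside e (I.connected e v _) ◅◅ to-root 15 e (Fin.toℕ<n e)
  rooted (inj₁ (w , i)) = star-sym (to-cluster w i zero) ◅◅ to-root 15 (edge w zero) (Fin.toℕ<n _)

  connected : ∀ v w → Star Adj v w
  connected v w = rooted v ◅◅ star-sym (rooted w)

  apart : V
  apart = inj₁ (zero , zero)

  apart′ : V
  apart′ = inj₁ (zero , # 1)

  uncolourable : ∀ (f : Line → Colour) → ¬ (∀ v → v ≢ apart → v ≢ apart′ → Rainbow (f ∘ inc v))
  uncolourable f proper = Petersen.uncolourable s λ w → ClusterNet.net-cluster (λ (i , k) → f (inc (inj₁ (Fin.suc w , i)) k))
      (λ i → proper (inj₁ (Fin.suc w , i)) (λ ()) (λ ())) (λ k → s (edge (Fin.suc w) k)) (nets (Fin.suc w))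
    where
    carried : ∀ e → ∃ λ s → ∀ σ → net (λ i → f (e , S.pline e σ i)) ≡ just s
    carried e = I.net-flow e (λ l → f (e , l)) (λ v → proper (inj₂ (e , v)) (λ ()) (λ ()))
    s : Fin 15 → Colour
    s e = proj₁ (carried e)
    net-cong : ∀ {g h : Fin 3 → Colour} → (∀ i → g i ≡ h i) → net (values g) ≡ net (values h)
    net-cong eq = cong net (cong₃ (eq zero) (eq (# 1)) (eq (# 2)))
      where
      cong₃ : ∀ {a b c a′ b′ c′ : Colour} → a ≡ a′ → b ≡ b′ → c ≡ c′ → triple a b c ≡ triple a′ b′ c′
      cong₃ refl refl refl = refl
    nets : ∀ w k → net (λ p → f (inc (inj₁ (w , unplace p k)) k)) ≡ just (s (edge w k))
    nets w k = trans (net-cong (λ p → cong (λ q → f (edge w k , S.pline (edge w k) (proj₂ (Petersen.inc w k)) q)) (place-unplace p k)))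
                     (proj₂ (carried (edge w k)) (proj₂ (Petersen.inc w k)))

  -- A colouring with values in K that is ι ∘ flow e₀ in total on every connector,
  -- except for the pole of e₀, which is coloured by f₀.
  module Paint (e₀ : Fin 15) {K : Set} (ι : Colour → K) (ι-injective : ∀ {a b} → ι a ≡ ι b → a ≡ b)
               (f₀ : S.Line e₀ → K) (c : Fin 2 → Fin 3 → Colour) (f₀-ports : ∀ σ i → f₀ (S.pline e₀ σ i) ≡ ι (c σ i))
               (turn : Colour) (P : Fin 2 → Fin 3 → Fin 5) where

    root : Fin 2 → Fin 10
    root = vertex e₀

    total : Fin 15 → Colour
    total e = rotate turn (Petersen.flow e₀ e)

    choice : ∀ {A B : Set} → Dec A → Dec B → Fin 3 → Fin 5
    choice (yes _) _       k = P zero k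
    choice (no _)  (yes _) k = P (# 1) k
    choice (no _)  (no _)  k = zero

    pattern-at : Fin 10 → Fin 3 → Fin 5
    pattern-at w k = choice (w Fin.≟ root zero) (w Fin.≟ root (# 1)) k

    pattern-of : Fin 15 → Fin 2 → Fin 5
    pattern-of e σ = pattern-at (proj₁ (Petersen.end e σ)) (proj₂ (Petersen.end e σ))

    -- The connector that gets the freely chosen pattern: the one at the end shared with `e₀`, if
    -- there is such an end. The other connector is constant.
    main : Fin 15 → Fin 2
    main e = if does (vertex e zero Fin.≟ root zero) ∨ does (vertex e zero Fin.≟ root (# 1)) then zero else # 1

    routed : ∀ e → S.Line e → Colour
    routed e l = rotate (total e) (proj₁ (I.through e (main e) (pattern-of e (main e))) l)

    outside : ∀ w k → w ≢ root zero → w ≢ root (# 1) → pattern-at w k ≡ zero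
    outside w k w≢₀ w≢₁ with w Fin.≟ root zero | w Fin.≟ root (# 1)
    ... | yes w≡₀ | _       = ⊥-elim (w≢₀ w≡₀)
    ... | no _    | yes w≡₁ = ⊥-elim (w≢₁ w≡₁)
    ... | no _    | no _    = refl

    main-or-zero : ∀ e → e ≢ e₀ → ∀ σ → σ ≡ main e ⊎ σ ≡ other (main e) × pattern-of e σ ≡ zero
    main-or-zero e e≢e₀ σ with vertex e zero Fin.≟ root zero | vertex e zero Fin.≟ root (# 1)
    main-or-zero e e≢e₀ zero       | yes _ | _     = inj₁ refl
    main-or-zero e e≢e₀ (suc zero) | yes p | _     = inj₂ (refl , outside _ _ (Petersen.no-triangle e e₀ e≢e₀ zero zero p) (Petersen.no-triangle e e₀ e≢e₀ zero (# 1) p))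
    main-or-zero e e≢e₀ zero       | no _  | yes _ = inj₁ refl
    main-or-zero e e≢e₀ (suc zero) | no _  | yes p = inj₂ (refl , outside _ _ (Petersen.no-triangle e e₀ e≢e₀ (# 1) zero p) (Petersen.no-triangle e e₀ e≢e₀ (# 1) (# 1) p))
    main-or-zero e e≢e₀ zero       | no p  | no q  = inj₂ (refl , outside _ _ p q)
    main-or-zero e e≢e₀ (suc zero) | no _  | no _  = inj₁ refl

    routed-port : ∀ e → e ≢ e₀ → ∀ σ i → routed e (S.pline e σ i) ≡ rotate (total e) (pattern₅ (pattern-of e σ) i)
    routed-port e e≢e₀ σ i with main-or-zero e e≢e₀ σ
    ... | inj₁ refl         = cong (rotate (total e)) (proj₁ (proj₂ (proj₂ (I.through e (main e) (pattern-of e (main e))))) i)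
    ... | inj₂ (refl , p≡0) = cong (rotate (total e)) (trans (proj₂ (proj₂ (proj₂ (I.through e (main e) (pattern-of e (main e))))) i)
                                                            (sym (cong (λ p → pattern₅ p i) p≡0)))

    routed-rainbow : ∀ e v → Rainbow (routed e ∘ S.inc e v)
    routed-rainbow e v i j eq = proj₁ (proj₂ (I.through e (main e) (pattern-of e (main e)))) v i j (rotate-injective (total e) _ _ eq)

    fill : ∀ e → Dec (e ≡ e₀) → S.Line e → K
    fill e (yes refl) l = f₀ l
    fill e (no _)     l = ι (routed e l)

    painted : Line → K
    painted (e , l) = fill e (e Fin.≟ e₀) l

    painted-inner : ∀ e v → (∀ (eq : e ≡ e₀) → Rainbow (f₀ ∘ S.inc e₀ (subst S.V eq v))) → Rainbow (painted ∘ inc (inj₂ (e , v)))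
    painted-inner e v ok = at-dec (e Fin.≟ e₀)
      where
      at-dec : ∀ d → Rainbow (fill e d ∘ S.inc e v)
      at-dec (yes refl) = ok refl
      at-dec (no _)     = λ i j eq → routed-rainbow e v i j (ι-injective eq)

    fill-away : ∀ e → e ≢ e₀ → ∀ d σ p → fill e d (S.pline e σ p) ≡ ι (rotate (total e) (pattern₅ (pattern-of e σ) p))
    fill-away e e≢e₀ (yes e≡e₀) σ p = ⊥-elim (e≢e₀ e≡e₀)
    fill-away e e≢e₀ (no _)     σ p = cong ι (routed-port e e≢e₀ σ p)

    fill-here : ∀ d σ p → fill e₀ d (S.pline e₀ σ p) ≡ ι (c σ p)
    fill-here (yes refl) σ p = f₀-ports σ p
    fill-here (no ne)    σ p = ⊥-elim (ne refl)

    pattern-inc : ∀ w k → pattern-of (edge w k) (proj₂ (Petersen.inc w k)) ≡ pattern-at w k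
    pattern-inc w k = cong (λ x → pattern-at (proj₁ x) (proj₂ x)) (Petersen.end-inc w k)

    away : ∀ w → w ≢ root zero → w ≢ root (# 1) → ∀ k → edge w k ≢ e₀
    away w w≢₀ w≢₁ k eq = which (proj₂ (Petersen.inc w k)) refl
      where
      w≡ : ∀ {e σ} → edge w k ≡ e → proj₂ (Petersen.inc w k) ≡ σ → w ≡ vertex e σ
      w≡ refl refl = sym (cong proj₁ (Petersen.end-inc w k))
      which : ∀ σ → proj₂ (Petersen.inc w k) ≡ σ → ⊥
      which zero       eq′ = w≢₀ (w≡ eq eq′)
      which (suc zero) eq′ = w≢₁ (w≡ eq eq′)

    cluster-away : ∀ w i → w ≢ root zero → w ≢ root (# 1) → Rainbow (painted ∘ inc (inj₁ (w , i)))
    cluster-away w i w≢₀ w≢₁ = Rainbow-cong (λ k → sym (colours k)) λ k m eq →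
        Petersen.flow-away e₀ w (away w w≢₀ w≢₁) k m (rotate-injective turn _ _ (ι-injective eq))
      where
      colours : ∀ k → painted (inc (inj₁ (w , i)) k) ≡ ι (total (edge w k))
      colours k = trans (fill-away (edge w k) (away w w≢₀ w≢₁ k) (edge w k Fin.≟ e₀) (proj₂ (Petersen.inc w k)) (place i k))
        (cong ι (trans (cong (λ p → rotate (total (edge w k)) (pattern₅ p (place i k))) (trans (pattern-inc w k) (outside w k w≢₀ w≢₁)))
                       (rotate-zero (total (edge w k)))))

    slot : Fin 2 → Fin 3
    slot τ = proj₂ (Petersen.end e₀ τ)

    root-pattern : ∀ τ k → pattern-at (root τ) k ≡ P τ k
    root-pattern zero k with root zero Fin.≟ root zero
    ... | yes _ = refl
    ... | no ne = ⊥-elim (ne refl)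
    root-pattern (suc zero) k with root (# 1) Fin.≟ root zero | root (# 1) Fin.≟ root (# 1)
    ... | yes eq | _ = ⊥-elim (Fin.0≢1+n (sym (Petersen.vertex-injective e₀ (# 1) zero eq)))
    ... | no _ | yes _ = refl
    ... | no _ | no ne = ⊥-elim (ne refl)

    here-or-away : ∀ τ k → k ≡ slot τ ⊎ k ≢ slot τ × edge (root τ) k ≢ e₀
    here-or-away τ k with k Fin.≟ slot τ
    ... | yes eq = inj₁ eq
    ... | no ne  = inj₂ (ne , λ eq → ne (Petersen.edge-injective (root τ) k (slot τ) (trans eq (sym (cong proj₁ (Petersen.inc-end e₀ τ))))))

    local : Fin 2 → Fin 3 → Fin 3 → Colour
    local τ i k = if does (k Fin.≟ slot τ) then c τ (place i k) else rotate (rotate turn (Petersen.flow-end e₀ τ)) (pattern₅ (P τ k) (place i k))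

    cluster-root : ∀ τ i → Rainbow (local τ i) → Rainbow (painted ∘ inc (inj₁ (root τ , i)))
    cluster-root τ i ok = Rainbow-cong (λ k → sym (colours k)) λ k m eq → ok k m (ι-injective eq)
      where
      fill-cong : ∀ {x y : Fin 15 × Fin 2} (p : Fin 3) → x ≡ y →
        fill (proj₁ x) (proj₁ x Fin.≟ e₀) (S.pline (proj₁ x) (proj₂ x) p) ≡ fill (proj₁ y) (proj₁ y Fin.≟ e₀) (S.pline (proj₁ y) (proj₂ y) p)
      fill-cong p refl = refl
      colours : ∀ k → painted (inc (inj₁ (root τ , i)) k) ≡ ι (local τ i k)
      colours k with here-or-away τ k | k Fin.≟ slot τ
      ... | inj₁ refl | yes _ = trans (fill-cong (place i k) (Petersen.inc-end e₀ τ)) (fill-here (e₀ Fin.≟ e₀) τ (place i k))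
      ... | inj₁ eq | no ne = ⊥-elim (ne eq)
      ... | inj₂ (ne , _) | yes eq = ⊥-elim (ne eq)
      ... | inj₂ (ne , e≢e₀) | no _ =
        trans (fill-away (edge (root τ) k) e≢e₀ (edge (root τ) k Fin.≟ e₀) (proj₂ (Petersen.inc (root τ) k)) (place i k))
          (cong ι (cong₂ (λ s p → rotate s (pattern₅ p (place i k))) (cong (rotate turn) (Petersen.flow-at e₀ τ k ne))
                         (trans (pattern-inc (root τ) k) (root-pattern τ k))))

    painted-rainbow : (Ok : V → Set) → (∀ τ i → Ok (inj₁ (root τ , i)) → Rainbow (local τ i)) →
      (∀ v → Ok (inj₂ (e₀ , v)) → Rainbow (f₀ ∘ S.inc e₀ v)) → ∀ v → Ok v → Rainbow (painted ∘ inc v)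
    painted-rainbow Ok clusters ok (inj₂ (e , v)) okv = painted-inner e v (λ { refl → ok v okv })
    painted-rainbow Ok clusters ok (inj₁ (w , i)) okv with w Fin.≟ root zero | w Fin.≟ root (# 1)
    ... | yes refl | _        = cluster-root zero i (clusters zero i okv)
    ... | no _     | yes refl = cluster-root (# 1) i (clusters (# 1) i okv)
    ... | no w≢₀   | no w≢₁   = cluster-away w i w≢₀ w≢₁

  -- Patterns at end τ of e₀ that fit the colours c of its connector there when the
  -- net colour of the other two connectors is s; skip marks vertices left free.
  Fit : Fin 15 → Fin 2 → (Fin 3 → Colour) → Colour → (Fin 3 → Set) → Set
  Fit e₀ τ c s Skip = let k₀ = proj₂ (Petersen.end e₀ τ) in
    ∃ λ p → ∃ λ q → ∀ i → ¬ Skip (place i k₀) → Rainbow (cluster k₀ c s p q i)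

  cluster-cong : ∀ k₀ {c d} s p q i → (∀ j → c j ≡ d j) → Rainbow (cluster k₀ c s p q i) → Rainbow (cluster k₀ d s p q i)
  cluster-cong k₀ {c} {d} s p q i eq = Rainbow-cong same
    where
    same : ∀ k → cluster k₀ c s p q i k ≡ cluster k₀ d s p q i k
    same k with does (k Fin.≟ k₀)
    ... | true  = eq (place i k)
    ... | false = refl

  fit : ∀ e₀ τ c s Skip → Rainbow c → Fit e₀ τ c s Skip
  fit e₀ τ c s Skip ok = let k₀ = proj₂ (Petersen.end e₀ τ)
                             p , q , fits = complete k₀ (c zero) (c (# 1)) (c (# 2)) s (Rainbow-cong (values-≗ c) ok) in
    p , q , λ i _ → cluster-cong k₀ s p q i (λ j → sym (values-≗ c j)) (fits i)

  fit-except : ∀ e₀ τ c h → ∃ λ s → Fit e₀ τ c s (_≡ h)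
  fit-except e₀ τ c h = let k₀ = proj₂ (Petersen.end e₀ τ)
                            s , p , q , fits = complete-except k₀ h (c zero) (c (# 1)) (c (# 2)) in
    s , p , q , λ i n → cluster-cong k₀ s p q i (λ j → sym (values-≗ c j)) (fits i n)

  arrange : (Fin 2 → Fin 3) → (Fin 2 → Fin 5) → (Fin 2 → Fin 5) → Fin 2 → Fin 3 → Fin 5
  arrange k₀ p q τ k = if does (k Fin.≟ k₀ τ ⊕ 1) then p τ else q τ

  module _ (e₀ : Fin 15) {K : Set} (ι : Colour → K) (ι-injective : ∀ {a b} → ι a ≡ ι b → a ≡ b)
           (f₀ : S.Line e₀ → K) (c : Fin 2 → Fin 3 → Colour) (f₀-ports : ∀ σ i → f₀ (S.pline e₀ σ i) ≡ ι (c σ i))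
           (Skip : Fin 2 → Fin 3 → Set) (turn : Colour)
           (fits : ∀ τ → Fit e₀ τ (c τ) (rotate turn (Petersen.flow-end e₀ τ)) (Skip τ)) where

    complete-colouring : (Ok : V → Set) → (∀ τ i → Ok (inj₁ (vertex e₀ τ , i)) → ¬ Skip τ (place i (proj₂ (Petersen.end e₀ τ)))) →
      (∀ v → Ok (inj₂ (e₀ , v)) → Rainbow (f₀ ∘ S.inc e₀ v)) → ∃ λ (f : Line → K) → ∀ v → Ok v → Rainbow (f ∘ inc v)
    complete-colouring Ok skip ok = painted , painted-rainbow Ok locals ok
      where
      open Paint e₀ ι ι-injective f₀ c f₀-ports turn
             (arrange (λ τ → proj₂ (Petersen.end e₀ τ)) (λ τ → proj₁ (fits τ)) (λ τ → proj₁ (proj₂ (fits τ))))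
      locals : ∀ τ i → Ok (inj₁ (vertex e₀ τ , i)) → Rainbow (local τ i)
      locals τ i okv = Rainbow-cong same (proj₂ (proj₂ (fits τ)) i (skip τ i okv))
        where
        same : ∀ k → cluster (slot τ) (c τ) (rotate turn (Petersen.flow-end e₀ τ)) (proj₁ (fits τ)) (proj₁ (proj₂ (fits τ))) i k ≡ local τ i k
        same k with does (k Fin.≟ slot τ)
        ... | true = refl
        ... | false with does (k Fin.≟ slot τ ⊕ 1)
        ...   | true  = refl
        ...   | false = refl

  -- Semiedges lead to inner vertices of the pole, so `l` lies in at most one connector. If it does,
  -- one new vertex is among the deleted ends and `fit-except` treats its triple; every connector
  -- without `l` has total zero and is treated by `fit`.
  broken : ∀ l → ∃ λ (f : Line → Colour) → ∀ v → (∀ i → inc v i ≢ l) → Rainbow (f ∘ inc v)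
  broken (e₀ , l) = colouring (Fin.any? λ i → S.pline e₀ zero i ≟ᴸ l) (Fin.any? λ i → S.pline e₀ (# 1) i ≟ᴸ l)
    where
    open IsSuperedge (superedge e₀) using (_≟ᴸ_; port-inner)
    open PoleLemmas (S e₀) using (same-line)
    f₀ = proj₁ (I.broken e₀ l)
    c : Fin 2 → Fin 3 → Colour
    c σ i = f₀ (S.pline e₀ σ i)
    s : Fin 2 → Colour
    s = Petersen.flow-end e₀
    Skip : Fin 2 → Fin 3 → Set
    Skip τ i = S.pline e₀ τ i ≡ l
    missed : ∀ τ t → ¬ (∃ λ i → S.pline e₀ τ i ≡ l) → Fit e₀ τ (c τ) t (Skip τ)
    missed τ t no-hit = fit e₀ τ (c τ) t (Skip τ) (proj₂ (proj₂ (I.broken e₀ l)) τ (λ i eq → no-hit (i , eq)))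
    weaken : ∀ τ {t h} → S.pline e₀ τ h ≡ l → Fit e₀ τ (c τ) t (_≡ h) → Fit e₀ τ (c τ) t (Skip τ)
    weaken τ {t} {h} hit (p , q , fits) = p , q , λ i n → fits i (λ { refl → n hit })
    single : ∀ i j → S.pline e₀ zero i ≡ l → S.pline e₀ (# 1) j ≡ l → ⊥
    single i j hit hit′ with same-line (inj₂ (zero , i)) (inj₂ (# 1 , j)) (trans hit (sym hit′))
    ... | inj₂ eq with trans (sym (proj₂ (port-inner (zero , i)))) eq
    ...   | ()
    finish : ∀ turn → (∀ τ → Fit e₀ τ (c τ) (rotate turn (s τ)) (Skip τ)) → ∃ λ (f : Line → Colour) → ∀ v → (∀ i → inc v i ≢ (e₀ , l)) → Rainbow (f ∘ inc v)
    finish turn fits = complete-colouring e₀ id id f₀ c (λ _ _ → refl) Skip turn fits (λ v → ∀ i → inc v i ≢ (e₀ , l))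
      (λ τ i n hit → n (proj₂ (Petersen.end e₀ τ)) (trans (line-at τ (place i (proj₂ (Petersen.end e₀ τ))) (Petersen.inc-end e₀ τ)) (cong (e₀ ,_) hit)))
      (λ v n → proj₁ (proj₂ (I.broken e₀ l)) v (λ i eq → n i (cong (e₀ ,_) eq)))
      where
      line-at : ∀ {x : Fin 15 × Fin 2} τ p → x ≡ (e₀ , τ) → _≡_ {A = Line} (proj₁ x , S.pline (proj₁ x) (proj₂ x) p) (e₀ , S.pline e₀ τ p)
      line-at τ p refl = refl
    colouring : Dec (∃ λ i → S.pline e₀ zero i ≡ l) → Dec (∃ λ i → S.pline e₀ (# 1) i ≡ l) →
      ∃ λ (f : Line → Colour) → ∀ v → (∀ i → inc v i ≢ (e₀ , l)) → Rainbow (f ∘ inc v)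
    colouring (no n)         (no m)         = finish zero λ { zero → missed zero _ n ; (suc zero) → missed (# 1) _ m }
    colouring (yes (h , hit)) (yes (j , hit′)) = ⊥-elim (single h j hit hit′)
    colouring (yes (h , hit)) (no m) = let t , F = fit-except e₀ zero (c zero) h in
      -- This rotation gives the two edges of equal colour at end 0 the net colour `t` that the
      -- damaged triple needs; at end 1 any net colour can be completed.
      finish (t ⊕ (3 ∸ Fin.toℕ (s zero))) λ
        { zero → weaken zero hit (subst (λ u → Fit e₀ zero (c zero) u (_≡ h)) (sym (rotate-onto t (s zero))) F) ; (suc zero) → missed (# 1) _ m }
    colouring (no n) (yes (h , hit)) = let t , F = fit-except e₀ (# 1) (c (# 1)) h in
      finish (t ⊕ (3 ∸ Fin.toℕ (s (# 1)))) λ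
        { zero → missed zero _ n ; (suc zero) → weaken (# 1) hit (subst (λ u → Fit e₀ (# 1) (c (# 1)) u (_≡ h)) (sym (rotate-onto t (s (# 1)))) F) }

  four-colouring : (f₀ : S.Line zero → Fin 4) (c : Fin 2 → Fin 3 → Colour) → (∀ v → Rainbow (f₀ ∘ S.inc zero v)) →
    (∀ σ i → f₀ (S.pline zero σ i) ≡ Fin.inject₁ (c σ i)) → (∀ σ → Rainbow (c σ)) → ∃ λ (f : Line → Fin 4) → ∀ v → Rainbow (f ∘ inc v)
  four-colouring f₀ c ok ports rainbow = let f , proper = complete-colouring zero Fin.inject₁ Fin.inject₁-injective f₀ c ports (λ _ _ → ⊥) zero
                                               (λ τ → fit zero τ (c τ) _ _ (rainbow τ)) (λ _ → ⊤) (λ _ _ _ ()) (λ v _ → ok v)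
                                         in f , λ v → proper v _

-- Edge cuts

pigeonhole : {A : Set} {xs ys : List A} → Unique xs → (∀ {x} → x ∈ xs → x ∈ ys) → length xs ≤ length ys
pigeonhole {xs = []}     _          _   = z≤n
pigeonhole {xs = x ∷ xs} (x∉ ∷ uni) sub with ∈-∃++ (sub (here refl))
... | as , bs , refl = ℕ.≤-trans (s≤s (pigeonhole uni rest)) (ℕ.≤-reflexive size)
  where
  rest : ∀ {y} → y ∈ xs → y ∈ as ++ bs
  rest y∈ with ∈-++⁻ as (sub (there y∈))
  ... | inj₁ y∈as           = ∈-++⁺ˡ y∈as
  ... | inj₂ (there y∈bs)   = ∈-++⁺ʳ as y∈bs
  ... | inj₂ (here refl)    = ⊥-elim (All.lookup x∉ y∈ refl)
  size : suc (length (as ++ bs)) ≡ length (as ++ x ∷ bs)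
  size = trans (cong suc (length-++ as)) (trans (sym (ℕ.+-suc (length as) (length bs))) (sym (length-++ as)))

length-filterᵇ : {A : Set} (p : A → Bool) (xs : List A) → sum (map (λ x → bit (p x)) xs) ≡ length (filterᵇ p xs)
length-filterᵇ p []       = refl
length-filterᵇ p (x ∷ xs) with p x
... | true  = cong suc (length-filterᵇ p xs)
... | false = length-filterᵇ p xs

∈-filterᵇ⁺ : {A : Set} (p : A → Bool) {x : A} {xs : List A} → x ∈ xs → p x ≡ true → x ∈ filterᵇ p xs
∈-filterᵇ⁺ p x∈ px = ∈-filter⁺ (λ x → T? (p x)) x∈ (Equivalence.from T-≡ px)

∈-filterᵇ⁻ : {A : Set} (p : A → Bool) {x : A} {xs : List A} → x ∈ filterᵇ p xs → x ∈ xs × p x ≡ true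
∈-filterᵇ⁻ p x∈ = let x∈xs , px = ∈-filter⁻ (λ x → T? (p x)) x∈ in x∈xs , Equivalence.to T-≡ px

module _ {A : Set} where

  sum-mono : (f g : A → ℕ) → (∀ x → f x ≤ g x) → ∀ xs → sum (map f xs) ≤ sum (map g xs)
  sum-mono f g le []       = z≤n
  sum-mono f g le (x ∷ xs) = ℕ.+-mono-≤ (le x) (sum-mono f g le xs)

  sum-+ : (f g : A → ℕ) → ∀ xs → sum (map (λ x → f x + g x) xs) ≡ sum (map f xs) + sum (map g xs)
  sum-+ f g []       = refl
  sum-+ f g (x ∷ xs) = trans (cong (f x + g x +_) (sum-+ f g xs))
    (solve 4 (λ a b c d → a :+ b :+ (c :+ d) := a :+ c :+ (b :+ d)) refl (f x) (g x) (sum (map f xs)) (sum (map g xs)))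
    where open +-*-Solver

  sum-cong : (f g : A → ℕ) → (∀ x → f x ≡ g x) → ∀ xs → sum (map f xs) ≡ sum (map g xs)
  sum-cong f g eq xs = cong sum (map-cong eq xs)

  term≤sum : (f : A → ℕ) → ∀ {x xs} → x ∈ xs → f x ≤ sum (map f xs)
  term≤sum f {xs = _ ∷ xs} (here refl) = ℕ.m≤m+n _ (sum (map f xs))
  term≤sum f {xs = y ∷ xs} (there x∈)  = ℕ.≤-trans (term≤sum f x∈) (ℕ.m≤n+m _ (f y))

  two-terms≤sum : (f : A → ℕ) → ∀ {x y xs} → x ≢ y → x ∈ xs → y ∈ xs → f x + f y ≤ sum (map f xs)
  two-terms≤sum f x≢y (here refl) (here refl) = ⊥-elim (x≢y refl)
  two-terms≤sum f x≢y (here refl) (there y∈)  = ℕ.+-monoʳ-≤ _ (term≤sum f y∈)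
  two-terms≤sum f {x} {y} {xs = _ ∷ xs} x≢y (there x∈) (here refl) = subst (_≤ f y + sum (map f xs)) (ℕ.+-comm (f y) (f x)) (ℕ.+-monoʳ-≤ (f y) (term≤sum f x∈))
  two-terms≤sum f {xs = z ∷ xs} x≢y (there x∈) (there y∈)  = ℕ.≤-trans (two-terms≤sum f x≢y x∈ y∈) (ℕ.m≤n+m _ (f z))

differ-xor : ∀ a b → differ a b ≡ bit (a xor b)
differ-xor false b = refl
differ-xor true  b = refl

xor-true : ∀ a b → a xor b ≡ true → a ≢ b
xor-true false true  _ ()
xor-true true  false _ ()

bit≤1 : ∀ b → bit b ≤ 1
bit≤1 false = z≤n
bit≤1 true  = ℕ.≤-refl

bit-zero : ∀ b → bit b ≤ 0 → b ≡ false
bit-zero false _ = refl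

bit-not : ∀ b → bit b + bit (not b) ≡ 1
bit-not false = refl
bit-not true  = refl

module PoleCuts (X : Pole) (superedge : IsSuperedge X) where
  open Pole X
  open Cut X
  open IsSuperedge superedge

  cutSize-cong : ∀ A b b′ → (∀ p → b p ≡ b′ p) → cutSize lines A b ≡ cutSize lines A b′
  cutSize-cong A b b′ eq = sum-cong (cut A b) (cut A b′) (λ l → cong₂ differ (at (end l false)) (at (end l true))) lines
    where
    at : ∀ o → side A b o ≡ side A b′ o
    at (inj₁ v) = refl
    at (inj₂ p) = eq p

  module _ (A : V → Bool) (b : Port → Bool) where

    hit : Owner → Bool
    hit (inj₁ _) = false
    hit (inj₂ p) = b p

    touched : Line → Bool
    touched l = hit (end l false) ∨ hit (end l true)

    cut-touched : ∀ l → cut A (λ _ → false) l ≤ cut A b l + bit (touched l)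
    cut-touched l = go (end l false) (end l true)
      where
      go : ∀ o o′ → differ (side A (λ _ → false) o) (side A (λ _ → false) o′) ≤ differ (side A b o) (side A b o′) + bit (hit o ∨ hit o′)
      go (inj₁ v) (inj₁ w) = ℕ.m≤m+n _ 0
      go (inj₁ v) (inj₂ p) with A v | b p
      ... | false | _     = z≤n
      ... | true  | true  = ℕ.≤-refl
      ... | true  | false = ℕ.≤-refl
      go (inj₂ p) (inj₁ w) with A w | b p
      ... | false | _     = z≤n
      ... | true  | true  = ℕ.≤-refl
      ... | true  | false = ℕ.≤-refl
      go (inj₂ p) (inj₂ q) = z≤n

    touched≤ones : sum (map (λ l → bit (touched l)) lines) ≤ ones b
    touched≤ones = subst₂ _≤_ (sym (length-filterᵇ touched lines)) (trans (length-map port-line (filterᵇ b ports)) (sym (length-filterᵇ b ports)))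
      (pigeonhole (Unique.filter⁺ (λ l → T? (touched l)) lines-unique) at-port)
      where
      open PoleLemmas X using (owner-port)
      port-line : Port → Line
      port-line (σ , i) = pline σ i
      found : ∀ l c → hit (end l c) ≡ true → l ∈ map port-line (filterᵇ b ports)
      found l c eq with end l c in here-end
      ... | inj₂ p = subst (_∈ map port-line (filterᵇ b ports)) (cong proj₁ (trans (cong line (sym (owner-port (dart (l , c)) here-end))) (line-dart (l , c))))
                           (∈-map⁺ port-line (∈-filterᵇ⁺ b (all-ports p) eq))
        where
        all-ports : ∀ p → p ∈ ports
        all-ports (σ , i) = ∈-cartesianProduct⁺ (∈-allFin σ) (∈-allFin i)
      at-port : ∀ {l} → l ∈ filterᵇ touched lines → l ∈ map port-line (filterᵇ b ports)
      at-port {l} l∈ with ∨-true (hit (end l false)) (proj₂ (∈-filterᵇ⁻ touched {xs = lines} l∈))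
      ... | inj₁ eq = found l false eq
      ... | inj₂ eq = found l true eq

    -- Moving the semiedges in `b` to the other side affects only their own lines, one for each.
    cutSize-ports : cutSize lines A (λ _ → false) ≤ cutSize lines A b + ones b
    cutSize-ports = ℕ.≤-trans (sum-mono _ (λ l → cut A b l + bit (touched l)) cut-touched lines)
      (ℕ.≤-trans (ℕ.≤-reflexive (sum-+ (cut A b) (λ l → bit (touched l)) lines)) (ℕ.+-monoʳ-≤ (cutSize lines A b) touched≤ones))

module Expansion (S : Fin 15 → Pole) (superedge : ∀ e → IsSuperedge (S e)) where
  open Petersen using (edge; vertex)
  open Assembly S superedge
  open Cubic cubic using (inc; nb; Cross; Sparse)
  module C (e : Fin 15) = Cut (S e)
  module B (e : Fin 15) = PoleCuts (S e) (superedge e)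

  edges : List (Fin 15)
  edges = allFin 15

  one-edge : ∀ e → sum (map (λ f → bit (does (e Fin.≟ f))) edges) ≡ 1
  one-edge = toWitness {a? = Fin.all? λ e → sum (map (λ f → bit (does (e Fin.≟ f))) edges) ℕ.≟ 1} _

  clusters : List (Fin 10)
  clusters = reverse (allFin 10)

  ∈-clusters : ∀ w → w ∈ clusters
  ∈-clusters w = reverse⁺ (∈-allFin w)

  members : Fin 10 → List V
  members w = inj₁ (w , zero) ∷ inj₁ (w , # 1) ∷ inj₁ (w , # 2) ∷ []

  module _ (A : V → Bool) where

    size-at : Fin 10 → ℕ
    size-at w = sum (map (λ v → bit (A v)) (members w))

    inside-of : ∀ e → S.V e → Bool
    inside-of e v = A (inj₂ (e , v))

    border : ∀ e → Port → Bool
    border e p = A (inner e (inj₂ p))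

    cutAt weightAt : Fin 15 → ℕ
    cutAt e    = C.cutSize e (I.lines e) (inside-of e) (border e)
    weightAt e = C.weight e (I.vertices e) (inside-of e)

    -- `unplace` permutes the three vertices cyclically, by an amount that depends on the connector.
    rotate-sum : ∀ k (h : Fin 3 → ℕ) n → h (unplace zero k) + (h (unplace (# 1) k) + (h (unplace (# 2) k) + n)) ≡ h zero + (h (# 1) + (h (# 2) + 0)) + n
    rotate-sum k h n = go k
      where
      open +-*-Solver
      x = h zero
      y = h (# 1)
      z = h (# 2)
      go : ∀ k → h (unplace zero k) + (h (unplace (# 1) k) + (h (unplace (# 2) k) + n)) ≡ x + (y + (z + 0)) + n
      go zero             = solve 4 (λ x y z n → x :+ (y :+ (z :+ n)) := x :+ (y :+ (z :+ con 0)) :+ n) refl x y z n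
      go (suc zero)       = solve 4 (λ x y z n → z :+ (x :+ (y :+ n)) := x :+ (y :+ (z :+ con 0)) :+ n) refl x y z n
      go (suc (suc zero)) = solve 4 (λ x y z n → y :+ (z :+ (x :+ n)) := x :+ (y :+ (z :+ con 0)) :+ n) refl x y z n

    ones-border : ∀ e → ones (border e) ≡ size-at (vertex e zero) + size-at (vertex e (# 1))
    ones-border e = trans (rotate-sum (proj₂ (Petersen.end e zero)) (λ i → bit (A (inj₁ (vertex e zero , i))))
      (sum (map (λ i → bit (border e (# 1 , i))) (allFin 3))))
      (cong (size-at (vertex e zero) +_) (trans (rotate-sum (proj₂ (Petersen.end e (# 1))) (λ i → bit (A (inj₁ (vertex e (# 1) , i)))) 0) (ℕ.+-identityʳ _)))

    all-vertices : List V
    all-vertices = concatMap members clusters ++ concatMap (λ e → map (λ v → inj₂ (e , v)) (I.vertices e)) edges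

    ∈-members : ∀ w i → inj₁ (w , i) ∈ members w
    ∈-members w zero             = here refl
    ∈-members w (suc zero)       = there (here refl)
    ∈-members w (suc (suc zero)) = there (there (here refl))

    ∈-all-vertices : ∀ v → v ∈ all-vertices
    ∈-all-vertices (inj₁ (w , i)) = ∈-++⁺ˡ (∈-concat⁺′ (∈-members w i) (∈-map⁺ members (∈-clusters w)))
    ∈-all-vertices (inj₂ (e , v)) = ∈-++⁺ʳ (concatMap members clusters)
      (∈-concat⁺′ (∈-map⁺ (λ v → inj₂ (e , v)) (I.∈-vertices e v)) (∈-map⁺ (λ e → map (λ v → inj₂ (e , v)) (I.vertices e)) (∈-allFin e)))

    sum-concatMap : {X Y : Set} (f : Y → ℕ) (g : X → List Y) (xs : List X) → sum (map f (concatMap g xs)) ≡ sum (map (λ x → sum (map f (g x))) xs)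
    sum-concatMap f g []       = refl
    sum-concatMap f g (x ∷ xs) = trans (sum-map-++ f (g x) (concatMap g xs)) (cong (sum (map f (g x)) +_) (sum-concatMap f g xs))

    total-size : sum (map (λ v → bit (A v)) all-vertices) ≡ sum (map size-at clusters) + sum (map weightAt edges)
    total-size = trans (sum-map-++ (λ v → bit (A v)) (concatMap members clusters) (concatMap (λ e → map (λ v → inj₂ (e , v)) (I.vertices e)) edges)) (cong₂ _+_ (sum-concatMap (λ v → bit (A v)) members clusters)
      (trans (sum-concatMap (λ v → bit (A v)) (λ e → map (λ v → inj₂ (e , v)) (I.vertices e)) edges)
             (sum-cong (λ e → sum (map (λ v → bit (A v)) (map (λ v → inj₂ (e , v)) (I.vertices e)))) weightAt (λ e → sum-map-map (λ v → bit (A v)) (λ v → inj₂ (e , v)) (I.vertices e)) edges)))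

    length≤total : ∀ xs → Unique xs → (∀ {x} → x ∈ xs → A x ≡ true) → length xs ≤ sum (map size-at clusters) + sum (map weightAt edges)
    length≤total xs uni true-at = subst (length xs ≤_) (trans (sym (length-filterᵇ A all-vertices)) total-size)
      (pigeonhole uni (λ {x} x∈ → ∈-filterᵇ⁺ A (∈-all-vertices x) (true-at x∈)))

    module _ (F : List Line) (cross : Cross A F) where

      belongs : Fin 15 → Line → Bool
      belongs e (f , _) = does (f Fin.≟ e)

      from : Fin 15 → List Line
      from e = filterᵇ (belongs e) F

      cross-line : ∀ l b → A (proj₁ (dart (l , b))) ≢ A (proj₁ (dart (l , not b))) → l ∈ F
      cross-line l b ne = subst (_∈ F) (cong proj₁ (line-dart (l , b)))
        (cross (proj₁ (dart (l , b))) (proj₂ (dart (l , b))) (λ eq → ne (trans eq (cong (λ (m , c) → A (proj₁ (dart (m , not c)))) (line-dart (l , b))))))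

      side-inner : ∀ e o → C.side e (inside-of e) (border e) o ≡ A (inner e o)
      side-inner e (inj₁ v) = refl
      side-inner e (inj₂ p) = refl

      cutAt≤ : ∀ e → cutAt e ≤ length (from e)
      cutAt≤ e = subst (_≤ length (from e)) (sym (trans (sum-cong (C.cut e (inside-of e) (border e)) (λ l → bit (crossing l)) (λ l → differ-xor (sd l false) (sd l true)) (I.lines e)) (length-filterᵇ crossing (I.lines e))))
        (subst (_≤ length (from e)) (length-map tag (filterᵇ crossing (I.lines e)))
          (pigeonhole (Unique.map⁺ {f = tag} (λ { refl → refl }) (Unique.filter⁺ (λ l → T? (crossing l)) (I.lines-unique e))) found))
        where
        tag : S.Line e → Line
        tag l = e , l
        sd : S.Line e → Bool → Bool
        sd l b = C.side e (inside-of e) (border e) (S.end e l b)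
        crossing : S.Line e → Bool
        crossing l = sd l false xor sd l true
        same : ∀ l b → sd l b ≡ A (proj₁ (dart ((e , l) , b)))
        same l b = trans (side-inner e (S.end e l b)) (cong A (sym (global-owner e (S.dart e (l , b)))))
        found : ∀ {x} → x ∈ map tag (filterᵇ crossing (I.lines e)) → x ∈ from e
        found x∈ with ∈-map⁻ tag {xs = filterᵇ crossing (I.lines e)} x∈
        ... | l , l∈ , refl = ∈-filterᵇ⁺ (belongs e)
              (cross-line (e , l) false (λ eq → xor-true (sd l false) (sd l true) (proj₂ (∈-filterᵇ⁻ crossing {xs = I.lines e} l∈)) (trans (same l false) (trans eq (sym (same l true))))))
              (dec-true (e Fin.≟ e) refl)

      sum-from : ∀ G → sum (map (λ e → length (filterᵇ (belongs e) G)) edges) ≡ length G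
      sum-from []      = refl
      sum-from (g ∷ G) = trans (sum-cong (λ e → length (filterᵇ (belongs e) (g ∷ G))) (λ e → bit (does (proj₁ g Fin.≟ e)) + length (filterᵇ (belongs e) G)) step edges)
        (trans (sum-+ (λ e → bit (does (proj₁ g Fin.≟ e))) (λ e → length (filterᵇ (belongs e) G)) edges) (cong₂ _+_ (one-edge (proj₁ g)) (sum-from G)))
        where
        step : ∀ e → length (filterᵇ (belongs e) (g ∷ G)) ≡ bit (does (proj₁ g Fin.≟ e)) + length (filterᵇ (belongs e) G)
        step e with does (proj₁ g Fin.≟ e)
        ... | true  = refl
        ... | false = refl

      cuts≤ : sum (map cutAt edges) ≤ length F
      cuts≤ = ℕ.≤-trans (sum-mono cutAt (λ e → length (from e)) cutAt≤ edges) (ℕ.≤-reflexive (sum-from F))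

    linked-at : ∀ e → Petersen.load (size-at (vertex e zero)) (size-at (vertex e (# 1))) ≤ cutAt e
    linked-at e = subst (λ o → o ⊓ (6 ∸ o) ≤ cutAt e) (ones-border e) (I.linked e (inside-of e) (border e))

    size-at≤3 : ∀ w → size-at w ≤ 3
    size-at≤3 w = ℕ.+-mono-≤ (bit≤1 (A (inj₁ (w , zero)))) (ℕ.+-mono-≤ (bit≤1 (A (inj₁ (w , # 1)))) (ℕ.+-mono-≤ (bit≤1 (A (inj₁ (w , # 2)))) (z≤n {0})))

    cap≤ : ∀ {n c} → 6 ⊓ n ≤ c → c ≤ 5 → n ≤ c
    cap≤ {n} {c} le c≤5 with ℕ.≤-total n 6
    ... | inj₁ n≤6 = subst (_≤ c) (ℕ.m≥n⇒m⊓n≡n n≤6) le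
    ... | inj₂ 6≤n = ⊥-elim (ℕ.<⇒≱ (s≤s c≤5) (subst (_≤ c) (ℕ.m≤n⇒m⊓n≡m 6≤n) le))

    module _ (small : sum (map cutAt edges) ≤ 5) where

      cutAt≤5 : ∀ e → cutAt e ≤ 5
      cutAt≤5 e = ℕ.≤-trans (term≤sum cutAt (∈-allFin e)) small

      isolated : ∀ e → ones (border e) ≤ 0 → weightAt e ≡ 0 ⊎ 2 + weightAt e ≤ cutAt e
      isolated e none = Data.Sum.map₂ (λ le → cap≤ (ℕ.≤-trans le (ℕ.≤-reflexive (B.cutSize-cong e (inside-of e) (λ _ → false) (border e) clear))) (cutAt≤5 e))
        (I.expanding e (inside-of e))
        where
        clear : ∀ p → false ≡ border e p
        clear (σ , i) = sym (bit-zero _ (ℕ.≤-trans (term≤sum (λ p → bit (border e p)) (∈-cartesianProduct⁺ (∈-allFin σ) (∈-allFin i))) none))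

      isolated≤ : ∀ e → ones (border e) ≤ 0 → weightAt e ≤ cutAt e
      isolated≤ e none with isolated e none
      ... | inj₁ w≡0 = ℕ.≤-trans (ℕ.≤-reflexive w≡0) z≤n
      ... | inj₂ le  = ℕ.≤-trans (ℕ.m≤n+m _ 2) le

      -- With the single semiedge put outside, the cut grows by at most 1. It is then still at most
      -- 5, so the cap in `expanding` is not reached and 2 + w is at most the cut plus 1.
      attached : ∀ e → ones (border e) ≡ 1 → cutAt e ≤ 4 → suc (weightAt e) ≤ cutAt e
      attached e one cut≤4 with I.expanding e (inside-of e)
      ... | inj₁ w≡0 = subst (λ n → suc n ≤ cutAt e) (sym w≡0) (subst (λ o → o ⊓ (6 ∸ o) ≤ cutAt e) one (I.linked e (inside-of e) (border e)))
      ... | inj₂ le  = ℕ.≤-pred (ℕ.≤-trans (cap≤ (ℕ.≤-trans le more) (ℕ.+-monoˡ-≤ 1 cut≤4)) (ℕ.≤-reflexive (ℕ.+-comm (cutAt e) 1)))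
        where
        more : C.cutSize e (I.lines e) (inside-of e) (λ _ → false) ≤ cutAt e + 1
        more = subst (λ o → C.cutSize e (I.lines e) (inside-of e) (λ _ → false) ≤ cutAt e + o) one (B.cutSize-ports e (inside-of e) (border e))

      -- If `A` contains no new vertex, a pole that meets `A` gives the surplus 2. If it contains
      -- one, each of the three poles there gives surplus 1, and 3 = 2 + 1 also pays for the new
      -- vertex itself.
      sparse : sum (map size-at clusters) ≤ 1 → ∀ xs → 1 ≤ length xs → Unique xs → (∀ {x} → x ∈ xs → A x ≡ true) → 2 + length xs ≤ sum (map cutAt edges)
      sparse few xs nonempty uni true-at = decide (Fin.any? λ w → Fin.any? λ i → A (inj₁ (w , i)) Data.Bool.≟ true)
        where
        open ℕ.≤-Reasoning
        decide : Dec (∃ λ w → ∃ λ i → A (inj₁ (w , i)) ≡ true) → 2 + length xs ≤ sum (map cutAt edges)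
        decide (no none) = start-from xs nonempty true-at
          where
          sizes : ∀ w → size-at w ≤ 0
          sizes w = ℕ.+-mono-≤ (off zero) (ℕ.+-mono-≤ (off (# 1)) (ℕ.+-mono-≤ (off (# 2)) (z≤n {0})))
            where
            off : ∀ i → bit (A (inj₁ (w , i))) ≤ 0
            off i with A (inj₁ (w , i)) in eq
            ... | true  = ⊥-elim (none (w , i , eq))
            ... | false = z≤n
          no-size : sum (map size-at clusters) ≤ 0
          no-size = ℕ.≤-trans (sum-mono size-at (λ _ → 0) sizes clusters) z≤n
          clear : ∀ e → ones (border e) ≤ 0
          clear e = subst (_≤ 0) (sym (ones-border e)) (ℕ.+-mono-≤ (sizes (vertex e zero)) (sizes (vertex e (# 1))))
          start-from : ∀ ys → 1 ≤ length ys → (∀ {x} → x ∈ ys → A x ≡ true) → 2 + length xs ≤ sum (map cutAt edges)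
          start-from (inj₁ (w , i) ∷ ys) _ at = ⊥-elim (none (w , i , at (here refl)))
          start-from (inj₂ (e , v) ∷ ys) _ at = begin
            2 + length xs                                          ≤⟨ ℕ.+-monoʳ-≤ 2 (length≤total xs uni true-at) ⟩
            2 + (sum (map size-at clusters) + sum (map weightAt edges)) ≤⟨ ℕ.+-monoʳ-≤ 2 (ℕ.+-monoˡ-≤ _ no-size) ⟩
            1 + (1 + sum (map weightAt edges))                     ≡⟨ cong₂ (λ a b → a + (b + sum (map weightAt edges))) (sym (one-edge e)) (sym (one-edge e)) ⟩
            sum (map δ edges) + (sum (map δ edges) + sum (map weightAt edges)) ≡⟨ cong (sum (map δ edges) +_) (sym (sum-+ δ weightAt edges)) ⟩
            sum (map δ edges) + sum (map (λ f → δ f + weightAt f) edges) ≡⟨ sym (sum-+ δ (λ f → δ f + weightAt f) edges) ⟩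
            sum (map (λ f → δ f + (δ f + weightAt f)) edges)       ≤⟨ sum-mono _ cutAt bound edges ⟩
            sum (map cutAt edges)                                  ∎
            where
            δ : Fin 15 → ℕ
            δ f = bit (does (e Fin.≟ f))
            bound : ∀ f → δ f + (δ f + weightAt f) ≤ cutAt f
            bound f with e Fin.≟ f
            ... | no _ = isolated≤ f (clear f)
            ... | yes refl with isolated e (clear e)
            ...   | inj₂ le  = le
            ...   | inj₁ w≡0 = ⊥-elim (ℕ.<⇒≱ (subst (λ b → bit b ≤ weightAt e) (at (here refl)) (term≤sum (λ v → bit (inside-of e v)) (I.∈-vertices e v))) (ℕ.≤-reflexive w≡0))
        decide (yes (w , i , at)) = begin
          2 + length xs                                            ≤⟨ ℕ.+-monoʳ-≤ 2 (length≤total xs uni true-at) ⟩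
          2 + (sum (map size-at clusters) + sum (map weightAt edges)) ≤⟨ ℕ.+-monoʳ-≤ 2 (ℕ.+-monoˡ-≤ _ few) ⟩
          3 + sum (map weightAt edges)                             ≡⟨ cong (_+ sum (map weightAt edges)) (sym (Petersen.three-edges w)) ⟩
          sum (map (λ e → bit (Petersen.incident w e)) edges) + sum (map weightAt edges) ≡⟨ sym (sum-+ (λ e → bit (Petersen.incident w e)) weightAt edges) ⟩
          sum (map (λ e → bit (Petersen.incident w e) + weightAt e) edges)  ≤⟨ sum-mono _ cutAt bound edges ⟩
          sum (map cutAt edges)                                    ∎
          where
          size-w : 1 ≤ size-at w
          size-w = ℕ.≤-trans (ℕ.≤-reflexive (cong bit (sym at))) (term≤sum (λ v → bit (A v)) (∈-members w i))
          size-w≤ : size-at w ≤ 1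
          size-w≤ = ℕ.≤-trans (term≤sum size-at (∈-clusters w)) few
          size-other : ∀ x → x ≢ w → size-at x ≤ 0
          size-other x x≢w = ℕ.≤-pred (ℕ.≤-trans (ℕ.+-monoˡ-≤ (size-at x) size-w)
            (ℕ.≤-trans (two-terms≤sum size-at (x≢w ∘ sym) (∈-clusters w) (∈-clusters x)) few))
          one-at : ∀ k → ones (border (edge w k)) ≡ 1
          one-at k = trans (ones-border (edge w k)) (split (Petersen.ends-cover w k))
            where
            e = edge w k
            distinct-ends : vertex e zero ≢ vertex e (# 1)
            distinct-ends eq = Fin.0≢1+n (Petersen.vertex-injective e zero (# 1) eq)
            split : vertex e zero ≡ w ⊎ vertex e (# 1) ≡ w → size-at (vertex e zero) + size-at (vertex e (# 1)) ≡ 1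
            split (inj₁ eq) = ℕ.≤-antisym (ℕ.+-mono-≤ (subst (λ x → size-at x ≤ 1) (sym eq) size-w≤) (size-other (vertex e (# 1)) (λ eq′ → distinct-ends (trans eq (sym eq′)))))
                                          (ℕ.≤-trans (subst (λ x → 1 ≤ size-at x) (sym eq) size-w) (ℕ.m≤m+n (size-at (vertex e zero)) (size-at (vertex e (# 1)))))
            split (inj₂ eq) = ℕ.≤-antisym (ℕ.+-mono-≤ (size-other (vertex e zero) (λ eq′ → distinct-ends (trans eq′ (sym eq)))) (subst (λ x → size-at x ≤ 1) (sym eq) size-w≤))
                                          (ℕ.≤-trans (subst (λ x → 1 ≤ size-at x) (sym eq) size-w) (ℕ.m≤n+m (size-at (vertex e (# 1))) (size-at (vertex e zero))))
          positive : ∀ k → 1 ≤ cutAt (edge w k)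
          positive k = subst (λ o → o ⊓ (6 ∸ o) ≤ cutAt (edge w k)) (one-at k) (I.linked (edge w k) (inside-of (edge w k)) (border (edge w k)))
          -- Another edge at `w` already takes one of the five lines.
          cut≤4 : ∀ k → cutAt (edge w k) ≤ 4
          cut≤4 k = ℕ.≤-pred (ℕ.≤-trans (ℕ.+-monoˡ-≤ (cutAt (edge w k)) (positive (k ⊕ 1)))
            (ℕ.≤-trans (two-terms≤sum cutAt (Petersen.next-edge w k) (∈-allFin (edge w (k ⊕ 1))) (∈-allFin (edge w k))) small))
          bound : ∀ e → bit (Petersen.incident w e) + weightAt e ≤ cutAt e
          bound e with Petersen.incident w e in eq
          ... | true  = let k , e≡ = Petersen.incident-slot w e eq in
            subst (λ e → suc (weightAt e) ≤ cutAt e) e≡ (attached (edge w k) (one-at k) (cut≤4 k))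
          ... | false = let p , q = Petersen.not-incident w e eq in
            isolated≤ e (subst (_≤ 0) (sym (ones-border e)) (ℕ.+-mono-≤ (size-other (vertex e zero) p) (size-other (vertex e (# 1)) q)))

  size-complement : ∀ A w → size-at A w + size-at (not ∘ A) w ≡ 3
  size-complement A w = trans (sym (sum-+ (λ v → bit (A v)) (λ v → bit (not (A v))) (members w)))
    (sum-cong _ (λ _ → 1) (λ v → bit-not (A v)) (members w))

  expansion : ∀ A F → Cross A F → length F ≤ 5 → Sparse A F ⊎ Sparse (not ∘ A) F
  expansion A F cross F≤5 with Petersen.concentrated (size-at A) (size-at≤3 A)
      (ℕ.≤-trans (sum-mono _ (cutAt A) (linked-at A) edges) (ℕ.≤-trans (cuts≤ A F cross) F≤5))
  ... | inj₁ few  = inj₁ λ xs ne uni at → ℕ.≤-trans (sparse A (ℕ.≤-trans (cuts≤ A F cross) F≤5) few xs ne uni at) (cuts≤ A F cross)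
  ... | inj₂ many = inj₂ λ xs ne uni at → ℕ.≤-trans (sparse (not ∘ A) (ℕ.≤-trans (cuts≤ (not ∘ A) F cross′) F≤5) few xs ne uni at) (cuts≤ (not ∘ A) F cross′)
    where
    cross′ : Cross (not ∘ A) F
    cross′ v i ne = cross v i (λ eq → ne (cong not eq))
    few : sum (map (size-at (not ∘ A)) clusters) ≤ 1
    few = ℕ.+-cancelˡ-≤ 29 _ 1 (ℕ.≤-trans (ℕ.+-monoˡ-≤ _ many)
      (ℕ.≤-reflexive (trans (sym (sum-+ (size-at A) (size-at (not ∘ A)) clusters)) (sum-cong _ (λ _ → 3) (size-complement A) clusters))))

-- Graphs on Fin n

-- Lets reachability after deletion of edges serve as a Boolean set without an algorithm for it: the
-- goal there is a contradiction.
¬¬-decide : ∀ {n} (P : Fin n → Set) → ¬ ¬ (∀ i → Dec (P i))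
¬¬-decide {zero}  P k = k λ ()
¬¬-decide {suc n} P k = ¬¬-decide (P ∘ suc) λ ds →
  k λ { zero → no (λ p → k λ { zero → yes p ; (suc i) → ds i }) ; (suc i) → ds i }

third-slot : ∀ i j k → i ≢ j → k ≢ i → k ≢ j → k ≡ third i j
third-slot = toWitness {a? = Fin.all? λ i → Fin.all? λ j → Fin.all? λ k → ¬? (i Fin.≟ j) →-dec ¬? (k Fin.≟ i) →-dec ¬? (k Fin.≟ j) →-dec (k Fin.≟ third i j)} _

option : Fin 4 → Maybe Colour
option zero    = nothing
option (suc c) = just c

_≟ᴹ_ : DecidableEquality (Maybe Colour)
_≟ᴹ_ = Maybe-≡-dec Fin._≟_

Completes : (Fin 3 → Maybe Colour) → (Fin 3 → Colour) → Set
Completes m g = Rainbow g × (∀ i → m i ≡ nothing ⊎ m i ≡ just (g i))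

Consistent : (Fin 3 → Maybe Colour) → Set
Consistent m = ∀ i j → m i ≡ m j → i ≡ j ⊎ m i ≡ nothing

completion-check : ∀ a b c → Consistent (triple (option a) (option b) (option c)) →
  ∃ λ x → ∃ λ y → ∃ λ z → Completes (triple (option a) (option b) (option c)) (triple x y z)
completion-check = toWitness {a? = Fin.all? λ a → Fin.all? λ b → Fin.all? λ c → let m = triple (option a) (option b) (option c) in
  (Fin.all? λ i → Fin.all? λ j → (m i ≟ᴹ m j) →-dec ((i Fin.≟ j) ⊎-dec (m i ≟ᴹ nothing))) →-dec
  Fin.any? λ x → Fin.any? λ y → Fin.any? λ z → rainbow? (triple x y z) ×-dec
    Fin.all? λ i → (m i ≟ᴹ nothing) ⊎-dec (m i ≟ᴹ just (triple x y z i))} _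

completion : ∀ m → Consistent m → ∃ (Completes m)
completion m consistent = let x , y , z , rainbow , agrees = completion-check (code (m zero)) (code (m (# 1))) (code (m (# 2))) consistent′ in
    triple x y z , rainbow , λ i → Data.Sum.map (trans (same i)) (trans (same i)) (agrees i)
  where
  code : Maybe Colour → Fin 4
  code nothing  = zero
  code (just c) = suc c
  option-code : ∀ x → x ≡ option (code x)
  option-code nothing  = refl
  option-code (just c) = refl
  same : ∀ i → m i ≡ triple (option (code (m zero))) (option (code (m (# 1)))) (option (code (m (# 2)))) i
  same zero             = option-code (m zero)
  same (suc zero)       = option-code (m (# 1))
  same (suc (suc zero)) = option-code (m (# 2))
  consistent′ : Consistent (triple (option (code (m zero))) (option (code (m (# 1)))) (option (code (m (# 2)))))
  consistent′ i j eq = Data.Sum.map₂ (trans (sym (same i))) (consistent i j (trans (same i) (trans eq (sym (same j)))))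

holds : {P : Set} (p? : Dec P) → does p? ≡ true → P
holds (yes p) _ = p

T⇒≡ : ∀ {b} → T b → b ≡ true
T⇒≡ = Equivalence.to T-≡

≡⇒T : ∀ {b} → b ≡ true → T b
≡⇒T = Equivalence.from T-≡

⇔⇒≡ : ∀ {a b} → (T a → T b) → (T b → T a) → a ≡ b
⇔⇒≡ {false} {false} f g = refl
⇔⇒≡ {false} {true}  f g = ⊥-elim (g tt)
⇔⇒≡ {true}  {false} f g = ⊥-elim (f tt)
⇔⇒≡ {true}  {true}  f g = refl

any-sound : {A : Set} (p : A → Bool) (xs : List A) → any p xs ≡ true → ∃ λ x → x ∈ xs × p x ≡ true
any-sound p (x ∷ xs) eq with p x in px
... | true  = x , here refl , px
... | false = let y , y∈ , py = any-sound p xs eq in y , there y∈ , py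

module Realise (Γ : Cubic) {n : ℕ} (index : Cubic.V Γ ↔ Fin n)
               (no-loop : ∀ v i → Cubic.nb Γ v i ≢ v) (no-parallel : ∀ v → Rainbow (Cubic.nb Γ v)) where
  open Cubic Γ
  open Inverse index using (to; from) renaming (strictlyInverseˡ to to-from; strictlyInverseʳ to from-to)

  to-injective : ∀ {v w} → to v ≡ to w → v ≡ w
  to-injective {v} {w} eq = trans (sym (from-to v)) (trans (cong from eq) (from-to w))

  from-injective : ∀ {i j} → from i ≡ from j → i ≡ j
  from-injective {i} {j} eq = trans (sym (to-from i)) (trans (cong to eq) (to-from j))

  joins? : ∀ i j → Dec (∃ λ k → to (nb (from i) k) ≡ j)
  joins? i j = Fin.any? λ k → to (nb (from i) k) Fin.≟ j

  graph : Graph n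
  graph i j = does (joins? i j)

  edge⁻ : ∀ {i j} → Edge graph i j → ∃ λ k → nb (from i) k ≡ from j
  edge⁻ {i} {j} e = let k , eq = holds (joins? i j) (T⇒≡ e) in k , trans (sym (from-to _)) (cong from eq)

  edge⁺ : ∀ {i j} k → nb (from i) k ≡ from j → Edge graph i j
  edge⁺ {i} {j} k eq = ≡⇒T (dec-true (joins? i j) (k , trans (cong to eq) (to-from j)))

  first : ∀ {i j} → Dec (∃ λ k → to (nb (from i) k) ≡ j) → Fin 3
  first (yes (k , _)) = k
  first (no _)        = zero

  slot : Fin n → Fin n → Fin 3
  slot i j = first (joins? i j)

  slot-nb : ∀ {i j} → Edge graph i j → nb (from i) (slot i j) ≡ from j
  slot-nb {i} {j} e = go (joins? i j) (T⇒≡ e)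
    where
    go : ∀ d → does d ≡ true → nb (from i) (first {i} {j} d) ≡ from j
    go (yes (k , eq)) _ = trans (sym (from-to _)) (cong from eq)

  back : ∀ v i → ∃ λ j → nb (nb v i) j ≡ v × inc (nb v i) j ≡ inc v i
  back v i = proj₂ (far (v , i)) , cong proj₁ (far-far (v , i)) , far-line (v , i)

  edge-sym : ∀ {i j} → Edge graph i j → Edge graph j i
  edge-sym {i} {j} e = let k , eq = edge⁻ e
                           l , eq′ , _ = back (from i) k in
    edge⁺ l (subst (λ v → nb v l ≡ from i) eq eq′)

  line-of : Fin n → Fin n → Line
  line-of i j = inc (from i) (slot i j)

  line-of-≡ : ∀ {i j} v k → from i ≡ v → nb v k ≡ from j → line-of i j ≡ inc v k
  line-of-≡ {i} {j} v k refl eq = cong (inc (from i)) (no-parallel (from i) (slot i j) k (trans (slot-nb (edge⁺ k eq)) (sym eq)))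

  line-of-sym : ∀ {i j} → Edge graph i j → line-of i j ≡ line-of j i
  line-of-sym {i} {j} e = let l , eq , same = back (from i) (slot i j)
                              there-and-back = subst (λ v → nb v l ≡ from i) (slot-nb e) eq in
    sym (trans (line-of-≡ (from j) l refl there-and-back) (trans (cong (λ v → inc v l) (sym (slot-nb e))) same))

  same-line : ∀ v i w j → inc v i ≡ inc w j → v ≡ w ⊎ nb v i ≡ w
  same-line v i w j eq = go (line (v , i)) (line (w , j)) refl refl eq
    where
    go : ∀ x y → line (v , i) ≡ x → line (w , j) ≡ y → proj₁ (line (v , i)) ≡ proj₁ (line (w , j)) → v ≡ w ⊎ nb v i ≡ w
    go (l , b) (m , c) ex ey eq with trans (sym (cong proj₁ ex)) (trans eq (cong proj₁ ey))
    go (l , false) (.l , false) ex ey eq | refl = inj₁ (cong proj₁ (trans (sym (dart-line (v , i))) (trans (cong dart (trans ex (sym ey))) (dart-line (w , j)))))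
    go (l , true)  (.l , true)  ex ey eq | refl = inj₁ (cong proj₁ (trans (sym (dart-line (v , i))) (trans (cong dart (trans ex (sym ey))) (dart-line (w , j)))))
    go (l , false) (.l , true)  ex ey eq | refl = inj₂ (cong proj₁ (trans (cong (λ (m , c) → dart (m , not c)) ex) (trans (cong dart (sym ey)) (dart-line (w , j)))))
    go (l , true)  (.l , false) ex ey eq | refl = inj₂ (cong proj₁ (trans (cong (λ (m , c) → dart (m , not c)) ex) (trans (cong dart (sym ey)) (dart-line (w , j)))))

  simple : IsSimpleGraph graph
  simple = (λ i j → ⇔⇒≡ (edge-sym {i} {j}) (edge-sym {j} {i})) , λ i → irreflexive i (graph i i) refl
    where
    irreflexive : ∀ i b → graph i i ≡ b → b ≡ false
    irreflexive i false eq = refl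
    irreflexive i true  eq = let k , eq′ = edge⁻ {i} {i} (≡⇒T eq) in ⊥-elim (no-loop (from i) k eq′)

  is-cubic : IsCubic graph
  is-cubic i = ℕ.≤-antisym
    (subst (degree graph i ≤_) (length-map neighbour (allFin 3)) (pigeonhole (Unique.filter⁺ (λ j → T? (graph i j)) (Unique.allFin⁺ n)) to-neighbour))
    (subst (_≤ degree graph i) (length-map neighbour (allFin 3)) (pigeonhole (Unique.map⁺ {f = neighbour} (λ {k} {l} eq → no-parallel (from i) k l (to-injective eq)) (Unique.allFin⁺ 3)) from-neighbour))
    where
    neighbour : Fin 3 → Fin n
    neighbour k = to (nb (from i) k)
    to-neighbour : ∀ {j} → j ∈ filter (λ j → T? (graph i j)) (allFin n) → j ∈ map neighbour (allFin 3)
    to-neighbour {j} j∈ = let k , eq = edge⁻ {i} {j} (proj₂ (∈-filter⁻ (λ j → T? (graph i j)) {xs = allFin n} j∈)) in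
      subst (_∈ map neighbour (allFin 3)) (trans (cong to eq) (to-from j)) (∈-map⁺ neighbour (∈-allFin k))
    from-neighbour : ∀ {j} → j ∈ map neighbour (allFin 3) → j ∈ filter (λ j → T? (graph i j)) (allFin n)
    from-neighbour {j} j∈ = let k , _ , eq = ∈-map⁻ neighbour {xs = allFin 3} j∈ in
      ∈-filter⁺ (λ j → T? (graph i j)) (∈-allFin j) (edge⁺ {i} {j} k (trans (sym (from-to _)) (cong from (sym eq))))

  is-connected : (∀ v w → Star (λ v w → ∃ λ i → nb v i ≡ w) v w) → Connected graph
  is-connected paths i j = subst₂ (Star (Edge graph)) (to-from i) (to-from j) (gmap to step (paths (from i) (from j)))
    where
    step : ∀ {v w} → (∃ λ i → nb v i ≡ w) → Edge graph (to v) (to w)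
    step {v} {w} (k , eq) = edge⁺ k (trans (cong (λ v → nb v k) (from-to v)) (trans eq (sym (from-to w))))

  module _ {K : ℕ} (f : Line → Fin K) where

    colouring : (H : Graph n) → (∀ {i j} → Edge H i j → Edge graph i j) → (∀ {i j} → Edge H i j → Rainbow (f ∘ inc (from i))) → IsEdgeColouring H K (λ i j → f (line-of i j))
    colouring H sub rainbow = (λ i j e → cong f (line-of-sym (sub e))) , λ i j l e e′ j≢l same →
      j≢l (from-injective (trans (sym (slot-nb (sub e))) (trans (cong (nb (from i)) (rainbow e (slot i j) (slot i l) same)) (slot-nb (sub e′)))))

  deleted⁻ : ∀ u v i j → Edge (deleteTwoVertices graph u v) i j → Edge graph i j × (i ≢ u × i ≢ v) × (j ≢ u × j ≢ v)
  deleted⁻ u v i j e with graph i j | i Fin.≟ u | i Fin.≟ v | j Fin.≟ u | j Fin.≟ v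
  ... | true | no a | no b | no c | no d = tt , (a , b) , (c , d)

  deleted⁺ : ∀ u v i j → Edge graph i j → i ≢ u → i ≢ v → j ≢ u → j ≢ v → Edge (deleteTwoVertices graph u v) i j
  deleted⁺ u v i j e a b c d with graph i j | i Fin.≟ u | i Fin.≟ v | j Fin.≟ u | j Fin.≟ v
  ... | true | no _   | no _   | no _   | no _   = tt
  ... | _    | yes eq | _      | _      | _      = ⊥-elim (a eq)
  ... | _    | no _   | yes eq | _      | _      = ⊥-elim (b eq)
  ... | _    | no _   | no _   | yes eq | _      = ⊥-elim (c eq)
  ... | _    | no _   | no _   | no _   | yes eq = ⊥-elim (d eq)

  critical : (∀ l → ∃ λ (f : Line → Colour) → ∀ v → (∀ i → inc v i ≢ l) → Rainbow (f ∘ inc v)) →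
    ∀ u v → u ≢ v → Edge graph u v → EdgeColourable (deleteTwoVertices graph u v) 3
  critical broken u v _ e = (λ i j → f (line-of i j)) , colouring f (deleteTwoVertices graph u v) (λ {i} {j} e → proj₁ (deleted⁻ u v i j e))
      λ {i} {j} e′ → let _ , (i≢u , i≢v) , _ = deleted⁻ u v i j e′ in proper (from i) (missed i i≢u i≢v)
    where
    f = proj₁ (broken (line-of u v))
    proper = proj₂ (broken (line-of u v))
    missed : ∀ i → i ≢ u → i ≢ v → ∀ k → inc (from i) k ≢ line-of u v
    missed i i≢u i≢v k eq with same-line (from u) (slot u v) (from i) k (sym eq)
    ... | inj₁ eq′ = i≢u (from-injective (sym eq′))
    ... | inj₂ eq′ = i≢v (from-injective (trans (sym eq′) (slot-nb e)))

  -- A line leading to a or b has another end, where it receives the colour missing there.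
  extend-colouring : ∀ a b → EdgeColourable (deleteTwoVertices graph (to a) (to b)) 3 →
    ∃ λ (f : Line → Colour) → ∀ v → v ≢ a → v ≢ b → Rainbow (f ∘ inc v)
  extend-colouring a b (c , c-sym , c-proper) = f , λ v v≢a v≢b → Rainbow-cong (λ k → sym (f-inc v v≢a v≢b k)) (proj₁ (proj₂ (completed v)))
    where
    H = deleteTwoVertices graph (to a) (to b)
    gone? : ∀ v → Dec (v ≡ a ⊎ v ≡ b)
    gone? v = map′ to-injective (cong to) (to v Fin.≟ to a) ⊎-dec map′ to-injective (cong to) (to v Fin.≟ to b)
    visible : ∀ v k → Dec (nb v k ≡ a ⊎ nb v k ≡ b) → Maybe Colour
    visible v k (yes _) = nothing
    visible v k (no _)  = just (c (to v) (to (nb v k)))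
    partial : V → Fin 3 → Maybe Colour
    partial v k = visible v k (gone? (nb v k))
    H-edge : ∀ v k → ¬ (v ≡ a ⊎ v ≡ b) → ¬ (nb v k ≡ a ⊎ nb v k ≡ b) → Edge H (to v) (to (nb v k))
    H-edge v k p q = deleted⁺ (to a) (to b) (to v) (to (nb v k)) (edge⁺ k (trans (cong (λ v → nb v k) (from-to v)) (sym (from-to (nb v k)))))
      (p ∘ inj₁ ∘ to-injective) (p ∘ inj₂ ∘ to-injective) (q ∘ inj₁ ∘ to-injective) (q ∘ inj₂ ∘ to-injective)
    consistent : ∀ v → ¬ (v ≡ a ⊎ v ≡ b) → Consistent (partial v)
    consistent v p i j = go (gone? (nb v i)) (gone? (nb v j))
      where
      go : ∀ d d′ → visible v i d ≡ visible v j d′ → i ≡ j ⊎ visible v i d ≡ nothing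
      go (yes _) _       eq = inj₂ refl
      go (no q)  (yes _) ()
      go (no q)  (no q′) eq with i Fin.≟ j
      ... | yes i≡j = inj₁ i≡j
      ... | no i≢j  = ⊥-elim (c-proper (to v) (to (nb v i)) (to (nb v j)) (H-edge v i p q) (H-edge v j p q′)
                        (λ eq′ → i≢j (no-parallel v i j (to-injective eq′))) (just-injective eq))
    completed : ∀ v → ∃ λ g → Rainbow g × (¬ (v ≡ a ⊎ v ≡ b) → ∀ i → partial v i ≡ nothing ⊎ partial v i ≡ just (g i))
    completed v with gone? v
    -- At a deleted vertex any three distinct colours will do.
    ... | yes gone = id , (λ _ _ eq → eq) , λ stays → ⊥-elim (stays gone)
    ... | no stays = let g , rainbow , agrees = completion (partial v) (consistent v stays) in g , rainbow , λ _ → agrees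
    at : V × Fin 3 → Colour
    at (v , k) = proj₁ (completed v) k
    pick : ∀ l → Dec (proj₁ (dart (l , false)) ≡ a ⊎ proj₁ (dart (l , false)) ≡ b) → Colour
    pick l (yes _) = at (dart (l , true))
    pick l (no _)  = at (dart (l , false))
    f : Line → Colour
    f l = pick l (gone? (proj₁ (dart (l , false))))
    agree : ∀ v k → ¬ (v ≡ a ⊎ v ≡ b) → ¬ (nb v k ≡ a ⊎ nb v k ≡ b) → at (v , k) ≡ c (to v) (to (nb v k))
    agree v k p q = go (gone? (nb v k)) (proj₂ (proj₂ (completed v)) p k)
      where
      go : ∀ d → visible v k d ≡ nothing ⊎ visible v k d ≡ just (at (v , k)) → at (v , k) ≡ c (to v) (to (nb v k))
      go (yes gone) _         = ⊥-elim (q gone)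
      go (no _)     (inj₂ eq) = sym (just-injective eq)
    agree-far : ∀ v k → ¬ (v ≡ a ⊎ v ≡ b) → ¬ (nb v k ≡ a ⊎ nb v k ≡ b) → at (far (v , k)) ≡ at (v , k)
    agree-far v k p q = trans (agree (nb v k) (proj₂ (far (v , k))) q (λ g → p (subst (λ w → w ≡ a ⊎ w ≡ b) home g)))
      (trans (cong (λ w → c (to (nb v k)) (to w)) home) (trans (sym (c-sym (to v) (to (nb v k)) (H-edge v k p q))) (sym (agree v k p q))))
      where
      home : nb (nb v k) (proj₂ (far (v , k))) ≡ v
      home = cong proj₁ (far-far (v , k))
    f-inc : ∀ v → v ≢ a → v ≢ b → ∀ k → f (inc v k) ≡ at (v , k)
    f-inc v v≢a v≢b k = go (line (v , k)) refl (gone? (proj₁ (dart (inc v k , false))))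
      where
      stays : ¬ (v ≡ a ⊎ v ≡ b)
      stays (inj₁ eq) = v≢a eq
      stays (inj₂ eq) = v≢b eq
      go : ∀ x → line (v , k) ≡ x → ∀ d → pick (inc v k) d ≡ at (v , k)
      go (l , false) eq (no _)     = cong at (trans (cong dart (trans (cong (λ x → proj₁ x , false) eq) (sym eq))) (dart-line (v , k)))
      go (l , false) eq (yes gone) = ⊥-elim (stays (subst (λ w → w ≡ a ⊎ w ≡ b) (cong proj₁ (trans (cong dart (trans (cong (λ x → proj₁ x , false) eq) (sym eq))) (dart-line (v , k)))) gone))
      go (l , true)  eq (yes gone) = cong at (trans (cong dart (trans (cong (λ x → proj₁ x , true) eq) (sym eq))) (dart-line (v , k)))
      go (l , true)  eq (no q)     = trans (cong at other-half) (agree-far v k stays (λ g → q (subst (λ x → proj₁ x ≡ a ⊎ proj₁ x ≡ b) (sym other-half) g)))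
        where
        other-half : dart (inc v k , false) ≡ far (v , k)
        other-half = cong dart (trans (cong (λ x → proj₁ x , false) eq) (cong (λ x → proj₁ x , not (proj₂ x)) (sym eq)))

  Uncolourable : V → V → Set
  Uncolourable a b = ∀ (f : Line → Colour) → ¬ (∀ v → v ≢ a → v ≢ b → Rainbow (f ∘ inc v))

  not-bicritical : ∀ {a b} → a ≢ b → Uncolourable a b → ¬ IsBicritical graph
  not-bicritical {a} {b} a≢b un (_ , bicritical) = let f , proper = extend-colouring a b (bicritical (to a) (to b) (a≢b ∘ to-injective)) in un f proper

  -- A colouring with fewer than four colours would restrict to the graph without `a` and `b`, so
  -- the pair that prevents bicriticality also gives the lower bound.
  chromatic-index : ∀ {a b} → Uncolourable a b → (∃ λ (f : Line → Fin 4) → ∀ v → Rainbow (f ∘ inc v)) → HasChromaticIndex graph 4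
  chromatic-index {a} {b} un (f , proper) = ((λ i j → f (line-of i j)) , colouring f graph id (λ {i} _ → proper (from i))) ,
      λ { m (s≤s m≤3) (c , c-sym , c-proper) → let g , ok = extend-colouring a b (three m≤3 c c-sym c-proper) in un g ok }
    where
    three : ∀ {m} → m ≤ 3 → (c : Fin n → Fin n → Fin m) → (∀ i j → Edge graph i j → c i j ≡ c j i) →
      (∀ i j l → Edge graph i j → Edge graph i l → j ≢ l → c i j ≢ c i l) → EdgeColourable (deleteTwoVertices graph (to a) (to b)) 3
    three m≤3 c c-sym c-proper = (λ i j → Fin.inject≤ (c i j) m≤3) ,
      (λ i j e → cong (λ x → Fin.inject≤ x m≤3) (c-sym i j (sub i j e))) ,
      (λ i j l e e′ j≢l eq → c-proper i j l (sub i j e) (sub i l e′) j≢l (Fin.inject≤-injective m≤3 m≤3 _ _ eq))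
      where
      sub : ∀ i j → Edge (deleteTwoVertices graph (to a) (to b)) i j → Edge graph i j
      sub i j e = proj₁ (deleted⁻ (to a) (to b) i j e)

  cross-both : ∀ A F → (∀ v i → A v ≡ true → A (nb v i) ≡ false → inc v i ∈ F) → Cross A F
  cross-both A F out v i ne = go (A v) (A (nb v i)) refl refl
    where
    go : ∀ x y → A v ≡ x → A (nb v i) ≡ y → inc v i ∈ F
    go true  true  ex ey = ⊥-elim (ne (trans ex (sym ey)))
    go false false ex ey = ⊥-elim (ne (trans ex (sym ey)))
    go true  false ex ey = out v i ex ey
    go false true  ex ey = let j , home , same = back v i in subst (_∈ F) same (out (nb v i) j ey (trans (cong A home) ex))

  module _ (expansion : ∀ A F → Cross A F → length F ≤ 5 → Sparse A F ⊎ Sparse (not ∘ A) F) where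

    three-distinct : ∀ {x y z : V} → x ≢ y → x ≢ z → y ≢ z → Unique (x ∷ y ∷ z ∷ [])
    three-distinct x≢y x≢z y≢z = (x≢y ∷ x≢z ∷ []) ∷ (y≢z ∷ []) ∷ [] ∷ []

    -- Three lines leave a triangle, fewer than expansion allows.
    no-triangle : ∀ {x y z} i j k l p q → nb x i ≡ y → nb x j ≡ z → nb y k ≡ z → nb y l ≡ x → nb z p ≡ x → nb z q ≡ y →
      ∀ (u : Fin 3 → V) → (∀ r s → u r ≡ u s → r ≡ s) → (∀ r → u r ≢ x × u r ≢ y × u r ≢ z) → ⊥
    no-triangle {x} {y} {z} i j k l p q xy xz yz yx zx zy u u-injective u-out = contradiction (expansion A F (cross-both A F leaves) (s≤s (s≤s (s≤s z≤n))))
      where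
      A : V → Bool
      A v = does (to v Fin.≟ to x) ∨ does (to v Fin.≟ to y) ∨ does (to v Fin.≟ to z)
      F : List Line
      F = inc x (third i j) ∷ inc y (third k l) ∷ inc z (third p q) ∷ []
      A-x : A x ≡ true
      A-x = cong (_∨ (does (to x Fin.≟ to y) ∨ does (to x Fin.≟ to z))) (dec-true (to x Fin.≟ to x) refl)
      A-y : A y ≡ true
      A-y with does (to y Fin.≟ to x)
      ... | true  = refl
      ... | false = cong (_∨ does (to y Fin.≟ to z)) (dec-true (to y Fin.≟ to y) refl)
      A-z : A z ≡ true
      A-z with does (to z Fin.≟ to x) | does (to z Fin.≟ to y)
      ... | true  | _     = refl
      ... | false | true  = refl
      ... | false | false = dec-true (to z Fin.≟ to z) refl
      inside : ∀ v → A v ≡ true → v ≡ x ⊎ v ≡ y ⊎ v ≡ z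
      inside v eq with ∨-true (does (to v Fin.≟ to x)) eq
      ... | inj₁ e = inj₁ (to-injective (holds (to v Fin.≟ to x) e))
      ... | inj₂ e with ∨-true (does (to v Fin.≟ to y)) e
      ...   | inj₁ e′ = inj₂ (inj₁ (to-injective (holds (to v Fin.≟ to y) e′)))
      ...   | inj₂ e′ = inj₂ (inj₂ (to-injective (holds (to v Fin.≟ to z) e′)))
      x≢y : x ≢ y
      x≢y eq = no-loop x i (trans xy (sym eq))
      x≢z : x ≢ z
      x≢z eq = no-loop x j (trans xz (sym eq))
      y≢z : y ≢ z
      y≢z eq = no-loop y k (trans yz (sym eq))
      exit : ∀ {v a b} i j k → nb v i ≡ a → nb v j ≡ b → a ≢ b → A a ≡ true → A b ≡ true → A (nb v k) ≡ false → inc v k ≡ inc v (third i j)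
      exit {v} i j k va vb a≢b Aa Ab out = cong (inc v) (third-slot i j k (λ { refl → a≢b (trans (sym va) vb) }) (λ { refl → clash′ va Aa }) (λ { refl → clash′ vb Ab }))
        where
        clash′ : ∀ {a} → nb v k ≡ a → A a ≡ true → ⊥
        clash′ refl t with trans (sym t) out
        ... | ()
      leaves : ∀ v m → A v ≡ true → A (nb v m) ≡ false → inc v m ∈ F
      leaves v m at out with inside v at
      ... | inj₁ refl        = here (exit i j m xy xz y≢z A-y A-z out)
      ... | inj₂ (inj₁ refl) = there (here (exit k l m yz yx (x≢z ∘ sym) A-z A-x out))
      ... | inj₂ (inj₂ refl) = there (there (here (exit p q m zx zy x≢y A-x A-y out)))
      contradiction : Sparse A F ⊎ Sparse (not ∘ A) F → ⊥
      contradiction (inj₁ sparse) with sparse (x ∷ y ∷ z ∷ []) (s≤s z≤n) (three-distinct x≢y x≢z y≢z) (λ { (here refl) → A-x ; (there (here refl)) → A-y ; (there (there (here refl))) → A-z })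
      ... | s≤s (s≤s (s≤s ()))
      contradiction (inj₂ sparse) with sparse (map u (allFin 3)) (s≤s z≤n) (Unique.map⁺ {f = u} (λ {r} {s} → u-injective r s) (Unique.allFin⁺ 3))
            (λ v∈ → let r , _ , eq = ∈-map⁻ u {xs = allFin 3} v∈ in subst (λ v → not (A v) ≡ true) (sym eq) (outside r (A (u r)) refl))
        where
        outside : ∀ r b → A (u r) ≡ b → not b ≡ true
        outside r false _ = refl
        outside r true eq with inside (u r) eq
        ... | inj₁ e        = ⊥-elim (proj₁ (u-out r) e)
        ... | inj₂ (inj₁ e) = ⊥-elim (proj₁ (proj₂ (u-out r)) e)
        ... | inj₂ (inj₂ e) = ⊥-elim (proj₂ (proj₂ (u-out r)) e)
      ... | s≤s (s≤s (s≤s ()))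

    -- The set reached from the first cycle has its boundary in `F`. Each side contains a cycle, but
    -- by `expansion` one side has at most three vertices; its cycle is a triangle, around which a
    -- smaller cut gives the contradiction.
    cyclically-6-connected : CyclicallyConnected 6 graph
    cyclically-6-connected F₀ F₀<6 (C₁@(m₁ , f₁ , inj-f₁ , path₁ , close₁) , C₂@(m₂ , f₂ , inj-f₂ , path₂ , close₂) , separated) =
        ¬¬-decide (λ i → Star (Edge H) (f₁ zero) i) conclude
      where
      H : Graph n
      H = deleteEdges graph F₀
      H⇒graph : ∀ {i j} → Edge H i j → Edge graph i j
      H⇒graph e = ≡⇒T (proj₁ (∧-true _ (T⇒≡ e)))
      -- A pair that is not an edge is sent to some line as well; this leaves the length unchanged,
      -- and `Cross` only asks that `F` contain the boundary.
      F : List Line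
      F = map (λ (i , j) → line-of i j) F₀
      F≤5 : length F ≤ 5
      F≤5 = subst (_≤ 5) (sym (length-map _ F₀)) (ℕ.≤-pred F₀<6)
      found : {P : Set} (p? : Dec P) → ⌊ p? ⌋ ≡ true → P
      found p? eq = toWitness {a? = p?} (≡⇒T eq)
      kept-or-cut : ∀ i j → Edge graph i j → Edge H i j ⊎ line-of i j ∈ F
      kept-or-cut i j e = go (any (sameEdge i j) F₀) refl
        where
        go : ∀ b → any (sameEdge i j) F₀ ≡ b → Edge H i j ⊎ line-of i j ∈ F
        go false eq = inj₁ (≡⇒T (cong₂ (λ a b → a ∧ not b) (T⇒≡ e) eq))
        go true  eq with any-sound (sameEdge i j) F₀ eq
        ... | (a , b) , ab∈ , same with ∨-true (⌊ a Fin.≟ i ⌋ ∧ ⌊ b Fin.≟ j ⌋) same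
        ...   | inj₁ eq′ = inj₂ (subst (_∈ F) (cong₂ line-of (found (a Fin.≟ i) (proj₁ (∧-true _ eq′))) (found (b Fin.≟ j) (proj₂ (∧-true (⌊ a Fin.≟ i ⌋) eq′))))
                                       (∈-map⁺ (λ (i , j) → line-of i j) ab∈))
        ...   | inj₂ eq′ = inj₂ (subst (_∈ F) (trans (cong₂ line-of (found (a Fin.≟ j) (proj₁ (∧-true _ eq′))) (found (b Fin.≟ i) (proj₂ (∧-true (⌊ a Fin.≟ j ⌋) eq′))))
                                                     (sym (line-of-sym e))) (∈-map⁺ (λ (i , j) → line-of i j) ab∈))
      reached₁ : ∀ i → Star (Edge H) (f₁ zero) (f₁ i)
      reached₁ = <-weakInduction (λ i → Star (Edge H) (f₁ zero) (f₁ i)) ε (λ i s → s ◅◅ (path₁ i ◅ ε))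
      refute : ∀ A → Sparse A F → ∀ {m m′} (f : Fin (3 + m) → Fin n) (g : Fin (3 + m′) → Fin n) →
        (∀ {i j} → f i ≡ f j → i ≡ j) → (∀ {i j} → g i ≡ g j → i ≡ j) →
        (∀ i → Edge graph (f (Fin.inject₁ i)) (f (suc i))) → Edge graph (f (fromℕ (2 + m))) (f zero) →
        (∀ i → A (from (f i)) ≡ true) → (∀ i → A (from (g i)) ≡ false) → ⊥
      refute A sparse {suc m} f g f-inj g-inj path close in-A out-A = ℕ.<⇒≱ (s≤s F≤5)
        (sparse (map vertex₄ (allFin 4)) (s≤s z≤n) (Unique.map⁺ {f = vertex₄} (λ {i} {j} eq → Fin.inject≤-injective four≤ four≤ i j (f-inj (from-injective eq))) (Unique.allFin⁺ 4))
          (λ v∈ → let i , _ , eq = ∈-map⁻ vertex₄ {xs = allFin 4} v∈ in subst (λ v → A v ≡ true) (sym eq) (in-A _)))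
        where
        four≤ : 4 ≤ 4 + m
        four≤ = s≤s (s≤s (s≤s (s≤s z≤n)))
        vertex₄ : Fin 4 → V
        vertex₄ i = from (f (Fin.inject≤ i four≤))
      -- Three vertices satisfy 2 + 3 ≤ 5, so a triangle is refuted by the three lines leaving it;
      -- three vertices of the other cycle show that the complement is no exception.
      refute A sparse {zero} {m′} f g f-inj g-inj path close in-A out-A =
          no-triangle _ _ _ _ _ _ (proj₂ xy) (proj₂ xz) (proj₂ yz) (proj₂ yx) (proj₂ zx) (proj₂ zy)
            (λ r → from (g (Fin.inject≤ r three≤))) (λ r s eq → Fin.inject≤-injective three≤ three≤ r s (g-inj (from-injective eq)))
            (λ r → apart r zero , apart r (# 1) , apart r (# 2))
        where
        three≤ : 3 ≤ 3 + m′
        three≤ = s≤s (s≤s (s≤s z≤n))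
        apart : ∀ r i → from (g (Fin.inject≤ r three≤)) ≢ from (f i)
        apart r i eq with trans (sym (in-A i)) (trans (sym (cong A eq)) (out-A (Fin.inject≤ r three≤)))
        ... | ()
        xy = edge⁻ {f zero} {f (# 1)} (path zero)
        yz = edge⁻ {f (# 1)} {f (# 2)} (path (# 1))
        zx = edge⁻ {f (# 2)} {f zero} close
        yx = edge⁻ {f (# 1)} {f zero} (edge-sym {f zero} {f (# 1)} (path zero))
        zy = edge⁻ {f (# 2)} {f (# 1)} (edge-sym {f (# 1)} {f (# 2)} (path (# 1)))
        xz = edge⁻ {f zero} {f (# 2)} (edge-sym {f (# 2)} {f zero} close)
      conclude : (∀ i → Dec (Star (Edge H) (f₁ zero) i)) → ⊥
      conclude reach? = finish (expansion A F (cross-both A F leaves) F≤5)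
        where
        A : V → Bool
        A v = does (reach? (to v))
        leaves : ∀ v i → A v ≡ true → A (nb v i) ≡ false → inc v i ∈ F
        leaves v i at out = go (kept-or-cut (to v) (to (nb v i)) e)
          where
          joined : nb (from (to v)) i ≡ from (to (nb v i))
          joined = trans (cong (λ v → nb v i) (from-to v)) (sym (from-to (nb v i)))
          e : Edge graph (to v) (to (nb v i))
          e = edge⁺ i joined
          go : Edge H (to v) (to (nb v i)) ⊎ line-of (to v) (to (nb v i)) ∈ F → inc v i ∈ F
          go (inj₂ l∈) = subst (_∈ F) (line-of-≡ v i (from-to v) (sym (from-to (nb v i)))) l∈
          go (inj₁ h) with trans (sym out) (dec-true (reach? (to (nb v i))) (holds (reach? (to v)) at ◅◅ (h ◅ ε)))
          ... | ()
        in₁ : ∀ i → A (from (f₁ i)) ≡ true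
        in₁ i = trans (cong (λ j → does (reach? j)) (to-from (f₁ i))) (dec-true (reach? (f₁ i)) (reached₁ i))
        out₂ : ∀ i → A (from (f₂ i)) ≡ false
        out₂ i = trans (cong (λ j → does (reach? j)) (to-from (f₂ i))) (dec-false (reach? (f₂ i)) (separated zero i))
        finish : Sparse A F ⊎ Sparse (not ∘ A) F → ⊥
        finish (inj₁ sparse) = refute A sparse f₁ f₂ inj-f₁ inj-f₂ (λ i → H⇒graph (path₁ i)) (H⇒graph close₁) in₁ out₂
        finish (inj₂ sparse) = refute (not ∘ A) sparse f₂ f₁ inj-f₂ inj-f₁ (λ i → H⇒graph (path₂ i)) (H⇒graph close₂) (λ i → cong not (out₂ i)) (λ i → cong not (in₁ i))

-- Choice of the poles and orders obtained

sizes : ∀ k → (Fin k → ℕ) → ℕ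
sizes zero    m = 0
sizes (suc k) m = m zero + sizes k (m ∘ suc)

Σ↔ : ∀ k (X : Fin k → Set) (m : Fin k → ℕ) → (∀ e → X e ↔ Fin (m e)) → Σ (Fin k) X ↔ Fin (sizes k m)
Σ↔ zero    X m f = mk↔ₛ′ (λ ()) (λ ()) (λ ()) (λ ())
Σ↔ (suc k) X m f = ↔-sym (Fin.+↔⊎ {m zero} {sizes k (m ∘ suc)}) ↔-∘
  ((f zero ⊎-↔ Σ↔ k (X ∘ suc) (m ∘ suc) (f ∘ suc)) ↔-∘ mk↔ₛ′ split unsplit split-unsplit unsplit-split)
  where
  split : Σ (Fin (suc k)) X → X zero ⊎ Σ (Fin k) (X ∘ suc)
  split (zero , x)  = inj₁ x
  split (suc e , x) = inj₂ (e , x)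
  unsplit : X zero ⊎ Σ (Fin k) (X ∘ suc) → Σ (Fin (suc k)) X
  unsplit (inj₁ x)       = zero , x
  unsplit (inj₂ (e , x)) = suc e , x
  split-unsplit : ∀ y → split (unsplit y) ≡ y
  split-unsplit (inj₁ x)       = refl
  split-unsplit (inj₂ (e , x)) = refl
  unsplit-split : ∀ y → unsplit (split y) ≡ y
  unsplit-split (zero , x)  = refl
  unsplit-split (suc e , x) = refl

Required : ∀ n → Graph n → Set
Required n G = IsSnark G × CyclicallyConnected 6 G × IsStrictlyCritical G

module Result (S : Fin 15 → Pole) (superedge : ∀ e → IsSuperedge (S e))
              (f₀ : Pole.Line (S zero) → Fin 4) (c : Fin 2 → Fin 3 → Colour) (f₀-proper : ∀ v → Rainbow (f₀ ∘ Pole.inc (S zero) v))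
              (f₀-ports : ∀ σ i → f₀ (Pole.pline (S zero) σ i) ≡ Fin.inject₁ (c σ i)) (c-rainbow : ∀ σ → Rainbow (c σ)) where
  open Assembly S superedge
  open Expansion S superedge using (expansion)

  order : ℕ
  order = 30 + sizes 15 I.size

  index : V ↔ Fin order
  index = ↔-sym (Fin.+↔⊎ {30} {sizes 15 I.size}) ↔-∘ (↔-sym (Fin.*↔× {10} {3}) ⊎-↔ Σ↔ 15 S.V I.size I.index)

  open Realise cubic index no-loop no-parallel

  required : ∃ (Required order)
  required = graph , snark , cyclically-6-connected expansion , (snark , critical broken) , not-bicritical {apart} {apart′} (λ ()) uncolourable
    where
    snark : IsSnark graph
    snark = simple , is-cubic , is-connected connected , chromatic-index {apart} {apart′} uncolourable (four-colouring f₀ c f₀-proper f₀-ports c-rainbow)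

-- Edge 0 has the shortest flower because `four-table` colours that pole; edge 1 has the long
-- flower, and `r` of the other thirteen edges have the pole with 24 vertices.
module Selection (t r : ℕ) where

  S : Fin 15 → Σ Pole IsSuperedge
  S zero          = flower 0 , superedge-flower 0
  S (suc zero)    = flower t , superedge-flower t
  S (suc (suc e)) = if Fin.toℕ e <ᵇ r then (Pole₂₄.pole₂₄ , Pole₂₄.superedge₂₄) else (flower 0 , superedge-flower 0)

  open Result (proj₁ ∘ S) (proj₂ ∘ S) Base.four Base.four-ports
    (λ v → All.lookup Base.four-rainbow (FlowerStructure.∈-vertices 2 v)) Base.four-ports-≡ Base.four-ports-rainbow public

double-*4 : ∀ t → double t * 4 ≡ t * 8
double-*4 zero    = refl
double-*4 (suc t) = cong (8 +_) (double-*4 t)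

-- The 66 vertices are the 30 new ones and 18 each in the poles of edge 0 and, for `t` = 0, of edge
-- 1.
exists : ∀ t r n → 66 + (double t * 4 + sizes 13 (λ e → IsSuperedge.size (proj₂ (Selection.S t r (suc (suc e)))))) ≡ n → ∃ (Required n)
exists t r n refl = Selection.required t r

-- Each further pair of segments of the long flower adds 8 vertices.
in-class : ∀ r c ρ n → ρ + c * 8 ≡ 66 + sizes 13 (λ e → IsSuperedge.size (proj₂ (Selection.S 0 r (suc (suc e))))) →
  n % 8 ≡ ρ → c * 8 ≤ n → ∃ (Required n)
in-class r c ρ n base residue c*8≤n = exists t r n (trans (cong (λ m → 66 + (m + K)) (double-*4 t))
    (trans (solve 2 (λ a k → con 66 :+ (a :+ k) := con 66 :+ k :+ a) refl (t * 8) K)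
    (trans (cong (_+ t * 8) (sym base))
    (trans (ℕ.+-assoc ρ (c * 8) (t * 8))
    (trans (cong (ρ +_) (sym (ℕ.*-distribʳ-+ 8 c t)))
    (trans (cong₂ (λ ρ q → ρ + q * 8) (sym residue) (ℕ.m+[n∸m]≡n c≤))
           (sym (m≡m%n+[m/n]*n n 8))))))))
  where
  open +-*-Solver
  -- Both `n` and the order for `t` = 0 have remainder `ρ` modulo 8, so the quotients tell how many
  -- pairs of segments to add.
  t = n / 8 ∸ c
  K = sizes 13 (λ e → IsSuperedge.size (proj₂ (Selection.S 0 r (suc (suc e)))))
  c≤ : c ≤ n / 8
  c≤ = subst (_≤ n / 8) (m*n/n≡m c 8) (/-monoˡ-≤ 8 c*8≤n)

theorem6 : (n : ℕ) →
    ((n % 8 ≡ 0 × 320 ≤ n) ⊎ (n % 8 ≡ 2 × 306 ≤ n) ⊎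
    (n % 8 ≡ 4 × 324 ≤ n) ⊎ (n % 8 ≡ 6 × 342 ≤ n)) →
    Σ (Graph n) λ G → IsSnark G × CyclicallyConnected 6 G × IsStrictlyCritical G
-- The values of `c` come from 300 + 6r: 312 = 39 * 8, 306 = 38 * 8 + 2, 300 = 37 * 8 + 4 and 318 =
-- 39 * 8 + 6.
theorem6 n (inj₁ (residue , le))               = in-class 2 39 0 n refl residue (ℕ.≤-trans (ℕ.m≤n+m 312 8) le)
theorem6 n (inj₂ (inj₁ (residue , le)))        = in-class 1 38 2 n refl residue (ℕ.≤-trans (ℕ.m≤n+m 304 2) le)
theorem6 n (inj₂ (inj₂ (inj₁ (residue , le)))) = in-class 0 37 4 n refl residue (ℕ.≤-trans (ℕ.m≤n+m 296 28) le)
theorem6 n (inj₂ (inj₂ (inj₂ (residue , le)))) = in-class 3 39 6 n refl residue (ℕ.≤-trans (ℕ.m≤n+m 312 30) le)
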